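{- Let $(\Sigma,\omega)$ be an oriented signed graph and let $f$ be an integral flow on $(\Sigma,\omega)$. Then $f$ is conformally indecomposable if and only if the support subgraph $\Sigma(f)$ is a sesqui-Eulerian circle-tree and there is a direction of $\Sigma(f)$, denoted $\omega_f$, such that \[ f=[\omega,\omega_f]\, I_{\Sigma(f)} . \]
   Context: All graphs are finite; loops and multiple edges are allowed. A signed graph $\Sigma$ is a graph with a sign function $\sigma:E(\Sigma)\to\{+1,-1\}$. Each edge $e$ has two ends (incidences) $(u,e),(v,e)$, where $u,v$ are its endpoints; a loop has two distinct ends at the same vertex. A circle is a connected 2-regular subgraph; its sign is the product of the signs of its edges. An orientation $\omega$ of $\Sigma$ assigns to each edge end $(v,e)$ a value $\omega(v,e)\in\{+1,-1\}$ such that $\sigma(e)=-\omega(u,e)\omega(v,e)$ for every edge $e$ with ends $(u,e),(v,e)$. A sink (resp. source) is a vertex $v$ with $\omega(v,e)=+1$ (resp. $-1$) for all ends $(v,e)$ at $v$. For two orientations $\omega_1,\omega_2$ defined on subgraphs, the coupling is $[\omega_1,\omega_2](e)=\omega_1(v,e)\omega_2(v,e)$ (for either end $(v,e)$) if $e$ lies in both subgraphs, and $0$ otherwise. The boundary of $g:E(\Sigma)\to\mathbb Z$ is $\partial g(v)=\sum_{(v,e)}\omega(v,e)g(e)$, the sum over all edge ends at $v$ (a loop contributes for both of its ends). An integral flow is $f:E(\Sigma)\to\mathbb Z$ with $\partial f\equiv 0$. $\Sigma(f)$ is the subgraph consisting of the edges $e$ with $f(e)\neq 0$ and their endpoints.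 A flow $f$ is conformally decomposable if it is nonzero and $f=f_1+f_2$ with $f_1,f_2$ nonzero integral flows satisfying $f_1(e)f_2(e)\ge 0$ for all edges $e$; it is conformally indecomposable if it is nonzero and not conformally decomposable. A block of a graph is a maximal connected subgraph without cut-vertices, where a cut-vertex is a vertex whose deletion increases the number of components, or a vertex incident with a loop and at least one other edge (so loops, cut-edges and isolated vertices are blocks). An end block is a block that shares a vertex with exactly one other block. A circle-tree is a signed graph $T$ with nonempty edge set such that: (a) $T$ is connected; (b) each block is a circle or a single edge; (c) each end block is a circle; (d) each cut-vertex is incident with exactly two blocks. Blocks that are circles are circle blocks; the block paths are the paths (possibly of length zero) connecting pairs of circle blocks through non-circle blocks (a block path of length $0$ is a common vertex of two circle blocks). $T$ is a sesqui-Eulerian circle-tree if moreover every circle block has sign $(-1)^p$, where $p$ is the number of cut-vertices of $T$ on that circle. A direction of a sesqui-Eulerian circle-tree $T$ is an orientation $\omega_T$ of $T$ such that $(T,\omega_T)$ has no sink and no source, and for each circle block $C$, the oriented circle $(C,\omega_T)$ has a sink or a source at each cut-vertex of $T$ lying on $C$. For a circle-tree $T$ in $\Sigma$, the indicator $I_T:E(\Sigma)\to\mathbb Z$ is $1$ on edges of circle blocks, $2$ on edges of block paths, and $0$ elsewhere. -}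

module Defs where

open import Data.Nat as ℕ using (ℕ; zero; suc)
open import Data.Integer as ℤ using (ℤ; _◃_; 0ℤ; 1ℤ)
open import Data.Sign as S using (Sign; opposite)
open import Data.Bool using (Bool; true; false; not; _∧_; _∨_; if_then_else_)
open import Data.Fin using (Fin; zero; suc; inject₁; fromℕ)
open import Data.Fin.Properties using (_≟_)
open import Data.List using (List; foldr; allFin; length)
open import Data.Bool.ListAction using (any)
open import Data.List.Membership.Propositional using (_∈_)
open import Data.List.Relation.Unary.Unique.Propositional using (Unique)
open import Data.Product using (Σ; ∃; ∃₂; _×_; _,_)
open import Data.Sum using (_⊎_)
open import Relation.Nullary using (¬_; does)
open import Relation.Binary.PropositionalEquality using (_≡_; _≢_)
open import Function.Bundles using (_⇔_)

-- Signed graphs: vertices Fin n, edges Fin m.  Each edge e has two ends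
-- (e , false) and (e , true); endpt e b is the vertex of the end (e , b).
-- A loop is an edge with endpt e false ≡ endpt e true (two distinct ends).

record SignedGraph (n m : ℕ) : Set where
  field
    endpt : Fin m → Bool → Fin n
    σ     : Fin m → Sign

EndSigns : ℕ → Set
EndSigns m = Fin m → Bool → Sign

record Sub (n m : ℕ) : Set where
  constructor sub
  field
    V : Fin n → Bool
    E : Fin m → Bool
open Sub public

sumℤ : List ℤ → ℤ
sumℤ = foldr ℤ._+_ 0ℤ

sumℕ : List ℕ → ℕ
sumℕ = foldr ℕ._+_ 0

ind : Bool → ℕ
ind true  = 1
ind false = 0

signPow : ℕ → Sign
signPow zero    = S.+
signPow (suc p) = opposite (signPow p)

Count : ∀ {n} → (Fin n → Set) → ℕ → Set
Count {n} P k = ∃ λ (xs : List (Fin n)) →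
  Unique xs × (∀ v → (v ∈ xs) ⇔ P v) × length xs ≡ k

module _ {n m : ℕ} (G : SignedGraph n m) where
  open SignedGraph G

  IsOrientationOn : (Fin m → Bool) → EndSigns m → Set
  IsOrientationOn E ω =
    ∀ e → E e ≡ true → σ e ≡ opposite (ω e false S.* ω e true)

  IsOrientation : EndSigns m → Set
  IsOrientation = IsOrientationOn (λ _ → true)

  boundary : EndSigns m → (Fin m → ℤ) → Fin n → ℤ
  boundary ω g v = sumℤ (Data.List.map term (allFin m))
    where
    endTerm : Fin m → Bool → ℤ
    endTerm e b = if does (endpt e b ≟ v) then (ω e b ◃ 1) ℤ.* g e else 0ℤ
    term : Fin m → ℤ
    term e = endTerm e false ℤ.+ endTerm e true

  IsFlow : EndSigns m → (Fin m → ℤ) → Set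
  IsFlow ω f = ∀ v → boundary ω f v ≡ 0ℤ

  NonZero : (Fin m → ℤ) → Set
  NonZero f = ¬ (∀ e → f e ≡ 0ℤ)

  ConfDecomposable : EndSigns m → (Fin m → ℤ) → Set
  ConfDecomposable ω f = NonZero f × ∃₂ λ f₁ f₂ →
    IsFlow ω f₁ × IsFlow ω f₂ × NonZero f₁ × NonZero f₂ ×
    (∀ e → f e ≡ f₁ e ℤ.+ f₂ e) × (∀ e → 0ℤ ℤ.≤ f₁ e ℤ.* f₂ e)

  ConfIndecomposable : EndSigns m → (Fin m → ℤ) → Set
  ConfIndecomposable ω f = NonZero f × ¬ ConfDecomposable ω f

  nz : (Fin m → ℤ) → Fin m → Bool
  nz f e = not (does (f e ℤ.≟ 0ℤ))

  incidentB : Fin m → Fin n → Bool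
  incidentB e v = does (endpt e false ≟ v) ∨ does (endpt e true ≟ v)

  supp : (Fin m → ℤ) → Sub n m
  supp f = sub (λ v → any (λ e → nz f e ∧ incidentB e v) (allFin m)) (nz f)

  WellFormed : Sub n m → Set
  WellFormed H = ∀ e b → E H e ≡ true → V H (endpt e b) ≡ true

  SubOf : Sub n m → Sub n m → Set
  SubOf H K = (∀ v → V H v ≡ true → V K v ≡ true) ×
              (∀ e → E H e ≡ true → E K e ≡ true)

  SameSub : Sub n m → Sub n m → Set
  SameSub H K = (∀ v → V H v ≡ V K v) × (∀ e → E H e ≡ E K e)

  data Reach (E : Fin m → Bool) : Fin n → Fin n → Set where
    here : ∀ {x} → Reach E x x
    step : ∀ {x y} e b → E e ≡ true → endpt e b ≡ x →
           Reach E (endpt e (not b)) y → Reach E x y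

  Connected : Sub n m → Set
  Connected H = (∃ λ v → V H v ≡ true) ×
    (∀ x y → V H x ≡ true → V H y ≡ true → Reach (E H) x y)

  deleteV : Sub n m → Fin n → Sub n m
  deleteV H v = sub (λ x → V H x ∧ not (does (x ≟ v)))
                    (λ e → E H e ∧ not (incidentB e v))

  IsLoop : Fin m → Set
  IsLoop e = endpt e false ≡ endpt e true

  Incident : Fin m → Fin n → Set
  Incident e v = endpt e false ≡ v ⊎ endpt e true ≡ v

  -- cut-vertex: deleting v increases the number of components (i.e. two
  -- vertices of H − v connected in H become disconnected in H − v), or v is
  -- incident with a loop and at least one other edge.
  CutVertex : Sub n m → Fin n → Set
  CutVertex H v = V H v ≡ true ×
    ((∃₂ λ x y → V (deleteV H v) x ≡ true × V (deleteV H v) y ≡ true ×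
                  Reach (E H) x y × ¬ Reach (E (deleteV H v)) x y)
     ⊎
     (∃₂ λ e e′ → E H e ≡ true × IsLoop e × endpt e false ≡ v ×
                  E H e′ ≡ true × e′ ≢ e × Incident e′ v))

  NoCutVertex : Sub n m → Set
  NoCutVertex H = ∀ v → ¬ CutVertex H v

  deg : (Fin m → Bool) → Fin n → ℕ
  deg E v = sumℕ (Data.List.map d (allFin m))
    where
    d : Fin m → ℕ
    d e = if E e then ind (does (endpt e false ≟ v)) ℕ.+ ind (does (endpt e true ≟ v))
          else 0

  IsCircle : Sub n m → Set
  IsCircle H = WellFormed H × Connected H × (∀ v → V H v ≡ true → deg (E H) v ≡ 2)

  circleSign : Sub n m → Sign
  circleSign C = foldr (λ e s → if E C e then σ e S.* s else s) S.+ (allFin m)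

  IsBlock : Sub n m → Sub n m → Set
  IsBlock T B = WellFormed B × SubOf B T × Connected B × NoCutVertex B ×
    (∀ B′ → WellFormed B′ → SubOf B′ T → Connected B′ → NoCutVertex B′ →
            SubOf B B′ → SubOf B′ B)

  SingleEdge : Sub n m → Set
  SingleEdge H = ∃ λ e → ∀ e′ → (E H e′ ≡ true) ⇔ (e′ ≡ e)

  SharesVertex : Sub n m → Sub n m → Set
  SharesVertex B B′ = ∃ λ v → V B v ≡ true × V B′ v ≡ true

  EndBlock : Sub n m → Sub n m → Set
  EndBlock T B = ∃ λ B′ → IsBlock T B′ × ¬ SameSub B′ B × SharesVertex B B′ ×
    (∀ B″ → IsBlock T B″ → ¬ SameSub B″ B → SharesVertex B B″ → SameSub B″ B′)

  CircleTree : Sub n m → Set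
  CircleTree T =
    (∃ λ e → E T e ≡ true) ×
    Connected T ×
    (∀ B → IsBlock T B → IsCircle B ⊎ SingleEdge B) ×
    (∀ B → IsBlock T B → EndBlock T B → IsCircle B) ×
    (∀ v → CutVertex T v → ∃₂ λ B₁ B₂ →
       IsBlock T B₁ × IsBlock T B₂ × V B₁ v ≡ true × V B₂ v ≡ true ×
       ¬ SameSub B₁ B₂ ×
       (∀ B → IsBlock T B → V B v ≡ true → SameSub B B₁ ⊎ SameSub B B₂))

  SesquiEulerianCircleTree : Sub n m → Set
  SesquiEulerianCircleTree T = CircleTree T ×
    (∀ C → IsBlock T C → IsCircle C → ∃ λ p →
       Count (λ v → CutVertex T v × V C v ≡ true) p × circleSign C ≡ signPow p)

  Sink : (Fin m → Bool) → EndSigns m → Fin n → Set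
  Sink E ω v = ∀ e b → E e ≡ true → endpt e b ≡ v → ω e b ≡ S.+

  Source : (Fin m → Bool) → EndSigns m → Fin n → Set
  Source E ω v = ∀ e b → E e ≡ true → endpt e b ≡ v → ω e b ≡ S.-

  Direction : Sub n m → EndSigns m → Set
  Direction T ωT = IsOrientationOn (E T) ωT ×
    (∀ v → V T v ≡ true → ¬ Sink (E T) ωT v × ¬ Source (E T) ωT v) ×
    (∀ C → IsBlock T C → IsCircle C → ∀ v → CutVertex T v → V C v ≡ true →
       Sink (E C) ωT v ⊎ Source (E C) ωT v)

  coupling : EndSigns m → EndSigns m → Sub n m → Fin m → ℤ
  coupling ω ωT T e = if E T e then (ω e false S.* ωT e false) ◃ 1 else 0ℤ

  InCircleBlock : Sub n m → Fin m → Set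
  InCircleBlock T e = ∃ λ C → IsBlock T C × IsCircle C × E C e ≡ true

  OnBlockPath : Sub n m → Fin m → Set
  OnBlockPath T e = ∃ λ k → Σ (Fin (suc k) → Fin n) λ vs → Σ (Fin k → Fin m) λ es →
    (∀ i j → vs i ≡ vs j → i ≡ j) ×
    (∀ i → E T (es i) ≡ true ×
           (∃ λ b → endpt (es i) b ≡ vs (inject₁ i) × endpt (es i) (not b) ≡ vs (suc i)) ×
           (∃ λ B → IsBlock T B × ¬ IsCircle B × E B (es i) ≡ true)) ×
    (∃₂ λ C₁ C₂ → IsBlock T C₁ × IsCircle C₁ × IsBlock T C₂ × IsCircle C₂ ×
                  ¬ SameSub C₁ C₂ × V C₁ (vs zero) ≡ true × V C₂ (vs (fromℕ k)) ≡ true) ×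
    (∃ λ i → es i ≡ e)

  IsIndicator : Sub n m → (Fin m → ℤ) → Set
  IsIndicator T I = ∀ e →
    (InCircleBlock T e → I e ≡ 1ℤ) ×
    (OnBlockPath T e → I e ≡ ℤ.+ 2) ×
    (¬ InCircleBlock T e → ¬ OnBlockPath T e → I e ≡ 0ℤ)

{-# OPTIONS --safe #-}

-- Switching the edges on which f is negative turns f into a flow g ≥ 0.  If g is indecomposable, it is traced
-- by a single closed walk which alternates signs at every vertex and never repeats a state (vertex, departing
-- sign).  When a vertex v is visited twice, reversing the half of the walk between the two visits gives another
-- such walk, which forces the two halves to meet only at v.  Hence g uses exactly 2 of every block at each of
-- its vertices and at most 4 at any vertex: blocks are circles (g = 1) or bridges (g = 2), and a cut-vertex
-- lies in two blocks.  The signs of the two ends of a block at a cut-vertex agree, since otherwise the part of g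
-- hanging off the block would be a flow.  Conversely, by parity a flow below the indicator of a directed
-- circle-tree uses 0 or 2 of each block at each of its vertices, and by conservation and connectedness it is
-- zero or everything.

module Submission where

open import Defs
open import Data.Nat as ℕ using (ℕ; zero; suc; _+_; _≤_; _<_; z≤n; s≤s)
open import Data.Nat.Properties as ℕₚ using (≤-refl; ≤-trans; ≤-antisym; ≤-reflexive; +-comm; +-assoc; +-identityʳ; +-cancelˡ-≡; +-cancelʳ-≡; m+n≡0⇒m≡0; m+n≡0⇒n≡0; m≤m+n; m≤n+m; +-mono-≤; n≢0⇒n>0; +-suc)
open import Data.Nat.Divisibility using (_∣_; divides; ∣m∣n⇒∣m+n; ∣m+n∣m⇒∣n; _∣0; ∣⇒≤)
open import Data.Nat.Solver using (module +-*-Solver)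
open import Data.Integer as ℤ using (ℤ; _*_; _◃_; 0ℤ; 1ℤ)
import Data.Integer.Properties as ℤₚ
import Data.Integer.Solver as ℤ-Solver
open import Data.Sign as S using (Sign; opposite)
open import Data.Sign.Properties using (s*s≡+; opposite-involutive; opposite-injective; s≢opposite[s]) renaming (_≟_ to _≟ₛ_)
open import Data.Bool using (Bool; true; false; not; _∧_; _∨_; if_then_else_)
open import Data.Bool.Properties using (not-involutive; ∧-zeroʳ; ∨-zeroʳ; ∧-identityʳ) renaming (_≟_ to _≟ᵇ_)
open import Data.Fin using (Fin; zero; suc; inject₁; fromℕ)
open import Data.Fin.Properties using (_≟_; any?; all?; injective⇒≤)
open import Data.List using (List; []; _∷_; foldr; allFin; tabulate; length; filter)
open import Data.List.Properties using (map-cong)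
open import Data.Bool.ListAction using (any)
open import Data.List.Membership.Propositional using (_∈_)
open import Data.List.Membership.Propositional.Properties using (∈-allFin; ∈-filter⁺; ∈-filter⁻)
open import Data.List.Relation.Unary.Unique.Propositional.Properties using (filter⁺; allFin⁺)
open import Data.List.Relation.Unary.Any using (here; there)
open import Data.Product using (Σ; ∃; ∃₂; _×_; _,_; proj₁; proj₂)
open import Data.Product.Properties using (≡-dec)
open import Data.Sum using (_⊎_; inj₁; inj₂; [_,_])
open import Data.Fin.Subset using (Subset)
open import Data.Fin.Subset.Properties using (anySubset?)
import Data.Vec as Vec
open import Data.Vec.Properties using (lookup∘tabulate)
open import Data.Unit using (⊤; tt)
open import Data.Empty using (⊥; ⊥-elim)
open import Relation.Binary.Definitions using (tri<; tri≈; tri>)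
open import Relation.Nullary using (¬_; Dec; yes; no; does)
open import Relation.Nullary.Decidable using (dec-true; dec-false; decidable-stable; _×-dec_; _⊎-dec_; _→-dec_; ¬?; map′)
open import Relation.Binary.PropositionalEquality using (_≡_; _≢_; refl; sym; trans; cong; cong₂; subst; module ≡-Reasoning)
open import Function using (_∘_; id; case_of_)
open import Function.Bundles using (_⇔_; mk⇔; Equivalence)
open import Algebra.Properties.CommutativeMonoid.Sum ℕₚ.+-0-commutativeMonoid using (sum; sum-cong-≗; ∑-distrib-+; ∑-comm; sum-replicate-zero)

-- It is available in the double cover, where a state is a vertex with a departing sign: a conserved
-- weighting contains a closed walk there, and every closed walk projects back to a flow. The price
-- is that a walk may pass a vertex twice, once on each sheet. The two halves between such passages
-- are not flows, so indecomposability does not apply to them directly; but reversing one half keeps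
-- its end states, and the bound of one visit per state can then be applied to two different walks.
--
-- Blocks are given only by maximality, so containment in a block is always shown by enlarging it
-- with an ear. The dichotomy "0 or 2" comes from the handshake lemma: what hangs off a block at `v`
-- is even at every other vertex, hence also at `v`.
--
-- The definitions are stated with negations, while subgraphs are Boolean functions; arguments by
-- contradiction therefore rest on deciding reachability, cut-vertices and the existence of a larger
-- block candidate.

fromDoes : ∀ {a} {A : Set a} (a? : Dec A) → does a? ≡ true → A
fromDoes (yes a) _ = a

fromDoes-false : ∀ {a} {A : Set a} (a? : Dec A) → does a? ≡ false → ¬ A
fromDoes-false (no ¬a) _ = ¬a

∧-intro : ∀ {x y} → x ≡ true → y ≡ true → x ∧ y ≡ true
∧-intro refl refl = refl

∧-elimˡ : ∀ {x y} → x ∧ y ≡ true → x ≡ true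
∧-elimˡ {true} _ = refl

∧-elimʳ : ∀ {x y} → x ∧ y ≡ true → y ≡ true
∧-elimʳ {true} p = p

∨-elim : ∀ {x y} → x ∨ y ≡ true → x ≡ true ⊎ y ≡ true
∨-elim {true} _ = inj₁ refl
∨-elim {false} p = inj₂ p

∨-introˡ : ∀ {x y} → x ≡ true → x ∨ y ≡ true
∨-introˡ refl = refl

∨-introʳ : ∀ {x y} → y ≡ true → x ∨ y ≡ true
∨-introʳ {x} refl = ∨-zeroʳ x

not-true : ∀ {x} → not x ≡ true → x ≡ false
not-true {false} _ = refl

true≢false : ∀ {x} → x ≡ true → x ≡ false → ⊥
true≢false refl ()

≢true : ∀ {x} → ¬ (x ≡ true) → x ≡ false
≢true {true} p = ⊥-elim (p refl)
≢true {false} p = refl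

bool-ext : ∀ {x y} → (x ≡ true → y ≡ true) → (y ≡ true → x ≡ true) → x ≡ y
bool-ext {true} p q = sym (p refl)
bool-ext {false} {true} p q = q refl
bool-ext {false} {false} p q = refl

-- Sums over finite index sets.

sum-mono : ∀ {k} {h h′ : Fin k → ℕ} → (∀ i → h i ≤ h′ i) → sum h ≤ sum h′
sum-mono {zero} p = z≤n
sum-mono {suc k} p = +-mono-≤ (p zero) (sum-mono (p ∘ suc))

≤sum : ∀ {k} (h : Fin k → ℕ) i → h i ≤ sum h
≤sum h zero = m≤m+n _ _
≤sum h (suc i) = ≤-trans (≤sum (h ∘ suc) i) (m≤n+m _ _)

sum-zero : ∀ {k} {h : Fin k → ℕ} → (∀ i → h i ≡ 0) → sum h ≡ 0
sum-zero {k} p = trans (sum-cong-≗ p) (sum-replicate-zero k)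

sum-nonzero : ∀ {k} (h : Fin k → ℕ) → sum h ≢ 0 → ∃ λ i → h i ≢ 0
sum-nonzero {zero} h p = ⊥-elim (p refl)
sum-nonzero {suc k} h p with h zero ℕ.≟ 0
... | no q = zero , q
... | yes q with sum-nonzero (h ∘ suc) (λ r → p (cong₂ _+_ q r))
...   | i , r = suc i , r

+-≤-≡ : ∀ {a b c d} → a ≤ c → b ≤ d → a + b ≡ c + d → a ≡ c × b ≡ d
+-≤-≡ {a} {b} {c} {d} p q r = a≡c , +-cancelˡ-≡ c b d (trans (cong (_+ b) (sym a≡c)) r)
  where
  a≡c : a ≡ c
  a≡c = ≤-antisym p (ℕₚ.+-cancelʳ-≤ d c a (≤-trans (≤-reflexive (sym r)) (ℕₚ.+-monoʳ-≤ a q)))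

sum-≤-≡ : ∀ {k} (h h′ : Fin k → ℕ) → (∀ i → h i ≤ h′ i) → sum h ≡ sum h′ → ∀ i → h i ≡ h′ i
sum-≤-≡ h h′ p r zero = proj₁ (+-≤-≡ (p zero) (sum-mono (p ∘ suc)) r)
sum-≤-≡ h h′ p r (suc i) = sum-≤-≡ (h ∘ suc) (h′ ∘ suc) (p ∘ suc) (proj₂ (+-≤-≡ (p zero) (sum-mono (p ∘ suc)) r)) i

sum-indicator : ∀ {k} (v : Fin k) (h : Fin k → ℕ) → sum (λ x → if does (v ≟ x) then h x else 0) ≡ h v
sum-indicator {suc k} zero h = trans (cong (h zero +_) (sum-zero {h = λ x → if does (zero ≟ suc x) then h (suc x) else 0} (λ _ → refl))) (+-identityʳ _)
sum-indicator {suc k} (suc v) h = trans (sum-cong-≗ {k} (λ x → refl)) (sum-indicator v (h ∘ suc))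

sum-allFin : ∀ {k} (h : Fin k → ℕ) → sumℕ (Data.List.map h (allFin k)) ≡ sum h
sum-allFin {k} h = go k id
  where
  go : ∀ j (ι : Fin j → Fin k) → sumℕ (Data.List.map h (tabulate ι)) ≡ sum (h ∘ ι)
  go zero ι = refl
  go (suc j) ι = cong (h (ι zero) +_) (go j (ι ∘ suc))

even-sum : ∀ {k} (h : Fin k → ℕ) → (∀ i → 2 ∣ h i) → 2 ∣ sum h
even-sum {zero} h p = 2 ∣0
even-sum {suc k} h p = ∣m∣n⇒∣m+n (p zero) (even-sum (h ∘ suc) (p ∘ suc))

even-double : ∀ x → 2 ∣ x + x
even-double x = divides x (trans (cong (x +_) (sym (+-identityʳ x))) (ℕₚ.*-comm 2 x))

-- With the handshake lemma supplying the even total, this carries parity over to the one vertex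
-- where it is not known in advance.
even-remaining : ∀ {k} (h : Fin k → ℕ) v → 2 ∣ sum h → (∀ x → x ≢ v → 2 ∣ h x) → 2 ∣ h v
even-remaining h zero p q = ∣m+n∣m⇒∣n (subst (2 ∣_) (+-comm (h zero) _) p) (even-sum (h ∘ suc) (λ i → q (suc i) λ ()))
even-remaining h (suc v) p q =
  even-remaining (h ∘ suc) v (∣m+n∣m⇒∣n p (q zero λ ())) (λ x x≢v → q (suc x) λ { refl → x≢v refl })

-- Restriction of edge weights, and selections of edge ends.

infix 30 _↾_
_↾_ : ∀ {k} → (Fin k → ℕ) → (Fin k → Bool) → Fin k → ℕ
(h ↾ E) e = if E e then h e else 0

↾-true : ∀ {k} (h : Fin k → ℕ) E {e} → E e ≡ true → (h ↾ E) e ≡ h e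
↾-true h E p rewrite p = refl

↾-false : ∀ {k} (h : Fin k → ℕ) E {e} → E e ≡ false → (h ↾ E) e ≡ 0
↾-false h E p rewrite p = refl

↾-nonzero : ∀ {k} (h : Fin k → ℕ) E {e} → (h ↾ E) e ≢ 0 → E e ≡ true × h e ≢ 0
↾-nonzero h E {e} p with E e
... | true = refl , p
... | false = ⊥-elim (p refl)

↾-≤ : ∀ {k} (h : Fin k → ℕ) E e → (h ↾ E) e ≤ h e
↾-≤ h E e with E e
... | true = ≤-refl
... | false = z≤n

↾-complement : ∀ {k} (h : Fin k → ℕ) E e → h e ≡ (h ↾ E) e + (h ↾ (not ∘ E)) e
↾-complement h E e with E e
... | true = sym (+-identityʳ _)
... | false = refl

allEnds : ∀ {m} → Fin m → Bool → Bool
allEnds _ _ = true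

endsOf : ∀ {m} → EndSigns m → Sign → Fin m → Bool → Bool
endsOf ω s e b = does (ω e b ≟ₛ s)

≢⇒opposite : ∀ s t → s ≢ t → s ≡ opposite t
≢⇒opposite S.+ S.+ p = ⊥-elim (p refl)
≢⇒opposite S.+ S.- p = refl
≢⇒opposite S.- S.+ p = refl
≢⇒opposite S.- S.- p = ⊥-elim (p refl)

-- Weighted incidence at a vertex.

module Incidence {n m : ℕ} (G : SignedGraph n m) where
  open SignedGraph G

  atEnd : (Fin m → Bool → Bool) → (Fin m → ℕ) → Fin n → Fin m → Bool → ℕ
  atEnd p h x e b = if p e b ∧ does (endpt e b ≟ x) then h e else 0

  opaque
    -- All ends give the weighted degree, the ends of one sign give one side of the conservation
    -- law, and the indicator weights of an edge set give `deg`. A loop is counted once for each of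
    -- its ends that is selected.
    inc : (Fin m → Bool → Bool) → (Fin m → ℕ) → Fin n → ℕ
    inc p h x = sum λ e → atEnd p h x e false + atEnd p h x e true

  D : (Fin m → ℕ) → Fin n → ℕ
  D = inc allEnds

  module _ (p : Fin m → Bool → Bool) where
    opaque
      unfolding inc

      atEnd-here : ∀ h {e b x} → p e b ≡ true → endpt e b ≡ x → atEnd p h x e b ≡ h e
      atEnd-here h {e} {b} {x} q r rewrite q | dec-true (endpt e b ≟ x) r = refl

      atEnd-mono : ∀ {h k x} → (∀ e b → p e b ≡ true → endpt e b ≡ x → h e ≤ k e) → ∀ e b → atEnd p h x e b ≤ atEnd p k x e b
      atEnd-mono {x = x} q e b with p e b in eq | endpt e b ≟ x
      ... | true | yes r = q e b eq r
      ... | true | no _ = z≤n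
      ... | false | _ = z≤n

      atEnd-pos : ∀ {h x e b} → atEnd p h x e b ≢ 0 → p e b ≡ true × endpt e b ≡ x × h e ≢ 0
      atEnd-pos {h} {x} {e} {b} q with p e b | endpt e b ≟ x
      ... | true | yes r = refl , r , q
      ... | true | no _ = ⊥-elim (q refl)
      ... | false | _ = ⊥-elim (q refl)

      inc-mono : ∀ {h k x} → (∀ e b → p e b ≡ true → endpt e b ≡ x → h e ≤ k e) → inc p h x ≤ inc p k x
      inc-mono q = sum-mono λ e → +-mono-≤ (atEnd-mono q e false) (atEnd-mono q e true)

      inc-cong : ∀ {h k x} → (∀ e b → p e b ≡ true → endpt e b ≡ x → h e ≡ k e) → inc p h x ≡ inc p k x
      inc-cong {h} {k} q = ≤-antisym (inc-mono {h} {k} λ e b r s → ≤-reflexive (q e b r s)) (inc-mono {k} {h} λ e b r s → ≤-reflexive (sym (q e b r s)))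

      inc-+ : ∀ h k x → inc p (λ e → h e + k e) x ≡ inc p h x + inc p k x
      inc-+ h k x = trans (sum-cong-≗ λ e → lem e) (∑-distrib-+ (λ e → atEnd p h x e false + atEnd p h x e true) (λ e → atEnd p k x e false + atEnd p k x e true))
        where
        lem1 : ∀ e b → atEnd p (λ e → h e + k e) x e b ≡ atEnd p h x e b + atEnd p k x e b
        lem1 e b with p e b ∧ does (endpt e b ≟ x)
        ... | true = refl
        ... | false = refl
        lem : ∀ e → atEnd p (λ e → h e + k e) x e false + atEnd p (λ e → h e + k e) x e true
                  ≡ (atEnd p h x e false + atEnd p h x e true) + (atEnd p k x e false + atEnd p k x e true)
        lem e = trans (cong₂ _+_ (lem1 e false) (lem1 e true))
          (solve 4 (λ a b c d → (a :+ b) :+ (c :+ d) := (a :+ c) :+ (b :+ d)) refl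
            (atEnd p h x e false) (atEnd p k x e false) (atEnd p h x e true) (atEnd p k x e true))
          where open +-*-Solver

      inc-zero : ∀ {h x} → (∀ e b → p e b ≡ true → endpt e b ≡ x → h e ≡ 0) → inc p h x ≡ 0
      inc-zero {h} {x} q = trans (inc-cong {h} {λ _ → 0} q) (sum-zero lem)
        where
        lem1 : ∀ e b → atEnd p (λ _ → 0) x e b ≡ 0
        lem1 e b with p e b ∧ does (endpt e b ≟ x)
        ... | true = refl
        ... | false = refl
        lem : ∀ e → atEnd p (λ _ → 0) x e false + atEnd p (λ _ → 0) x e true ≡ 0
        lem e = cong₂ _+_ (lem1 e false) (lem1 e true)

      inc-nonzero : ∀ {h x} → inc p h x ≢ 0 → ∃₂ λ e b → p e b ≡ true × endpt e b ≡ x × h e ≢ 0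
      inc-nonzero {h} {x} q with sum-nonzero _ q
      ... | e , r with atEnd p h x e false ℕ.≟ 0
      ...   | no s = e , false , atEnd-pos {h} s
      ...   | yes s = e , true , atEnd-pos {h} (λ t → r (cong₂ _+_ s t))

      ≤inc : ∀ h {e b x} → p e b ≡ true → endpt e b ≡ x → h e ≤ inc p h x
      ≤inc h {e} {b} {x} q r = ≤-trans (≤-trans (≤-reflexive (sym (atEnd-here h q r))) (lem b)) (≤sum _ e)
        where
        lem : ∀ b → atEnd p h x e b ≤ atEnd p h x e false + atEnd p h x e true
        lem false = m≤m+n _ _
        lem true = m≤n+m _ _

      inc-zero⁻¹ : ∀ {h x} → inc p h x ≡ 0 → ∀ {e b} → p e b ≡ true → endpt e b ≡ x → h e ≡ 0
      inc-zero⁻¹ {h} q r s = ℕₚ.n≤0⇒n≡0 (≤-trans (≤inc h r s) (≤-reflexive q))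

      -- A sum without slack has no slack in any term; this turns equality of local totals into
      -- equality edge by edge.
      inc-≤-≡ : ∀ {h k x} → (∀ e → h e ≤ k e) → inc p h x ≡ inc p k x → ∀ {e b} → p e b ≡ true → endpt e b ≡ x → h e ≡ k e
      inc-≤-≡ {h} {k} {x} q r {e} {b} s t =
        trans (sym (atEnd-here h s t)) (trans (lem b) (atEnd-here k s t))
        where
        q′ : ∀ e b → atEnd p h x e b ≤ atEnd p k x e b
        q′ = atEnd-mono (λ e _ _ _ → q e)
        both : atEnd p h x e false ≡ atEnd p k x e false × atEnd p h x e true ≡ atEnd p k x e true
        both = +-≤-≡ (q′ e false) (q′ e true) (sum-≤-≡ _ _ (λ e → +-mono-≤ (q′ e false) (q′ e true)) r e)
        lem : ∀ b → atEnd p h x e b ≡ atEnd p k x e b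
        lem false = proj₁ both
        lem true = proj₂ both

      inc-↾-complement : ∀ h E x → inc p h x ≡ inc p (h ↾ E) x + inc p (h ↾ (not ∘ E)) x
      inc-↾-complement h E x = trans (inc-cong λ e _ _ _ → ↾-complement h E e) (inc-+ (h ↾ E) (h ↾ (not ∘ E)) x)

  opaque
    unfolding inc

    D-signs : ∀ ω h x → D h x ≡ inc (endsOf ω S.+) h x + inc (endsOf ω S.-) h x
    D-signs ω h x = trans (sum-cong-≗ lem)
      (∑-distrib-+ (λ e → atEnd (endsOf ω S.+) h x e false + atEnd (endsOf ω S.+) h x e true) (λ e → atEnd (endsOf ω S.-) h x e false + atEnd (endsOf ω S.-) h x e true))
      where
      lem1 : ∀ e b → atEnd allEnds h x e b ≡ atEnd (endsOf ω S.+) h x e b + atEnd (endsOf ω S.-) h x e b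
      lem1 e b with ω e b | does (endpt e b ≟ x)
      ... | S.+ | true = sym (+-identityʳ _)
      ... | S.+ | false = refl
      ... | S.- | true = refl
      ... | S.- | false = refl
      lem : ∀ e → atEnd allEnds h x e false + atEnd allEnds h x e true
                ≡ (atEnd (endsOf ω S.+) h x e false + atEnd (endsOf ω S.+) h x e true) + (atEnd (endsOf ω S.-) h x e false + atEnd (endsOf ω S.-) h x e true)
      lem e = trans (cong₂ _+_ (lem1 e false) (lem1 e true))
          (solve 4 (λ a b c d → (a :+ b) :+ (c :+ d) := (a :+ c) :+ (b :+ d)) refl
            (atEnd (endsOf ω S.+) h x e false) (atEnd (endsOf ω S.-) h x e false) (atEnd (endsOf ω S.+) h x e true) (atEnd (endsOf ω S.-) h x e true))
        where open +-*-Solver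

    inc-only : ∀ p {h e} → (∀ e′ → e′ ≢ e → h e′ ≡ 0) → ∀ x → inc p h x ≡ atEnd p h x e false + atEnd p h x e true
    inc-only p {h} {e} only x = trans (sum-cong-≗ lem) (sum-indicator e _)
      where
      vanish : ∀ e′ b → h e′ ≡ 0 → atEnd p h x e′ b ≡ 0
      vanish e′ b q with p e′ b ∧ does (endpt e′ b ≟ x)
      ... | true = q
      ... | false = refl
      lem : ∀ e′ → atEnd p h x e′ false + atEnd p h x e′ true ≡ (if does (e ≟ e′) then atEnd p h x e′ false + atEnd p h x e′ true else 0)
      lem e′ with e ≟ e′
      ... | yes _ = refl
      ... | no e≢e′ = cong₂ _+_ (vanish e′ false (only e′ (e≢e′ ∘ sym))) (vanish e′ true (only e′ (e≢e′ ∘ sym)))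

    loop≤D : ∀ h {e x} → IsLoop G e → endpt e false ≡ x → h e + h e ≤ D h x
    loop≤D h {e} {x} l p = ≤-trans (≤-reflexive (sym (cong₂ _+_ (atEnd-here allEnds h {b = false} refl p) (atEnd-here allEnds h {b = true} refl (trans (sym l) p)))))
      (≤sum (λ e → atEnd allEnds h x e false + atEnd allEnds h x e true) e)

    deg≡D : ∀ F v → deg G F v ≡ D (ind ∘ F) v
    deg≡D F v = trans (sum-allFin {m} _) (sum-cong-≗ lem)
      where
      lem : ∀ e → (if F e then ind (does (endpt e false ≟ v)) + ind (does (endpt e true ≟ v)) else 0)
                ≡ atEnd allEnds (ind ∘ F) v e false + atEnd allEnds (ind ∘ F) v e true
      lem e with F e | does (endpt e false ≟ v) | does (endpt e true ≟ v)
      ... | true | true | true = refl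
      ... | true | true | false = refl
      ... | true | false | true = refl
      ... | true | false | false = refl
      ... | false | true | true = refl
      ... | false | true | false = refl
      ... | false | false | true = refl
      ... | false | false | false = refl

    -- For p = allEnds this is the handshake lemma.
    sum-inc : ∀ p h → sum (inc p h) ≡ sum (λ e → (if p e false then h e else 0) + (if p e true then h e else 0))
    sum-inc p h = trans (∑-comm (λ x e → atEnd p h x e false + atEnd p h x e true)) (sum-cong-≗ lem)
      where
      lem1 : ∀ e b → sum (λ x → atEnd p h x e b) ≡ (if p e b then h e else 0)
      lem1 e b with p e b
      ... | true = sum-indicator (endpt e b) (λ _ → h e)
      ... | false = sum-zero {n} {λ _ → 0} (λ _ → refl)
      lem : ∀ e → sum (λ x → atEnd p h x e false + atEnd p h x e true) ≡ (if p e false then h e else 0) + (if p e true then h e else 0)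
      lem e = trans (∑-distrib-+ (λ x → atEnd p h x e false) (λ x → atEnd p h x e true)) (cong₂ _+_ (lem1 e false) (lem1 e true))

  D-sign : ∀ ω s h x → D h x ≡ inc (endsOf ω s) h x + inc (endsOf ω (opposite s)) h x
  D-sign ω S.+ h x = D-signs ω h x
  D-sign ω S.- h x = trans (D-signs ω h x) (+-comm (inc (endsOf ω S.+) h x) _)

  D-only-loop : ∀ {h e x} → (∀ e′ → e′ ≢ e → h e′ ≡ 0) → IsLoop G e → endpt e false ≡ x → D h x ≡ h e + h e
  D-only-loop {h} {e} {x} only l p = trans (inc-only allEnds only x)
    (cong₂ _+_ (atEnd-here allEnds h {b = false} refl p) (atEnd-here allEnds h {b = true} refl (trans (sym l) p)))

  D-only-link : ∀ {h e x} → (∀ e′ → e′ ≢ e → h e′ ≡ 0) → ¬ IsLoop G e → ∀ b → endpt e b ≡ x → D h x ≡ h e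
  D-only-link {h} {e} {x} only ¬l b p = trans (inc-only allEnds only x) (lem b p)
    where
    miss : ∀ b → endpt e b ≢ x → atEnd allEnds h x e b ≡ 0
    miss b q rewrite dec-false (endpt e b ≟ x) q = refl
    lem : ∀ b → endpt e b ≡ x → atEnd allEnds h x e false + atEnd allEnds h x e true ≡ h e
    lem false p = trans (cong₂ _+_ (atEnd-here allEnds h {b = false} refl p) (miss true (λ q → ¬l (trans p (sym q))))) (+-identityʳ _)
    lem true p = cong₂ _+_ (miss false (λ q → ¬l (trans q (sym p)))) (atEnd-here allEnds h {b = true} refl p)

  -- S is a union of components of the support of h.
  module _ (h : Fin m → ℕ) (S : Fin n → Bool) (closed : ∀ e → h e ≢ 0 → S (endpt e false) ≡ S (endpt e true)) where
    private
      -- Testing one end suffices: by `closed` the other end of a support edge gives the same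
      -- answer.
      inS : Fin m → Bool
      inS e = S (endpt e false)

    cut : Fin m → ℕ
    cut = h ↾ inS

    private
      S-end : ∀ {e} b {x} → h e ≢ 0 → endpt e b ≡ x → S (endpt e false) ≡ S x
      S-end false p refl = refl
      S-end {e} true p refl = closed e p

    inc-cut-in : ∀ p {x} → S x ≡ true → inc p cut x ≡ inc p h x
    inc-cut-in p {x} q = inc-cong p λ e b _ r → lem e b r
      where
      lem : ∀ e b → endpt e b ≡ x → cut e ≡ h e
      lem e b r with h e ℕ.≟ 0
      ... | yes s = trans (ℕₚ.n≤0⇒n≡0 (≤-trans (↾-≤ h inS e) (≤-reflexive s))) (sym s)
      ... | no s = ↾-true h inS (trans (S-end b s r) q)

    inc-cut-out : ∀ p {x} → S x ≡ false → inc p cut x ≡ 0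
    inc-cut-out p {x} q = inc-zero p λ e b _ r → lem e b r
      where
      lem : ∀ e b → endpt e b ≡ x → cut e ≡ 0
      lem e b r with h e ℕ.≟ 0
      ... | yes s = ℕₚ.n≤0⇒n≡0 (≤-trans (↾-≤ h inS e) (≤-reflexive s))
      ... | no s = ↾-false h inS (trans (S-end b s r) q)

-- Reachability and simple paths.

module Paths {n m : ℕ} (G : SignedGraph n m) where
  open SignedGraph G

  private
    variable
      F F′ : Fin m → Bool
      x y z u v w : Fin n

  endpt-not-not : ∀ {e b} → endpt e b ≡ x → endpt e (not (not b)) ≡ x
  endpt-not-not {e = e} {b} p = trans (cong (endpt e) (not-involutive b)) p

  reach-trans : Reach G F x y → Reach G F y z → Reach G F x z
  reach-trans here s = s
  reach-trans (step e b p q r) s = step e b p q (reach-trans r s)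

  reach-edge : ∀ e b → F e ≡ true → Reach G F (endpt e b) (endpt e (not b))
  reach-edge e b p = step e b p refl here

  reach-edge⁻ : ∀ e b → F e ≡ true → Reach G F (endpt e (not b)) (endpt e b)
  reach-edge⁻ {F} e b p = step e (not b) p refl (subst (λ c → Reach G F (endpt e c) (endpt e b)) (sym (not-involutive b)) here)

  reach-sym : Reach G F x y → Reach G F y x
  reach-sym here = here
  reach-sym (step e b p refl r) = reach-trans (reach-sym r) (reach-edge⁻ e b p)

  reach-mono : (∀ e → F e ≡ true → F′ e ≡ true) → Reach G F x y → Reach G F′ x y
  reach-mono f here = here
  reach-mono f (step e b p q r) = step e b (f e p) q (reach-mono f r)

  reach-invariant : (P : Fin n → Set) → (∀ e b → F e ≡ true → P (endpt e b) → P (endpt e (not b))) →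
                    Reach G F x y → P x → P y
  reach-invariant P f here p = p
  reach-invariant P f (step e b q refl r) p = reach-invariant P f r (f e b q p)

  reach-first : Reach G F x y → x ≢ y → ∃₂ λ e b → F e ≡ true × endpt e b ≡ x × endpt e (not b) ≢ x
  reach-first here p = ⊥-elim (p refl)
  reach-first {x = x} (step e b q s r) p with endpt e (not b) ≟ x
  ... | no t = e , b , q , s , t
  ... | yes refl = reach-first r p

  loop-end : ∀ {e} → IsLoop G e → ∀ b c → endpt e b ≡ endpt e c
  loop-end p false false = refl
  loop-end p false true = p
  loop-end p true false = sym p
  loop-end p true true = refl

  end⇒incident : ∀ {e} b → endpt e b ≡ v → Incident G e v
  end⇒incident false p = inj₁ p
  end⇒incident true p = inj₂ p

  incident⇒end : ∀ {e} → Incident G e v → ∃ λ b → endpt e b ≡ v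
  incident⇒end (inj₁ p) = false , p
  incident⇒end (inj₂ p) = true , p

  incidentB-end : ∀ {e} b → endpt e b ≡ v → incidentB G e v ≡ true
  incidentB-end false p = ∨-introˡ (dec-true (_ ≟ _) p)
  incidentB-end true p = ∨-introʳ (dec-true (_ ≟ _) p)

  incidentB⁻ : ∀ {e} → incidentB G e v ≡ true → ∃ λ b → endpt e b ≡ v
  incidentB⁻ p with ∨-elim p
  ... | inj₁ q = false , fromDoes (_ ≟ _) q
  ... | inj₂ q = true , fromDoes (_ ≟ _) q

  infixl 20 _⊖_
  -- Agrees by computation with the edge set of `deleteV`, so reachability in it can be handed to
  -- `CutVertex` as it is.
  _⊖_ : (Fin m → Bool) → Fin n → Fin m → Bool
  (F ⊖ v) e = F e ∧ not (incidentB G e v)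

  ⊖-intro : ∀ F {v e} → F e ≡ true → (∀ b → endpt e b ≢ v) → (F ⊖ v) e ≡ true
  ⊖-intro F {v} {e} p q with incidentB G e v in eq
  ... | false = ∧-intro p refl
  ... | true with incidentB⁻ eq
  ...   | b , r = ⊥-elim (q b r)

  ⊖-edge : ∀ F {v e} → (F ⊖ v) e ≡ true → F e ≡ true
  ⊖-edge F = ∧-elimˡ

  ⊖-avoid : ∀ F {v e} → (F ⊖ v) e ≡ true → ∀ b → endpt e b ≢ v
  ⊖-avoid F p b q = true≢false (incidentB-end b q) (not-true (∧-elimʳ {F _} p))

  ⊖-intro′ : ∀ F {v e} b → F e ≡ true → endpt e b ≢ v → endpt e (not b) ≢ v → (F ⊖ v) e ≡ true
  ⊖-intro′ F {e = e} b p q r = ⊖-intro F p λ c → lem b c q r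
    where
    lem : ∀ b c → endpt e b ≢ _ → endpt e (not b) ≢ _ → endpt e c ≢ _
    lem false false q r = q
    lem false true q r = r
    lem true false q r = r
    lem true true q r = q

  private
    ViaEdge : (Fin m → Bool) → Fin m → Fin n → Fin n → Set
    ViaEdge F e x y = Reach G F x y ⊎ (∃ λ b → Reach G F x (endpt e b) × Reach G F (endpt e (not b)) y)

    without : (Fin m → Bool) → Fin m → Fin m → Bool
    without F e e′ = F e′ ∧ not (does (e′ ≟ e))

    -- One traversal of `e` is enough: if it is traversed again in the same direction, the detour
    -- between is dropped, and if in the opposite direction, the walk is back where it began and
    -- both traversals go. Reachability is thereby decided by removing one edge at a time.
    viaEdge : ∀ e → Reach G F x y → ViaEdge (without F e) e x y
    viaEdge e here = inj₁ here
    viaEdge {F} e (step e′ b p refl r) with e′ ≟ e in eq | viaEdge e r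
    ... | no _ | inj₁ s = inj₁ (step e′ b (∧-intro p (cong (not ∘ does) eq)) refl s)
    ... | no _ | inj₂ (c , s , t) = inj₂ (c , step e′ b (∧-intro p (cong (not ∘ does) eq)) refl s , t)
    ... | yes refl | inj₁ s = inj₂ (b , here , s)
    ... | yes refl | inj₂ (c , s , t) with c ≟ᵇ b
    ...   | yes refl = inj₂ (b , here , t)
    ...   | no q = inj₁ (subst (λ d → Reach G _ (endpt e d) _) (lem b c q) t)
      where
      lem : ∀ b c → c ≢ b → not c ≡ b
      lem false false q = ⊥-elim (q refl)
      lem false true q = refl
      lem true false q = refl
      lem true true q = ⊥-elim (q refl)

    viaEdge⁻ : ∀ {e} → F e ≡ true → ViaEdge (without F e) e x y → Reach G F x y
    viaEdge⁻ p (inj₁ r) = reach-mono (λ _ → ∧-elimˡ) r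
    viaEdge⁻ {e = e} p (inj₂ (b , r , s)) = reach-trans (reach-mono (λ _ → ∧-elimˡ) r) (step e b p refl (reach-mono (λ _ → ∧-elimˡ) s))

    reach?-within : (L : List (Fin m)) → ∀ F → (∀ e → F e ≡ true → e ∈ L) → ∀ x y → Dec (Reach G F x y)
    reach?-within [] F f x y with x ≟ y
    ... | yes refl = yes here
    ... | no p = no λ { here → p refl ; (step e b q _ _) → case f e q of λ () }
    reach?-within (e ∷ L) F f x y with F e in eq
    ... | false = reach?-within L F (λ e′ p → lem e′ p (f e′ p)) x y
      where
      lem : ∀ e′ → F e′ ≡ true → e′ ∈ e ∷ L → e′ ∈ L
      lem e′ p (here refl) = ⊥-elim (true≢false p eq)
      lem e′ p (there q) = q
    ... | true = map′ (λ { (inj₁ r) → viaEdge⁻ eq (inj₁ r) ; (inj₂ (inj₁ r)) → viaEdge⁻ eq (inj₂ (false , r)) ; (inj₂ (inj₂ r)) → viaEdge⁻ eq (inj₂ (true , r)) })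
                      (λ r → case viaEdge e r of λ { (inj₁ s) → inj₁ s ; (inj₂ (false , s)) → inj₂ (inj₁ s) ; (inj₂ (true , s)) → inj₂ (inj₂ s) })
                      (rec x y ⊎-dec ((rec x (endpt e false) ×-dec rec (endpt e true) y) ⊎-dec (rec x (endpt e true) ×-dec rec (endpt e false) y)))
      where
      rec : ∀ x y → Dec (Reach G (without F e) x y)
      rec = reach?-within L (without F e) λ e′ p → lem e′ (not-true (∧-elimʳ {F e′} p)) (f e′ (∧-elimˡ p))
        where
        lem : ∀ e′ → does (e′ ≟ e) ≡ false → e′ ∈ e ∷ L → e′ ∈ L
        lem e′ p (here refl) = ⊥-elim (fromDoes-false (e′ ≟ e) p refl)
        lem e′ p (there q) = q

  abstract
    reach? : ∀ F x y → Dec (Reach G F x y)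
    reach? F = reach?-within (allFin m) F λ e _ → ∈-allFin e

  OnV : Reach G F x y → Fin n → Set
  OnV (here {x}) z = z ≡ x
  OnV (step {x} _ _ _ _ r) z = z ≡ x ⊎ OnV r z

  OnE : Reach G F x y → Fin m → Set
  OnE here e = ⊥
  OnE (step e′ _ _ _ r) e = e ≡ e′ ⊎ OnE r e

  onV? : (r : Reach G F x y) → ∀ z → Dec (OnV r z)
  onV? (here {x}) z = z ≟ x
  onV? (step {x} _ _ _ _ r) z = z ≟ x ⊎-dec onV? r z

  onE? : (r : Reach G F x y) → ∀ e → Dec (OnE r e)
  onE? here e = no λ ()
  onE? (step e′ _ _ _ r) e = e ≟ e′ ⊎-dec onE? r e

  Simple : Reach G F x y → Set
  Simple here = ⊤
  Simple (step {x} _ _ _ _ r) = ¬ OnV r x × Simple r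

  start-onV : (r : Reach G F x y) → OnV r x
  start-onV here = refl
  start-onV (step _ _ _ _ _) = inj₁ refl

  end-onV : (r : Reach G F x y) → OnV r y
  end-onV here = refl
  end-onV (step _ _ _ _ r) = inj₂ (end-onV r)

  onE⇒edge : (r : Reach G F x y) → ∀ {e} → OnE r e → F e ≡ true
  onE⇒edge (step _ _ p _ _) (inj₁ refl) = p
  onE⇒edge (step _ _ _ _ r) (inj₂ q) = onE⇒edge r q

  onE-ends : (r : Reach G F x y) → ∀ {e} → OnE r e → ∀ b → OnV r (endpt e b)
  onE-ends (step e false _ p r) (inj₁ refl) false = inj₁ p
  onE-ends (step e false _ p r) (inj₁ refl) true = inj₂ (start-onV r)
  onE-ends (step e true _ p r) (inj₁ refl) true = inj₁ p
  onE-ends (step e true _ p r) (inj₁ refl) false = inj₂ (start-onV r)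
  onE-ends (step _ _ _ _ r) (inj₂ q) b = inj₂ (onE-ends r q b)

  onV-end : (r : Reach G F x y) → ∀ {z} → OnV r z → z ≡ x ⊎ ∃₂ λ e b → OnE r e × endpt e b ≡ z
  onV-end here refl = inj₁ refl
  onV-end (step e b p q r) (inj₁ refl) = inj₁ refl
  onV-end (step e b p q r) (inj₂ s) with onV-end r s
  ... | inj₁ refl = inj₂ (e , not b , inj₁ refl , refl)
  ... | inj₂ (e′ , b′ , t , t′) = inj₂ (e′ , b′ , inj₂ t , t′)

  onV-mono : {f : ∀ e → F e ≡ true → F′ e ≡ true} (r : Reach G F x y) → OnV (reach-mono f r) z → OnV r z
  onV-mono here p = p
  onV-mono (step _ _ _ _ r) (inj₁ p) = inj₁ p
  onV-mono (step _ _ _ _ r) (inj₂ p) = inj₂ (onV-mono r p)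

  simple-mono : {f : ∀ e → F e ≡ true → F′ e ≡ true} (r : Reach G F x y) → Simple r → Simple (reach-mono f r)
  simple-mono here p = p
  simple-mono (step _ _ _ _ r) (p , q) = p ∘ onV-mono r , simple-mono r q

  simple-loopless : (r : Reach G F x y) → Simple r → ∀ {e} → OnE r e → ¬ IsLoop G e
  simple-loopless (step e b p refl r) (q , _) (inj₁ refl) l = q (subst (OnV r) (loop-end l (not b) b) (start-onV r))
  simple-loopless (step e b p q r) (_ , s) (inj₂ t) = simple-loopless r s t

  simple-suffix : (r : Reach G F x y) → Simple r → OnV r z → Σ (Reach G F z y) Simple
  simple-suffix here s refl = here , s
  simple-suffix (step e b p q r) s (inj₁ refl) = step e b p q r , s
  simple-suffix (step e b p q r) (_ , s) (inj₂ t) = simple-suffix r s t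

  simplify : Reach G F x y → Σ (Reach G F x y) Simple
  simplify here = here , tt
  simplify {x = x} (step e b p q r) with simplify r
  ... | r′ , s with onV? r′ x
  ...   | yes t = simple-suffix r′ s t
  ...   | no t = step e b p q r′ , t , s

  path-avoiding : (r : Reach G F x y) → (∀ e → OnE r e → F′ e ≡ true) → ¬ OnV r z → OnV r u → Reach G (F′ ⊖ z) u y
  path-avoiding here f p refl = here
  path-avoiding {F′ = F′} (step e b q refl r) f p (inj₁ refl) =
    step e b (⊖-intro F′ (f e (inj₁ refl)) λ c s → p (subst (OnV (step e b q refl r)) s (onE-ends (step e b q refl r) (inj₁ refl) c))) refl
      (path-avoiding r (λ e′ → f e′ ∘ inj₂) (p ∘ inj₂) (start-onV r))
  path-avoiding (step e b q s r) f p (inj₂ t) = path-avoiding r (λ e′ → f e′ ∘ inj₂) (p ∘ inj₂) t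

  -- A simple path meets `z` at most once, so `z` cannot stand both before and after `x`. This is
  -- the ear condition for a path.
  path-minus-vertex : (r : Reach G F u w) → Simple r → (∀ e → OnE r e → F′ e ≡ true) → ∀ z {x} → OnV r x → x ≢ z →
                      (u ≢ z × Reach G (F′ ⊖ z) x u) ⊎ (w ≢ z × Reach G (F′ ⊖ z) x w)
  path-minus-vertex here s f z refl q = inj₁ (q , here)
  path-minus-vertex (step e b p t r) s f z (inj₁ refl) q = inj₁ (q , here)
  path-minus-vertex {u = u} {F′ = F′} (step e b p refl r) (s₁ , s₂) f z (inj₂ x∈r) q with path-minus-vertex r s₂ (λ e′ → f e′ ∘ inj₂) z x∈r q
  ... | inj₂ t = inj₂ t
  ... | inj₁ (t , r′) with u ≟ z
  ...   | no u≢z = inj₁ (u≢z , reach-trans r′ (reach-edge⁻ e b (⊖-intro′ F′ b (f e (inj₁ refl)) u≢z t)))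
  ...   | yes refl = inj₂ ((λ { refl → s₁ (end-onV r) }) , path-avoiding r (λ e′ → f e′ ∘ inj₂) s₁ x∈r)

  simple-prefix : (r : Reach G F x y) → Simple r → OnV r z → Σ (Reach G F x z) λ r′ → Simple r′ × (∀ {v} → OnV r′ v → OnV r v)
  simple-prefix here s refl = here , tt , id
  simple-prefix (step e b p q r) s (inj₁ refl) = here , tt , inj₁
  simple-prefix (step e b p q r) (s , s′) (inj₂ t) with simple-prefix r s′ t
  ... | r′ , u , f = step e b p q r′ , (s ∘ f , u) , λ { (inj₁ v) → inj₁ v ; (inj₂ v) → inj₂ (f v) }

  snoc : Reach G F x y → ∀ e b → F e ≡ true → endpt e b ≡ y → endpt e (not b) ≡ z → Reach G F x z
  snoc here e b p q refl = step e b p q here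
  snoc (step e′ b′ p′ q′ r) e b p q t = step e′ b′ p′ q′ (snoc r e b p q t)

  onV-snoc : (r : Reach G F x y) → ∀ {e b p q} (t : endpt e (not b) ≡ z) → OnV (snoc r e b p q t) v → OnV r v ⊎ v ≡ z
  onV-snoc here refl (inj₁ s) = inj₁ s
  onV-snoc here refl (inj₂ s) = inj₂ s
  onV-snoc (step _ _ _ _ r) t (inj₁ s) = inj₁ (inj₁ s)
  onV-snoc (step _ _ _ _ r) t (inj₂ s) with onV-snoc r t s
  ... | inj₁ u = inj₁ (inj₂ u)
  ... | inj₂ u = inj₂ u

  simple-snoc : (r : Reach G F x y) → Simple r → ∀ {e b p q} (t : endpt e (not b) ≡ z) → ¬ OnV r z → Simple (snoc r e b p q t)
  simple-snoc here s refl n = (λ u → n (sym u)) , tt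
  simple-snoc (step _ _ _ _ r) (s , s′) t n = (λ u → [ s , (λ w → n (inj₁ (sym w))) ] (onV-snoc r t u)) , simple-snoc r s′ t (n ∘ inj₂)

  onE-snoc : (r : Reach G F x y) → ∀ {e b p q} (t : endpt e (not b) ≡ z) → ∀ {e′} → OnE r e′ ⊎ e′ ≡ e → OnE (snoc r e b p q t) e′
  onE-snoc here refl (inj₂ s) = inj₁ s
  onE-snoc (step _ _ _ _ r) t (inj₁ (inj₁ s)) = inj₁ s
  onE-snoc (step _ _ _ _ r) t (inj₁ (inj₂ s)) = inj₂ (onE-snoc r t (inj₁ s))
  onE-snoc (step _ _ _ _ r) t (inj₂ s) = inj₂ (onE-snoc r t (inj₂ s))

  reverse : Reach G F x y → Reach G F y x
  reverse here = here
  reverse (step e b p q r) = snoc (reverse r) e (not b) p refl (endpt-not-not q)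

  onV-reverse : (r : Reach G F x y) → OnV (reverse r) v → OnV r v
  onV-reverse here s = s
  onV-reverse (step e b p q r) s with onV-snoc (reverse r) (endpt-not-not q) s
  ... | inj₁ t = inj₂ (onV-reverse r t)
  ... | inj₂ t = inj₁ t

  simple-reverse : (r : Reach G F x y) → Simple r → Simple (reverse r)
  simple-reverse here s = s
  simple-reverse (step e b p q r) (s , s′) = simple-snoc (reverse r) (simple-reverse r s′) (endpt-not-not q) (s ∘ onV-reverse r)

  onE-reverse : (r : Reach G F x y) → ∀ {e} → OnE r e → OnE (reverse r) e
  onE-reverse (step e b p q r) (inj₁ s) = onE-snoc (reverse r) (endpt-not-not q) (inj₂ s)
  onE-reverse (step e b p q r) (inj₂ s) = onE-snoc (reverse r) (endpt-not-not q) (inj₁ (onE-reverse r s))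

  len : Reach G F x y → ℕ
  len here = 0
  len (step _ _ _ _ r) = suc (len r)

  -- Together with `edgeAt` this converts a path into the indexed sequences that `OnBlockPath` asks
  -- for.
  vertexAt : (r : Reach G F x y) → Fin (suc (len r)) → Fin n
  vertexAt {x = x} r zero = x
  vertexAt (step _ _ _ _ r) (suc i) = vertexAt r i

  edgeAt : (r : Reach G F x y) → Fin (len r) → Fin m
  edgeAt (step e _ _ _ _) zero = e
  edgeAt (step _ _ _ _ r) (suc i) = edgeAt r i

  vertexAt-onV : (r : Reach G F x y) → ∀ i → OnV r (vertexAt r i)
  vertexAt-onV r zero = start-onV r
  vertexAt-onV (step _ _ _ _ r) (suc i) = inj₂ (vertexAt-onV r i)

  vertexAt-injective : (r : Reach G F x y) → Simple r → ∀ i j → vertexAt r i ≡ vertexAt r j → i ≡ j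
  vertexAt-injective r s zero zero p = refl
  vertexAt-injective (step _ _ _ _ r) (s , _) zero (suc j) p = ⊥-elim (s (subst (OnV r) (sym p) (vertexAt-onV r j)))
  vertexAt-injective (step _ _ _ _ r) (s , _) (suc i) zero p = ⊥-elim (s (subst (OnV r) p (vertexAt-onV r i)))
  vertexAt-injective (step _ _ _ _ r) (_ , s) (suc i) (suc j) p = cong suc (vertexAt-injective r s i j p)

  vertexAt-last : (r : Reach G F x y) → vertexAt r (fromℕ (len r)) ≡ y
  vertexAt-last here = refl
  vertexAt-last (step _ _ _ _ r) = vertexAt-last r

  edgeAt-ends : (r : Reach G F x y) → ∀ i → F (edgeAt r i) ≡ true ×
                ∃ λ b → endpt (edgeAt r i) b ≡ vertexAt r (inject₁ i) × endpt (edgeAt r i) (not b) ≡ vertexAt r (suc i)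
  edgeAt-ends (step e b p q r) zero = p , b , q , refl
  edgeAt-ends (step _ _ _ _ r) (suc i) with r | i | edgeAt-ends r i
  ... | step _ _ _ _ _ | zero | t = t
  ... | step _ _ _ _ _ | suc _ | t = t

  onE⇒edgeAt : (r : Reach G F x y) → ∀ {e} → OnE r e → ∃ λ i → edgeAt r i ≡ e
  onE⇒edgeAt (step _ _ _ _ r) (inj₁ p) = zero , sym p
  onE⇒edgeAt (step _ _ _ _ r) (inj₂ p) with onE⇒edgeAt r p
  ... | i , q = suc i , q

  -- The vertices along the path inject into the vertex set. This is the termination bound when
  -- bridges are chained into a block path.
  simple-short : (r : Reach G F x y) → Simple r → len r < n
  simple-short r s = injective⇒≤ λ {i} {j} → vertexAt-injective r s i j

-- Decidability of the subgraph predicates.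

module Decide {n m : ℕ} (G : SignedGraph n m) where
  open SignedGraph G
  open Paths G

  private
    true? : ∀ b → Dec (b ≡ true)
    true? b = b ≟ᵇ true

  allBool? : {P : Bool → Set} → (∀ b → Dec (P b)) → Dec (∀ b → P b)
  allBool? P? = map′ (λ { (p , q) false → p ; (p , q) true → q }) (λ f → f false , f true) (P? false ×-dec P? true)

  subOf? : ∀ H K → Dec (SubOf G H K)
  subOf? H K = all? (λ v → true? (V H v) →-dec true? (V K v)) ×-dec all? (λ e → true? (E H e) →-dec true? (E K e))

  wellFormed? : ∀ H → Dec (WellFormed G H)
  wellFormed? H = all? λ e → allBool? λ b → true? (E H e) →-dec true? (V H (endpt e b))

  connected? : ∀ H → Dec (Connected G H)
  connected? H = any? (λ v → true? (V H v)) ×-dec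
    all? (λ x → all? λ y → true? (V H x) →-dec (true? (V H y) →-dec reach? (E H) x y))

  abstract
    cutVertex? : ∀ H v → Dec (CutVertex G H v)
    cutVertex? H v = true? (V H v) ×-dec
      (any? (λ x → any? λ y → true? (V (deleteV G H v) x) ×-dec (true? (V (deleteV G H v) y) ×-dec
         (reach? (E H) x y ×-dec ¬? (reach? (E (deleteV G H v)) x y))))
       ⊎-dec
       any? (λ e → any? λ e′ → true? (E H e) ×-dec (endpt e false ≟ endpt e true ×-dec (endpt e false ≟ v ×-dec
         (true? (E H e′) ×-dec (¬? (e′ ≟ e) ×-dec (endpt e′ false ≟ v ⊎-dec endpt e′ true ≟ v)))))))

  noCutVertex? : ∀ H → Dec (NoCutVertex G H)
  noCutVertex? H = all? λ v → ¬? (cutVertex? H v)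

-- Blocks: ears, maximality, and what hangs off a block.

module Blocks {n m : ℕ} (G : SignedGraph n m) (T : Sub n m) (wfT : WellFormed G T) where
  open SignedGraph G
  open Incidence G
  open Paths G
  open Decide G

  Good : Sub n m → Set
  Good B = WellFormed G B × SubOf G B T × Connected G B × NoCutVertex G B

  good? : ∀ B → Dec (Good B)
  good? B = wellFormed? B ×-dec (subOf? B T ×-dec (connected? B ×-dec noCutVertex? B))

  Block : Sub n m → Set
  Block = IsBlock G T

  private
    variable
      B B′ : Sub n m
      u v w x y : Fin n
      e e′ : Fin m

  block⇒good : Block B → Good B
  block⇒good (p , q , r , s , _) = p , q , r , s

  block-max : Block B → Good B′ → SubOf G B B′ → SubOf G B′ B
  block-max {B′ = B′} (_ , _ , _ , _ , f) (p , q , r , s) = f B′ p q r s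

  sub-trans : ∀ {H K L : Sub n m} → SubOf G H K → SubOf G K L → SubOf G H L
  sub-trans (p , q) (r , s) = (λ v → r v ∘ p v) , (λ e → s e ∘ q e)

  sub-antisym : ∀ {H K : Sub n m} → SubOf G H K → SubOf G K H → SameSub G H K
  sub-antisym (p , q) (r , s) = (λ v → bool-ext (p v) (r v)) , (λ e → bool-ext (q e) (s e))

  same⇒sub : ∀ {H K : Sub n m} → SameSub G H K → SubOf G H K
  same⇒sub (p , q) = (λ v r → trans (sym (p v)) r) , (λ e r → trans (sym (q e)) r)

  same-sym : ∀ {H K : Sub n m} → SameSub G H K → SameSub G K H
  same-sym (p , q) = (sym ∘ p) , (sym ∘ q)

  same-trans : ∀ {H K L : Sub n m} → SameSub G H K → SameSub G K L → SameSub G H L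
  same-trans (p , q) (r , s) = (λ v → trans (p v) (r v)) , (λ e → trans (q e) (s e))

  -- For `z` in `B` this is the absence of cut-vertices, made positive by deciding reachability; for
  -- `z` outside `B`, well-formedness keeps every edge of `B` away from `z`.
  good-avoiding : Good B → ∀ z → V B x ≡ true → V B y ≡ true → x ≢ z → y ≢ z → Reach G (E B ⊖ z) x y
  good-avoiding {B} {x} {y} (wf , _ , (_ , conn) , nocut) z p q x≢z y≢z with V B z in eq
  ... | true = decidable-stable (reach? _ x y) λ ¬r → nocut z (eq , inj₁ (x , y ,
                 ∧-intro p (cong not (dec-false (x ≟ z) x≢z)) , ∧-intro q (cong not (dec-false (y ≟ z) y≢z)) , conn x y p q , ¬r))
  ... | false = reach-mono (λ e r → ⊖-intro (E B) r λ b s → true≢false (subst (λ w → V B w ≡ true) s (wf e b r)) eq) (conn x y p q)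

  other-of : u ≢ w → ∀ z → u ≢ z ⊎ w ≢ z
  other-of {u} u≢w z with u ≟ z
  ... | yes refl = inj₂ λ { refl → u≢w refl }
  ... | no p = inj₁ p

  -- With a second vertex present, connectedness puts another edge at the vertex of a loop, which is
  -- then a cut-vertex by the loop clause.
  good-loopless : Good B → V B u ≡ true → V B w ≡ true → u ≢ w → E B e ≡ true → ¬ IsLoop G e
  good-loopless {B} {e = e} (wf , _ , (_ , conn) , nocut) p q u≢w r l =
    [ (λ s → go p (s ∘ sym)) , (λ s → go q (s ∘ sym)) ] (other-of u≢w o)
    where
    o = endpt e false
    go : ∀ {y} → V B y ≡ true → o ≢ y → ⊥
    go {y} s t with reach-first (conn o y (wf e false r) s) t
    ... | e′ , b , e′∈B , h , h′ =
      nocut o (wf e false r , inj₂ (e , e′ , r , l , refl , e′∈B ,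
        (λ { refl → h′ (trans (loop-end l (not b) b) h) }) , end⇒incident b h))

  infixr 25 _∪_
  _∪_ : Sub n m → Sub n m → Sub n m
  H ∪ K = sub (λ v → V H v ∨ V K v) (λ e → E H e ∨ E K e)

  ⊖-mono : ∀ {F F′ : Fin m → Bool} {z} → (∀ e → F e ≡ true → F′ e ≡ true) → ∀ e → (F ⊖ z) e ≡ true → (F′ ⊖ z) e ≡ true
  ⊖-mono {F} {F′} f e p = ⊖-intro F′ (f e (⊖-edge F p)) (⊖-avoid F p)

  -- Ear extension, for a notion of ear X wide enough to include another block sharing two vertices with B.
  extend : Good B → V B u ≡ true → V B w ≡ true → u ≢ w → (X : Sub n m) → WellFormed G X → SubOf G X T →
           (∀ e → E X e ≡ true → ¬ IsLoop G e) →
           (∀ z x → V X x ≡ true → x ≢ z → ∃ λ y → V B y ≡ true × y ≢ z × Reach G (E (B ∪ X) ⊖ z) x y) →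
           Good (B ∪ X)
  extend {B} {u} {w} good u∈B w∈B u≢w X wfX (sV , sE) loopless ear =
    wf , ((λ v p → [ proj₁ (proj₁ (proj₂ good)) v , sV v ] (∨-elim p)) , (λ e p → [ proj₂ (proj₁ (proj₂ good)) e , sE e ] (∨-elim p))) ,
    ((u , ∨-introˡ u∈B) , conn) , nocut
    where
    wf : WellFormed G (B ∪ X)
    wf e b p = [ (λ q → ∨-introˡ (proj₁ good e b q)) , (λ q → ∨-introʳ (wfX e b q)) ] (∨-elim p)

    toB : ∀ z x → V (B ∪ X) x ≡ true → x ≢ z → ∃ λ y → V B y ≡ true × y ≢ z × Reach G (E (B ∪ X) ⊖ z) x y
    toB z x p q = [ (λ r → x , r , q , here) , (λ r → ear z x r q) ] (∨-elim p)

    connAvoid : ∀ z x y → V (B ∪ X) x ≡ true → V (B ∪ X) y ≡ true → x ≢ z → y ≢ z → Reach G (E (B ∪ X) ⊖ z) x y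
    connAvoid z x y p q x≢z y≢z with toB z x p x≢z | toB z y q y≢z
    ... | x′ , x′∈B , x′≢z , r | y′ , y′∈B , y′≢z , s =
      reach-trans r (reach-trans (reach-mono (⊖-mono (λ _ → ∨-introˡ)) (good-avoiding good z x′∈B y′∈B x′≢z y′≢z)) (reach-sym s))

    toB′ : ∀ x → V (B ∪ X) x ≡ true → ∃ λ y → V B y ≡ true × Reach G (E (B ∪ X)) x y
    toB′ x p = [ go u , go w ] (other-of u≢w x)
      where
      go : ∀ z → z ≢ x → ∃ λ y → V B y ≡ true × Reach G (E (B ∪ X)) x y
      go z q with toB z x p (q ∘ sym)
      ... | y , y∈B , _ , r = y , y∈B , reach-mono (λ _ → ⊖-edge (E (B ∪ X))) r

    conn : ∀ x y → V (B ∪ X) x ≡ true → V (B ∪ X) y ≡ true → Reach G (E (B ∪ X)) x y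
    conn x y p q with toB′ x p | toB′ y q
    ... | x′ , x′∈B , r | y′ , y′∈B , s =
      reach-trans r (reach-trans (reach-mono (λ _ → ∨-introˡ) (proj₂ (proj₁ (proj₂ (proj₂ good))) x′ y′ x′∈B y′∈B)) (reach-sym s))

    nocut : NoCutVertex G (B ∪ X)
    nocut z (_ , inj₁ (x , y , p , q , _ , ¬r)) =
      ¬r (connAvoid z x y (∧-elimˡ p) (∧-elimˡ q)
        (fromDoes-false (x ≟ z) (not-true (∧-elimʳ {V (B ∪ X) x} p))) (fromDoes-false (y ≟ z) (not-true (∧-elimʳ {V (B ∪ X) y} q))))
    nocut z (_ , inj₂ (e , _ , p , l , _)) = [ (λ q → good-loopless good u∈B w∈B u≢w q l) , (λ q → loopless e q l) ] (∨-elim p)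

  block-⊇ : Block B → V B u ≡ true → V B w ≡ true → u ≢ w → (X : Sub n m) → WellFormed G X → SubOf G X T →
            (∀ e → E X e ≡ true → ¬ IsLoop G e) →
            (∀ z x → V X x ≡ true → x ≢ z → ∃ λ y → V B y ≡ true × y ≢ z × Reach G (E (B ∪ X) ⊖ z) x y) →
            SubOf G X B
  block-⊇ {B} isB p q r X wfX sX loopless ear =
    sub-trans {X} {B ∪ X} {B} ((λ _ → ∨-introʳ) , (λ _ → ∨-introʳ))
      (block-max isB (extend (block⇒good isB) p q r X wfX sX loopless ear) ((λ _ → ∨-introˡ) , (λ _ → ∨-introˡ)))

  -- A simple path with two distinct ends in `B` is an ear, whatever it meets in between, so
  -- maximality swallows it. Most statements that an edge lies in a block, or that two blocks
  -- differ, come down to this.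
  block-absorbs-path : ∀ {F} → Block B → V B u ≡ true → V B w ≡ true → u ≢ w → (∀ e → F e ≡ true → E T e ≡ true) →
                       (r : Reach G F u w) → Simple r → ∀ e → OnE r e → E B e ≡ true
  block-absorbs-path {B} {u} {w} isB@(_ , (sV , _) , _) u∈B w∈B u≢w F⊆T r simple e e∈r =
    proj₂ (block-⊇ isB u∈B w∈B u≢w X
      (λ e b p → dec-true (onV? r _) (onE-ends r (fromDoes (onE? r e) p) b))
      ((λ x p → V∈T (fromDoes (onV? r x) p)) , (λ e p → F⊆T e (onE⇒edge r (fromDoes (onE? r e) p))))
      (λ e p → simple-loopless r simple (fromDoes (onE? r e) p))
      ear) e (dec-true (onE? r e) e∈r)
    where
    X = sub (λ x → does (onV? r x)) (λ e → does (onE? r e))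
    V∈T : ∀ {x} → OnV r x → V T x ≡ true
    V∈T p with onV-end r p
    ... | inj₁ refl = sV _ u∈B
    ... | inj₂ (e , b , q , refl) = wfT e b (F⊆T e (onE⇒edge r q))
    ear : ∀ z x → V X x ≡ true → x ≢ z → ∃ λ y → V B y ≡ true × y ≢ z × Reach G (E (B ∪ X) ⊖ z) x y
    ear z x p q with path-minus-vertex {F′ = E (B ∪ X)} r simple (λ e s → ∨-introʳ (dec-true (onE? r e) s)) z (fromDoes (onV? r x) p) q
    ... | inj₁ (u≢z , r′) = u , u∈B , u≢z , r′
    ... | inj₂ (w≢z , r′) = w , w∈B , w≢z , r′

  -- `B′` itself serves as the ear: deleting `z` spares one of `u` and `w`, and the rest of `B′`
  -- still reaches that one inside `B′`.
  block-⊇-good : Block B → Good B′ → u ≢ w → V B u ≡ true → V B w ≡ true → V B′ u ≡ true → V B′ w ≡ true → SubOf G B′ B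
  block-⊇-good {B} {B′} {u} {w} isB good u≢w p q p′ q′ =
    block-⊇ isB p q u≢w B′ (proj₁ good) (proj₁ (proj₂ good)) (λ e → good-loopless good p′ q′ u≢w) ear
    where
    ear : ∀ z x → V B′ x ≡ true → x ≢ z → ∃ λ y → V B y ≡ true × y ≢ z × Reach G (E (B ∪ B′) ⊖ z) x y
    ear z x r s with other-of u≢w z
    ... | inj₁ t = u , p , t , reach-mono (⊖-mono (λ _ → ∨-introʳ)) (good-avoiding good z r p′ s t)
    ... | inj₂ t = w , q , t , reach-mono (⊖-mono (λ _ → ∨-introʳ)) (good-avoiding good z r q′ s t)

  two-vertices⇒same : Block B → Block B′ → u ≢ w → V B u ≡ true → V B w ≡ true → V B′ u ≡ true → V B′ w ≡ true → SameSub G B B′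
  two-vertices⇒same isB isB′ u≢w p q p′ q′ =
    sub-antisym (block-⊇-good isB′ (block⇒good isB) u≢w p′ q′ p q) (block-⊇-good isB (block⇒good isB′) u≢w p q p′ q′)

  good-loop-V : Good B → E B e ≡ true → IsLoop G e → ∀ x → V B x ≡ true → x ≡ endpt e false
  good-loop-V {e = e} good p l x q = decidable-stable (x ≟ endpt e false) λ r → good-loopless good q (proj₁ good e false p) r p l

  good-loop-E : Good B → E B e ≡ true → IsLoop G e → ∀ e′ → E B e′ ≡ true → e′ ≡ e
  good-loop-E {e = e} good p l e′ q = decidable-stable (e′ ≟ e) λ r →
    proj₂ (proj₂ (proj₂ good)) (endpt e false)
      (proj₁ good e false p , inj₂ (e , e′ , p , l , refl , q , r , inj₁ (good-loop-V good p l _ (proj₁ good e′ false q))))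

  -- A link provides two common vertices; the block of a loop consists of the loop alone.
  edge⇒same : Block B → Block B′ → E B e ≡ true → E B′ e ≡ true → SameSub G B B′
  edge⇒same {B} {B′} {e} isB isB′ p q with endpt e false ≟ endpt e true
  ... | no r = two-vertices⇒same isB isB′ r (proj₁ isB e false p) (proj₁ isB e true p) (proj₁ isB′ e false q) (proj₁ isB′ e true q)
  ... | yes l = sub-antisym (half isB isB′ p q) (half isB′ isB q p)
    where
    half : ∀ {B B′} → Block B → Block B′ → E B e ≡ true → E B′ e ≡ true → SubOf G B B′
    half {B} {B′} isB isB′ p q =
      (λ x r → subst (λ y → V B′ y ≡ true) (sym (good-loop-V (block⇒good isB) p l x r)) (proj₁ isB′ e false q)) ,
      (λ e′ r → subst (λ y → E B′ y ≡ true) (sym (good-loop-E (block⇒good isB) p l e′ r)) q)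

  edgeSub : Fin m → Sub n m
  edgeSub e = sub (incidentB G e) (λ e′ → does (e′ ≟ e))

  edge-good : E T e ≡ true → Good (edgeSub e)
  edge-good {e} p = wf , ((λ v q → V∈T (incidentB⁻ q)) , (λ e′ q → subst (λ z → E T z ≡ true) (sym (fromDoes (e′ ≟ e) q)) p)) ,
                    ((endpt e false , incidentB-end false refl) , λ x y q r → conn (incidentB⁻ q) (incidentB⁻ r)) , nocut
    where
    self : does (e ≟ e) ≡ true
    self = dec-true (e ≟ e) refl
    V∈T : ∀ {v} → (∃ λ b → endpt e b ≡ v) → V T v ≡ true
    V∈T (b , refl) = wfT e b p
    wf : WellFormed G (edgeSub e)
    wf e′ b q with fromDoes (e′ ≟ e) q
    ... | refl = incidentB-end b refl
    conn : ∀ {x y} → (∃ λ b → endpt e b ≡ x) → (∃ λ b → endpt e b ≡ y) → Reach G (E (edgeSub e)) x y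
    conn (false , refl) (false , refl) = here
    conn (true , refl) (true , refl) = here
    conn (false , refl) (true , refl) = reach-edge e false self
    conn (true , refl) (false , refl) = reach-edge e true self
    covered : ∀ {x y z} → (∃ λ b → endpt e b ≡ x) → (∃ λ b → endpt e b ≡ y) → (∃ λ b → endpt e b ≡ z) → x ≢ z → y ≢ z → x ≡ y
    covered (false , refl) (false , refl) _ _ _ = refl
    covered (true , refl) (true , refl) _ _ _ = refl
    covered (false , refl) (true , refl) (false , refl) r s = ⊥-elim (r refl)
    covered (false , refl) (true , refl) (true , refl) r s = ⊥-elim (s refl)
    covered (true , refl) (false , refl) (true , refl) r s = ⊥-elim (r refl)
    covered (true , refl) (false , refl) (false , refl) r s = ⊥-elim (s refl)
    nocut : NoCutVertex G (edgeSub e)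
    nocut z (z∈ , inj₁ (x , y , q , r , _ , ¬s)) with covered (incidentB⁻ (∧-elimˡ q)) (incidentB⁻ (∧-elimˡ r)) (incidentB⁻ z∈)
        (fromDoes-false (x ≟ z) (not-true (∧-elimʳ {incidentB G e x} q))) (fromDoes-false (y ≟ z) (not-true (∧-elimʳ {incidentB G e y} r)))
    ... | refl = ¬s here
    nocut z (_ , inj₂ (e₁ , e₂ , q , _ , _ , r , s , _)) = s (trans (fromDoes (e₂ ≟ e) r) (sym (fromDoes (e₁ ≟ e) q)))

  module _ {H K : Sub n m} (same : SameSub G H K) where
    private
      toE : ∀ e → E H e ≡ true → E K e ≡ true
      toE e p = trans (sym (proj₂ same e)) p
      toV : ∀ v → V H v ≡ true → V K v ≡ true
      toV v p = trans (sym (proj₁ same v)) p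
      fromE : ∀ e → E K e ≡ true → E H e ≡ true
      fromE e p = trans (proj₂ same e) p
      fromV : ∀ v → V K v ≡ true → V H v ≡ true
      fromV v p = trans (proj₁ same v) p

    good-resp : Good H → Good K
    good-resp (wf , s , ((v₀ , p₀) , conn) , nocut) =
      (λ e b p → toV _ (wf e b (fromE e p))) , ((λ v → proj₁ s v ∘ fromV v) , (λ e → proj₂ s e ∘ fromE e)) ,
      ((v₀ , toV v₀ p₀) , λ x y p q → reach-mono toE (conn x y (fromV x p) (fromV y q))) ,
      λ { v (p , inj₁ (x , y , q , r , s , t)) → nocut v (fromV v p , inj₁ (x , y , ∧-intro (fromV x (∧-elimˡ q)) (∧-elimʳ {V K x} q) ,
            ∧-intro (fromV y (∧-elimˡ r)) (∧-elimʳ {V K y} r) , reach-mono fromE s , λ t′ → t (reach-mono (⊖-mono toE) t′)))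
        ; v (p , inj₂ (e , e′ , q , l , r , s , t)) → nocut v (fromV v p , inj₂ (e , e′ , fromE e q , l , r , fromE e′ s , t)) }

  private
    decode : Subset n → Subset m → Sub n m
    decode p q = sub (Vec.lookup p) (Vec.lookup q)

    Larger : Sub n m → Sub n m → Set
    Larger B B′ = Good B′ × SubOf G B B′ × ¬ SubOf G B′ B

    -- Subgraphs are pairs of functions, so the search runs over pairs of subsets. Every subgraph is
    -- `SameSub` to a decoded pair, and `good-resp` carries goodness across without function
    -- extensionality.
    larger? : ∀ B → Dec (∃ (Larger B))
    larger? B = map′ (λ { (p , q , l) → decode p q , l }) encode
      (anySubset? λ p → anySubset? λ q → good? (decode p q) ×-dec (subOf? B (decode p q) ×-dec ¬? (subOf? (decode p q) B)))
      where
      encode : ∃ (Larger B) → ∃ λ p → ∃ λ q → Larger B (decode p q)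
      encode (B′ , g , s , t) = Vec.tabulate (V B′) , Vec.tabulate (E B′) , good-resp same g ,
        sub-trans {B} {B′} {K} s (same⇒sub same) , λ t′ → t (sub-trans {B′} {K} {B} (same⇒sub same) t′)
        where
        K = decode (Vec.tabulate (V B′)) (Vec.tabulate (E B′))
        same : SameSub G B′ K
        same = (λ v → sym (lookup∘tabulate (V B′) v)) , (λ e → sym (lookup∘tabulate (E B′) e))

    size : Sub n m → ℕ
    size H = sum (ind ∘ V H) + sum (ind ∘ E H)

    ind-mono : ∀ {a b} → (a ≡ true → b ≡ true) → ind a ≤ ind b
    ind-mono {true} f rewrite f refl = ≤-refl
    ind-mono {false} f = z≤n

    ind-true : ∀ {a b} → ind a ≡ ind b → b ≡ true → a ≡ true
    ind-true {true} p q = refl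
    ind-true {false} {true} () q

    ind≤1 : ∀ a → ind a ≤ 1
    ind≤1 true = ≤-refl
    ind≤1 false = z≤n

    size-< : Larger B B′ → size B < size B′
    size-< {B} {B′} (_ , (sV , sE) , ¬s) = ℕₚ.≤∧≢⇒< (+-mono-≤ vs es) λ eq → case +-≤-≡ vs es eq of λ { (p , q) →
        ¬s ((λ v → ind-true (sum-≤-≡ _ _ vs′ p v)) , (λ e → ind-true (sum-≤-≡ _ _ es′ q e))) }
      where
      vs′ : ∀ v → ind (V B v) ≤ ind (V B′ v)
      vs′ v = ind-mono (sV v)
      es′ : ∀ e → ind (E B e) ≤ ind (E B′ e)
      es′ e = ind-mono (sE e)
      vs = sum-mono vs′
      es = sum-mono es′

    bound : ℕ
    bound = sum {n} (λ _ → 1) + sum {m} (λ _ → 1)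

    size≤bound : ∀ B → size B ≤ bound
    size≤bound B = +-mono-≤ (sum-mono λ v → ind≤1 (V B v)) (sum-mono λ e → ind≤1 (E B e))

    -- `k` bounds how often the subgraph can still be enlarged: each enlargement raises `size`,
    -- which never exceeds `bound`.
    grow : ∀ k B → Good B → bound ≤ size B + k → ∃ λ B′ → Block B′ × SubOf G B B′
    grow k B good@(a , b , c , d) p with larger? B
    ... | no ¬l = B , (a , b , c , d , λ B′ a′ b′ c′ d′ s → decidable-stable (subOf? B′ B) λ t → ¬l (B′ , (a′ , b′ , c′ , d′) , s , t)) , (λ _ → id) , (λ _ → id)
    grow zero B good p | yes (B′ , l) = ⊥-elim (ℕₚ.<⇒≱ (size-< l) (≤-trans (size≤bound B′) (≤-trans p (≤-reflexive (+-identityʳ _)))))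
    grow (suc k) B good p | yes (B′ , l@(good′ , s , _)) with grow k B′ good′ (≤-trans p (≤-trans (≤-reflexive (+-suc (size B) k)) (ℕₚ.+-monoˡ-≤ k (size-< l))))
    ... | B″ , isB , t = B″ , isB , sub-trans {B} {B′} {B″} s t

  abstract
    block-containing : Good B → ∃ λ B′ → Block B′ × SubOf G B B′
    block-containing {B} good = grow bound B good (m≤n+m bound (size B))

    block-of : E T e ≡ true → ∃ λ B → Block B × E B e ≡ true
    block-of {e} p with block-containing (edge-good p)
    ... | B , isB , (_ , s) = B , isB , s e (dec-true (e ≟ e) refl)

  -- If no edge of `B` met `x`, connectedness would shrink `B` to the vertex `x`; it would then lie
  -- inside the single edge `e`, and maximality would put `e` into `B` after all.
  block-has-end : ∀ {b} → Block B → V B x ≡ true → E T e ≡ true → endpt e b ≡ x → ∃₂ λ e′ b′ → E B e′ ≡ true × endpt e′ b′ ≡ x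
  block-has-end {B} {x} {e} {b} isB@(wf , _ , (_ , conn) , _) x∈B e∈T refl
    with any? (λ e′ → (E B e′ ≟ᵇ true) ×-dec (endpt e′ false ≟ x ⊎-dec endpt e′ true ≟ x))
  ... | yes (e′ , p , q) with incident⇒end q
  ...   | b′ , r = e′ , b′ , p , r
  block-has-end {B} {x} {e} {b} isB@(wf , _ , (_ , conn) , _) x∈B e∈T refl | no ¬p = e , b , proj₂ big e (dec-true (e ≟ e) refl) , refl
    where
    only : ∀ y → V B y ≡ true → x ≡ y
    only y q = decidable-stable (x ≟ y) λ r → case reach-first (conn x y x∈B q) r of λ
      { (e′ , b′ , s , t , _) → ¬p (e′ , s , end⇒incident b′ t) }
    big : SubOf G (edgeSub e) B
    big = block-max isB (edge-good e∈T)
      ((λ y q → incidentB-end b (only y q)) , (λ e′ q → ⊥-elim (¬p (e′ , q , inj₁ (sym (only _ (wf e′ false q)))))))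

  -- The two edges and a path between their far ends avoiding v form a circle.
  noncut⇒same-block : ∀ {b b′} → Block B → E B e ≡ true → endpt e b ≡ v → E T e′ ≡ true → endpt e′ b′ ≡ v →
                      ¬ CutVertex G T v → E B e′ ≡ true
  noncut⇒same-block {B} {e} {v} {e′} {b} {b′} isB@(wf , (_ , sE) , _) e∈B refl e′∈T p′ noncut with e′ ≟ e
  ... | yes refl = e∈B
  ... | no e′≢e = block-absorbs-path isB (wf e b e∈B) (wf e (not b) e∈B) (x≢v ∘ sym) (λ _ → id)
                    (step e′ b′ e′∈T p′ (reach-mono (λ _ → ⊖-edge (E T)) r))
                    ((λ q → v∉r (onV-mono r q)) , simple-mono r simple) e′ (inj₁ refl)
    where
    v∈T = wfT e b (sE e e∈B)
    far = endpt e (not b)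
    far′ = endpt e′ (not b′)
    x≢v : far ≢ v
    x≢v q = noncut (v∈T , inj₂ (e , e′ , sE e e∈B , ends-loop b q , end-false b q , e′∈T , e′≢e , end⇒incident b′ p′))
      where
      ends-loop : ∀ b → endpt e (not b) ≡ endpt e b → IsLoop G e
      ends-loop false q = sym q
      ends-loop true q = q
      end-false : ∀ b → endpt e (not b) ≡ endpt e b → endpt e false ≡ endpt e b
      end-false false q = refl
      end-false true q = q
    y≢v : far′ ≢ v
    y≢v q = noncut (v∈T , inj₂ (e′ , e , e′∈T , ends-loop b′ p′ q , end-false b′ p′ q , sE e e∈B , e′≢e ∘ sym , end⇒incident b refl))
      where
      ends-loop : ∀ c → endpt e′ c ≡ v → endpt e′ (not c) ≡ v → IsLoop G e′
      ends-loop false q r = trans q (sym r)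
      ends-loop true q r = trans r (sym q)
      end-false : ∀ c → endpt e′ c ≡ v → endpt e′ (not c) ≡ v → endpt e′ false ≡ v
      end-false false q r = q
      end-false true q r = r
    conn : Reach G (E T ⊖ v) far′ far
    conn = decidable-stable (reach? _ far′ far) λ ¬r → noncut (v∈T , inj₁ (far′ , far ,
      ∧-intro (wfT e′ (not b′) e′∈T) (cong not (dec-false (far′ ≟ v) y≢v)) ,
      ∧-intro (wfT e (not b) (sE e e∈B)) (cong not (dec-false (far ≟ v) x≢v)) ,
      reach-trans (subst (λ z → Reach G (E T) far′ z) p′ (reach-edge⁻ e′ b′ e′∈T)) (reach-edge e b (sE e e∈B)) , ¬r))
    r = proj₁ (simplify conn)
    simple = proj₂ (simplify conn)
    v∉r : ¬ OnV r v
    v∉r q with onV-end r q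
    ... | inj₁ s = y≢v (sym s)
    ... | inj₂ (e″ , b″ , s , t) = ⊖-avoid (E T) (onE⇒edge r s) b″ t

  sideEdge : Sub n m → Fin m → Bool
  sideEdge B e = E T e ∧ not (E B e)

  -- A path outside `B` that returned to it at another vertex would be an ear, and `B` would contain
  -- its first edge.
  side-meets-block : Block B → V B v ≡ true → V B x ≡ true → Reach G (sideEdge B) v x → x ≡ v
  side-meets-block {B} {v} {x} isB p q r = decidable-stable (x ≟ v) λ x≢v → go x≢v (proj₁ (simplify r)) (proj₂ (simplify r))
    where
    go : x ≢ v → (r : Reach G (sideEdge B) v x) → Simple r → ⊥
    go x≢v here s = x≢v refl
    go x≢v r@(step e b t _ _) s = true≢false
      (block-absorbs-path isB p q (x≢v ∘ sym) (λ e u → ∧-elimˡ u) r s e (inj₁ refl)) (not-true (∧-elimʳ {E T e} t))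

  -- The part of h hanging off the block B at its vertex v.
  module Side (h : Fin m → ℕ) (supp : ∀ e → h e ≢ 0 → E T e ≡ true) (isB : Block B) (v∈B : V B v ≡ true) where
    rest : Fin m → ℕ
    rest = h ↾ (not ∘ E B)

    S : Fin n → Bool
    S x = does (reach? (sideEdge B) v x)

    private
      closed : ∀ e → rest e ≢ 0 → S (endpt e false) ≡ S (endpt e true)
      closed e p with ↾-nonzero h (not ∘ E B) p
      ... | q , r = bool-ext
          (λ s → dec-true (reach? _ _ _) (reach-trans (fromDoes (reach? (sideEdge B) v _) s) (reach-edge e false t)))
          (λ s → dec-true (reach? _ _ _) (reach-trans (fromDoes (reach? (sideEdge B) v _) s) (reach-edge e true t)))
        where
        t : sideEdge B e ≡ true
        t = ∧-intro (supp e r) q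

    side : Fin m → ℕ
    side = cut rest S closed

    side≤ : ∀ e → side e ≤ rest e
    side≤ e = ↾-≤ rest (λ e → S (endpt e false)) e

    side-at : ∀ p → inc p side v ≡ inc p rest v
    side-at p = inc-cut-in rest S closed p (dec-true (reach? (sideEdge B) v v) here)

    -- A vertex other than `v` that is reached from `v` outside `B` is not on `B`, so nothing is
    -- lost there by restricting. Parity and conservation of `h` thus pass to `side` at every vertex
    -- except possibly `v`.
    side-off : x ≢ v → (∀ p → inc p side x ≡ inc p h x) ⊎ (∀ p → inc p side x ≡ 0)
    side-off {x} x≢v with S x in eq
    ... | false = inj₂ λ p → inc-cut-out rest S closed p eq
    ... | true = inj₁ λ p → trans (inc-cut-in rest S closed p eq)
                   (sym (trans (inc-↾-complement p h (E B) x) (cong (_+ inc p rest x) (inc-zero p λ e b _ q → ↾-false h (E B) (≢true λ e∈B →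
                      x≢v (side-meets-block isB v∈B (subst (λ z → V B z ≡ true) q (proj₁ isB e b e∈B)) (fromDoes (reach? (sideEdge B) v x) eq)))))))

  -- What hangs off `B` at `v` has an even total by the handshake lemma and an even amount at each
  -- other vertex, hence an even amount at `v`. Removing it from the even amount of `h` at `v`
  -- leaves the share of `B`.
  even-in-block : ∀ h → (∀ e → h e ≢ 0 → E T e ≡ true) → (∀ x → 2 ∣ D h x) → Block B → V B v ≡ true → 2 ∣ D (h ↾ E B) v
  even-in-block {B} {v} h supp even isB v∈B =
    ∣m+n∣m⇒∣n (subst (2 ∣_) (trans (inc-↾-complement allEnds h (E B) v) (+-comm (D (h ↾ E B) v) _)) (even v))
      (subst (2 ∣_) (side-at allEnds) even-side)
    where
    open Side h supp isB v∈B
    even-side : 2 ∣ D side v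
    even-side = even-remaining (D side) v (subst (2 ∣_) (sym (sum-inc allEnds side)) (even-sum _ λ e → even-double (side e)))
      λ x x≢v → case side-off x≢v of λ
        { (inj₁ p) → subst (2 ∣_) (sym (p allEnds)) (even x) ; (inj₂ p) → subst (2 ∣_) (sym (p allEnds)) (2 ∣0) }

-- Walks in the double cover: a state is a vertex together with the sign of the end through which
-- it is left, so that consecutive ends of a walk have opposite signs at their common vertex.
module Walks {n m : ℕ} (G : SignedGraph n m) (ω : EndSigns m) where
  open SignedGraph G
  open Incidence G

  State : Set
  State = Fin n × Sign

  private
    variable
      p q r a x : State

  -- The deck involution of the double cover.
  ι : State → State
  ι (v , s) = v , opposite s

  ι-ι : ∀ x → ι (ι x) ≡ x
  ι-ι (v , s) = cong (v ,_) (opposite-involutive s)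

  _≟ˢ_ : (p q : State) → Dec (p ≡ q)
  _≟ˢ_ = ≡-dec _≟_ _≟ₛ_

  -- Kronecker delta, with its test in the same form as in `atEnd`, so that counting ends and
  -- counting states match by computation.
  δ : State → State → ℕ
  δ (u , t) (v , s) = if does (t ≟ₛ s) ∧ does (u ≟ v) then 1 else 0

  δ-self : ∀ p → δ p p ≡ 1
  δ-self (u , t) rewrite dec-true (t ≟ₛ t) refl | dec-true (u ≟ u) refl = refl

  δ-≢ : p ≢ x → δ p x ≡ 0
  δ-≢ {u , t} {v , s} f with t ≟ₛ s | u ≟ v
  ... | yes refl | yes refl = ⊥-elim (f refl)
  ... | yes _ | no _ = refl
  ... | no _ | _ = refl

  δ-ι : ∀ p x → δ (ι p) (ι x) ≡ δ p x
  δ-ι (u , S.+) (v , S.+) = refl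
  δ-ι (u , S.+) (v , S.-) = refl
  δ-ι (u , S.-) (v , S.+) = refl
  δ-ι (u , S.-) (v , S.-) = refl

  δ-ι′ : ∀ p x → δ (ι p) x ≡ δ p (ι x)
  δ-ι′ p x = trans (cong (δ (ι p)) (sym (ι-ι x))) (δ-ι p (ι x))

  -- A walk that arrives through an end must leave through one of opposite sign; the state reached
  -- therefore carries the opposite of the sign of the far end.
  src tgt : Fin m → Bool → State
  src e b = endpt e b , ω e b
  tgt e b = ι (src e (not b))

  data Walk : State → State → Set where
    []   : Walk p p
    cons : ∀ e b → src e b ≡ p → tgt e b ≡ r → Walk r q → Walk p q

  unit : Fin m → Fin m → ℕ
  unit e e′ = if does (e ≟ e′) then 1 else 0

  use : Walk p q → Fin m → ℕ
  use [] _ = 0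
  use (cons e _ _ _ w) e′ = unit e e′ + use w e′

  dep arr : Walk p q → State → ℕ
  dep [] x = 0
  dep (cons {p} _ _ _ _ w) x = δ p x + dep w x
  arr [] x = 0
  arr (cons {r = r} _ _ _ _ w) x = δ r x + arr w x

  dep-arr : (w : Walk p q) → ∀ x → dep w x + δ q x ≡ arr w x + δ p x
  dep-arr [] x = refl
  dep-arr {p} {q} (cons {r = r} _ _ _ _ w) x = begin
    (δ p x + dep w x) + δ q x ≡⟨ +-assoc (δ p x) _ _ ⟩
    δ p x + (dep w x + δ q x) ≡⟨ cong (δ p x +_) (dep-arr w x) ⟩
    δ p x + (arr w x + δ r x) ≡⟨ cong (δ p x +_) (+-comm (arr w x) _) ⟩
    δ p x + (δ r x + arr w x) ≡⟨ +-comm (δ p x) _ ⟩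
    (δ r x + arr w x) + δ p x ∎
    where open ≡-Reasoning

  closed-dep-arr : (w : Walk p p) → ∀ x → dep w x ≡ arr w x
  closed-dep-arr {p} w x = +-cancelʳ-≡ (δ p x) _ _ (dep-arr w x)

  opaque
    unfolding inc

    -- The far end is recorded through the state reached, whose sign is opposite to that of the end;
    -- hence `opposite s` in the second term.
    inc-unit : ∀ s e b v → inc (endsOf ω s) (unit e) v ≡ δ (src e b) (v , s) + δ (tgt e b) (v , opposite s)
    inc-unit s e b v = trans (trans (sum-cong-≗ lem) (sum-indicator e X)) (lem′ b)
      where
      X : Fin m → ℕ
      X e′ = δ (src e′ false) (v , s) + δ (src e′ true) (v , s)
      lem : ∀ e′ → atEnd (endsOf ω s) (unit e) v e′ false + atEnd (endsOf ω s) (unit e) v e′ true ≡ (if does (e ≟ e′) then X e′ else 0)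
      lem e′ with does (e ≟ e′)
      ... | true = refl
      ... | false with endsOf ω s e′ false ∧ does (endpt e′ false ≟ v) | endsOf ω s e′ true ∧ does (endpt e′ true ≟ v)
      ...   | true | true = refl
      ...   | true | false = refl
      ...   | false | true = refl
      ...   | false | false = refl
      lem′ : ∀ b → X e ≡ δ (src e b) (v , s) + δ (tgt e b) (v , opposite s)
      lem′ false = cong (δ (src e false) (v , s) +_) (sym (δ-ι (src e true) (v , s)))
      lem′ true = trans (+-comm (δ (src e false) (v , s)) _) (cong (δ (src e true) (v , s) +_) (sym (δ-ι (src e false) (v , s))))

  inc-use : (w : Walk p q) → ∀ s v → inc (endsOf ω s) (use w) v ≡ dep w (v , s) + arr w (v , opposite s)
  inc-use [] s v = inc-zero (endsOf ω s) {λ _ → 0} (λ _ _ _ _ → refl)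
  inc-use (cons e b refl refl w) s v = begin
    inc (endsOf ω s) (λ e′ → unit e e′ + use w e′) v                ≡⟨ inc-+ (endsOf ω s) (unit e) (use w) v ⟩
    inc (endsOf ω s) (unit e) v + inc (endsOf ω s) (use w) v        ≡⟨ cong₂ _+_ (inc-unit s e b v) (inc-use w s v) ⟩
    (δp + δr) + (dep w (v , s) + arr w (v , opposite s))            ≡⟨ solve 4 (λ a b c d → (a :+ b) :+ (c :+ d) := (a :+ c) :+ (b :+ d)) refl δp δr (dep w (v , s)) (arr w (v , opposite s)) ⟩
    (δp + dep w (v , s)) + (δr + arr w (v , opposite s))            ∎
    where
    open ≡-Reasoning
    open +-*-Solver
    δp = δ (src e b) (v , s)
    δr = δ (tgt e b) (v , opposite s)

  Flow : (Fin m → ℕ) → Set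
  Flow h = ∀ v → inc (endsOf ω S.+) h v ≡ inc (endsOf ω S.-) h v

  flow-sign : ∀ {h} → Flow h → ∀ s v → inc (endsOf ω s) h v ≡ inc (endsOf ω (opposite s)) h v
  flow-sign f S.+ v = f v
  flow-sign f S.- v = sym (f v)

  flow-D : ∀ {h} → Flow h → ∀ v → D h v ≡ inc (endsOf ω S.+) h v + inc (endsOf ω S.+) h v
  flow-D {h} f v = trans (D-signs ω h v) (cong (inc (endsOf ω S.+) h v +_) (sym (f v)))

  flow-even : ∀ {h} → Flow h → ∀ v → 2 ∣ D h v
  flow-even {h} f v = subst (2 ∣_) (sym (flow-D f v)) (even-double (inc (endsOf ω S.+) h v))

  closed-inc : (w : Walk p p) → ∀ s v → inc (endsOf ω s) (use w) v ≡ dep w (v , s) + dep w (v , opposite s)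
  closed-inc w s v = trans (inc-use w s v) (cong (dep w (v , s) +_) (sym (closed-dep-arr w (v , opposite s))))

  -- Each passage through a vertex uses one end of either sign, which makes the count of
  -- `closed-inc` symmetric in the sign.
  closed-flow : (w : Walk p p) → Flow (use w)
  closed-flow w v = trans (closed-inc w S.+ v) (trans (+-comm (dep w (v , S.+)) _) (sym (closed-inc w S.- v)))

  infixr 5 _++_
  _++_ : Walk p q → Walk q r → Walk p r
  [] ++ w′ = w′
  cons e b f g w ++ w′ = cons e b f g (w ++ w′)

  use-++ : (w : Walk p q) (w′ : Walk q r) → ∀ e → use (w ++ w′) e ≡ use w e + use w′ e
  use-++ [] w′ e = refl
  use-++ (cons e _ _ _ w) w′ e′ = trans (cong (unit e e′ +_) (use-++ w w′ e′)) (sym (+-assoc (unit e e′) _ _))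

  dep-++ : (w : Walk p q) (w′ : Walk q r) → ∀ x → dep (w ++ w′) x ≡ dep w x + dep w′ x
  dep-++ [] w′ x = refl
  dep-++ (cons {p} _ _ _ _ w) w′ x = trans (cong (δ p x +_) (dep-++ w w′ x)) (sym (+-assoc (δ p x) _ _))

  private
    back : ∀ e b → src e b ≡ p → tgt e b ≡ r → Walk (ι r) (ι p)
    back e b f g = cons e (not b) (trans (sym (ι-ι _)) (cong ι g))
                     (trans (cong (ι ∘ src e) (not-involutive b)) (cong ι f)) []

  -- Reversal exchanges both the direction and the sheets. A walk from a state to its `ι`-image
  -- therefore reverses to a walk between the same two states in the same order, and can be replaced
  -- by it inside a longer walk.
  rev : Walk p q → Walk (ι q) (ι p)
  rev [] = []
  rev (cons e b f g w) = rev w ++ back e b f g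

  use-rev : (w : Walk p q) → ∀ e → use (rev w) e ≡ use w e
  use-rev [] e = refl
  use-rev (cons e b f g w) e′ = trans (use-++ (rev w) (back e b f g) e′)
    (trans (cong₂ _+_ (use-rev w e′) (+-identityʳ (unit e e′))) (+-comm (use w e′) _))

  dep-rev : (w : Walk p q) → ∀ x → dep (rev w) x ≡ arr w (ι x)
  dep-rev [] x = refl
  dep-rev (cons {r = r} e b f g w) x = trans (dep-++ (rev w) (back e b f g) x)
    (trans (cong₂ _+_ (dep-rev w x) (trans (+-identityʳ (δ (ι r) x)) (δ-ι′ r x))) (+-comm (arr w (ι x)) _))

  split : (w : Walk p q) → ∀ x → dep w x ≢ 0 → Σ (Walk p x) λ w₁ → Σ (Walk x q) λ w₂ →
          (∀ e → use w e ≡ use w₁ e + use w₂ e) × (∀ y → dep w y ≡ dep w₁ y + dep w₂ y) × dep w₁ x ≡ 0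
  split [] x f = ⊥-elim (f refl)
  split {p} (cons e b g h w) x f with p ≟ˢ x
  ... | yes refl = [] , cons e b g h w , (λ _ → refl) , (λ _ → refl) , refl
  ... | no p≢x with split w x (λ k → f (cong₂ _+_ (δ-≢ p≢x) k))
  ...   | w₁ , w₂ , u , d , z = cons e b g h w₁ , w₂ , (λ e′ → trans (cong (unit e e′ +_) (u e′)) (sym (+-assoc (unit e e′) _ _))) ,
            (λ y → trans (cong (δ p y +_) (d y)) (sym (+-assoc (δ p y) _ _))) , cong₂ _+_ (δ-≢ p≢x) z

  unit-self : ∀ e → unit e e ≡ 1
  unit-self e rewrite dec-true (e ≟ e) refl = refl

  cons-nonzero : ∀ e b f g (w : Walk r q) → use (cons {p} e b f g w) e ≢ 0
  cons-nonzero e b f g w eq = case trans (cong (_+ use w e) (sym (unit-self e))) eq of λ ()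

  use-nonzero : (w : Walk p q) → dep w x ≢ 0 → ∃ λ e → use w e ≢ 0
  use-nonzero [] f = ⊥-elim (f refl)
  use-nonzero (cons e b f g w) _ = e , cons-nonzero e b f g w

  rotate : (w : Walk p p) → ∀ x → dep w x ≢ 0 → Σ (Walk x x) λ w′ → (∀ e → use w e ≡ use w′ e) × (∀ y → dep w y ≡ dep w′ y)
  rotate w x f with split w x f
  ... | w₁ , w₂ , u , d , _ = w₂ ++ w₁ , (λ e → trans (u e) (trans (+-comm (use w₁ e) _) (sym (use-++ w₂ w₁ e)))) ,
                              (λ y → trans (d y) (trans (+-comm (dep w₁ y) _) (sym (dep-++ w₂ w₁ y))))

  Indecomposable : (Fin m → ℕ) → Set
  Indecomposable g = ∀ g₁ g₂ → Flow g₁ → Flow g₂ → (∀ e → g e ≡ g₁ e + g₂ e) → (∃ λ e → g₁ e ≢ 0) → (∃ λ e → g₂ e ≢ 0) → ⊥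

  -- A closed walk visiting a state twice splits into two closed walks.
  no-repeat : ∀ {g} → Indecomposable g → (w : Walk p p) → (∀ e → g e ≡ use w e) → ∀ x → dep w x ≤ 1
  no-repeat indec w u x with dep w x ℕ.≤? 1
  ... | yes f = f
  ... | no f with rotate w x (λ g → f (≤-trans (≤-reflexive g) z≤n))
  ...   | [] , _ , d = ⊥-elim (f (≤-trans (≤-reflexive (d x)) z≤n))
  ...   | cons e b g h w′ , u′ , d with split w′ x (λ k → f (≤-reflexive (trans (d x) (cong₂ _+_ (δ-self x) k))))
  ...     | w₁ , w₂ , u″ , d′ , z =
              ⊥-elim (indec (use c) (use w₂) (closed-flow c) (closed-flow w₂)
                (λ e′ → trans (u e′) (trans (u′ e′) (trans (cong (unit e e′ +_) (u″ e′)) (sym (+-assoc (unit e e′) _ _)))))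
                (e , cons-nonzero e b g h w₁)
                (use-nonzero w₂ λ k → f (≤-reflexive (trans (d x) (cong₂ _+_ (δ-self x) (trans (d′ x) (cong₂ _+_ z k)))))))
    where c = cons e b g h w₁

  -- As long as the walk is not closed, conservation provides an unused end leading into its
  -- starting state.
  closed-walk : ∀ {g} → Flow g → (∃ λ e → g e ≢ 0) →
                ∃ λ p → Σ (Walk p p) λ w → (∃ λ e → use w e ≢ 0) × ∃ λ r → ∀ e → g e ≡ use w e + r e
  closed-walk {g} flow (e₀ , g≢0) =
    grow (sum g) (cons e₀ false refl refl []) (e₀ , cons-nonzero e₀ false refl refl []) (λ e → g e ℕ.∸ unit e₀ e)
      (λ e → trans (sub-unit g e₀ g≢0 e) (cong (_+ (g e ℕ.∸ unit e₀ e)) (sym (+-identityʳ (unit e₀ e)))))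
      (sum-mono λ e → ℕₚ.m∸n≤m (g e) (unit e₀ e))
    where
    sub-unit : ∀ h e → h e ≢ 0 → ∀ e′ → h e′ ≡ unit e e′ + (h e′ ℕ.∸ unit e e′)
    sub-unit h e f e′ with e ≟ e′
    ... | yes refl = sym (ℕₚ.m+[n∸m]≡n (n≢0⇒n>0 f))
    ... | no _ = refl

    -- An end leading into the state `(u , t)` has sign `opposite t`. If none were left over, the
    -- walk would account for all of them, while it leaves its start once more than it arrives
    -- there; the ends of sign `t` at `u` would then outnumber those of sign `opposite t`.
    unused : ∀ {u t a} (w : Walk (u , t) a) r → (∀ e → g e ≡ use w e + r e) → (u , t) ≢ a → inc (endsOf ω (opposite t)) r u ≢ 0
    unused {u} {t} {a} w r split≡ p≢a r≡0 = ℕₚ.m≢1+m+n (inc (endsOf ω (opposite t)) g u) (begin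
      inc (endsOf ω (opposite t)) g u                          ≡⟨ sym (flow-sign {g} flow t u) ⟩
      inc (endsOf ω t) g u                                     ≡⟨ total t ⟩
      (dep w pᵤ + arr w (ι pᵤ)) + inc (endsOf ω t) r u           ≡⟨ cong (λ k → (k + arr w (ι pᵤ)) + inc (endsOf ω t) r u) dep≡ ⟩
      (suc (arr w pᵤ) + arr w (ι pᵤ)) + inc (endsOf ω t) r u     ≡⟨ cong (λ k → (suc (arr w pᵤ) + k) + inc (endsOf ω t) r u) arr≡ ⟩
      (suc (arr w pᵤ) + (dep w (ι pᵤ) + δ a (ι pᵤ))) + inc (endsOf ω t) r u
        ≡⟨ solve 4 (λ a b c d → (con 1 :+ a :+ (b :+ c)) :+ d := con 1 :+ ((b :+ a :+ con 0) :+ (c :+ d))) refl (arr w pᵤ) (dep w (ι pᵤ)) (δ a (ι pᵤ)) (inc (endsOf ω t) r u) ⟩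
      suc ((dep w (ι pᵤ) + arr w pᵤ + 0) + (δ a (ι pᵤ) + inc (endsOf ω t) r u))
        ≡⟨ cong (λ k → suc (k + (δ a (ι pᵤ) + inc (endsOf ω t) r u))) (sym total′) ⟩
      suc (inc (endsOf ω (opposite t)) g u + (δ a (ι pᵤ) + inc (endsOf ω t) r u)) ∎)
      where
      open ≡-Reasoning
      open +-*-Solver
      pᵤ : State
      pᵤ = u , t
      total : ∀ s → inc (endsOf ω s) g u ≡ (dep w (u , s) + arr w (u , opposite s)) + inc (endsOf ω s) r u
      total s = trans (inc-cong (endsOf ω s) {g} λ e _ _ _ → split≡ e) (trans (inc-+ (endsOf ω s) (use w) r u) (cong (_+ inc (endsOf ω s) r u) (inc-use w s u)))
      total′ : inc (endsOf ω (opposite t)) g u ≡ dep w (ι pᵤ) + arr w pᵤ + 0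
      total′ = trans (total (opposite t)) (cong₂ (λ j k → dep w (ι pᵤ) + arr w j + k) (ι-ι pᵤ) r≡0)
      dep≡ : dep w pᵤ ≡ suc (arr w pᵤ)
      dep≡ = trans (sym (+-identityʳ _)) (trans (cong (dep w pᵤ +_) (sym (δ-≢ (p≢a ∘ sym))))
               (trans (dep-arr w pᵤ) (trans (cong (arr w pᵤ +_) (δ-self pᵤ)) (+-comm (arr w pᵤ) 1))))
      ι≢ : ∀ s → (u , s) ≢ (u , opposite s)
      ι≢ S.+ ()
      ι≢ S.- ()
      arr≡ : arr w (ι pᵤ) ≡ dep w (ι pᵤ) + δ a (ι pᵤ)
      arr≡ = sym (trans (dep-arr w (ι pᵤ)) (trans (cong (arr w (ι pᵤ) +_) (δ-≢ (ι≢ t))) (+-identityʳ _)))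

    grow : ∀ {p a} k (w : Walk p a) → (∃ λ e → use w e ≢ 0) → ∀ r → (∀ e → g e ≡ use w e + r e) → sum r ≤ k →
           ∃ λ p → Σ (Walk p p) λ w → (∃ λ e → use w e ≢ 0) × ∃ λ r → ∀ e → g e ≡ use w e + r e
    grow {p} {a} k w nz r split≡ le with p ≟ˢ a
    ... | yes refl = p , w , nz , r , split≡
    ... | no p≢a with inc-nonzero (endsOf ω (opposite (proj₂ p))) {r} (unused w r split≡ p≢a)
    ...   | e , b , sgn , refl , re≢0 = next k le
      where
      r′ : Fin m → ℕ
      r′ e′ = r e′ ℕ.∸ unit e e′
      target : tgt e (not b) ≡ p
      target = trans (cong (ι ∘ src e) (not-involutive b))
        (cong (_ ,_) (trans (cong opposite (fromDoes (ω e b ≟ₛ _) sgn)) (opposite-involutive _)))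
      w′ : Walk (src e (not b)) a
      w′ = cons e (not b) refl target w
      split′ : ∀ e′ → g e′ ≡ use w′ e′ + r′ e′
      split′ e′ = trans (split≡ e′) (trans (cong (use w e′ +_) (sub-unit r e re≢0 e′))
        (solve 3 (λ a b c → a :+ (b :+ c) := (b :+ a) :+ c) refl (use w e′) (unit e e′) (r′ e′)))
        where open +-*-Solver
      smaller : sum r ≡ suc (sum r′)
      smaller = trans (sum-cong-≗ (sub-unit r e re≢0)) (trans (∑-distrib-+ (unit e) r′) (cong (_+ sum r′) (sum-indicator e (λ _ → 1))))
      next : ∀ k → sum r ≤ k → ∃ λ p → Σ (Walk p p) λ w → (∃ λ e → use w e ≢ 0) × ∃ λ r → ∀ e → g e ≡ use w e + r e
      next zero le = case trans (sym smaller) (ℕₚ.n≤0⇒n≡0 le) of λ ()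
      next (suc k) le = grow k w′ (e , cons-nonzero e (not b) refl target w) r′ split′ (ℕₚ.≤-pred (≤-trans (≤-reflexive (sym smaller)) le))

  flow-rest : ∀ {g g₁ g₂} → Flow g → Flow g₁ → (∀ e → g e ≡ g₁ e + g₂ e) → Flow g₂
  flow-rest {g} {g₁} {g₂} flow flow₁ split≡ v = +-cancelˡ-≡ (inc (endsOf ω S.+) g₁ v) _ _
    (trans (sym (both S.+)) (trans (flow v) (trans (both S.-) (cong (_+ inc (endsOf ω S.-) g₂ v) (sym (flow₁ v))))))
    where
    both : ∀ s → inc (endsOf ω s) g v ≡ inc (endsOf ω s) g₁ v + inc (endsOf ω s) g₂ v
    both s = trans (inc-cong (endsOf ω s) λ e _ _ _ → split≡ e) (inc-+ (endsOf ω s) g₁ g₂ v)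

  -- The complement of a subflow is a flow, so a nonzero subflow leaves nothing over. Connectedness
  -- and the sign condition at cut-vertices both follow by exhibiting a nonzero subflow that misses
  -- an edge.
  subflow-everything : ∀ {g} → Flow g → Indecomposable g → ∀ h → Flow h → (∀ e → h e ≤ g e) → (∃ λ e → h e ≢ 0) → ∀ e → h e ≡ g e
  subflow-everything {g} flow indec h flow′ h≤g nz e = decidable-stable (h e ℕ.≟ g e) λ h≢g →
    indec h (λ e → g e ℕ.∸ h e) flow′ (flow-rest {g₁ = h} flow flow′ split≡) split≡ nz
      (e , λ z → h≢g (≤-antisym (h≤g e) (ℕₚ.m∸n≡0⇒m≤n z)))
    where
    split≡ : ∀ e → g e ≡ h e + (g e ℕ.∸ h e)
    split≡ e = sym (ℕₚ.m+[n∸m]≡n (h≤g e))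

  covering-walk : ∀ {g} → Flow g → (∃ λ e → g e ≢ 0) → Indecomposable g → ∃ λ p → Σ (Walk p p) λ w → ∀ e → g e ≡ use w e
  covering-walk flow nz indec with closed-walk flow nz
  ... | p , w , nz′ , r , split≡ = p , w , λ e → sym (subflow-everything flow indec (use w) (closed-flow w)
          (λ e → ≤-trans (m≤m+n _ _) (≤-reflexive (sym (split≡ e)))) nz′ e)

  private
    D≤2 : ∀ {g v} → Flow g → (w : Walk p p) → (∀ e → g e ≡ use w e) → dep w (v , S.+) + dep w (v , S.-) ≤ 1 → D g v ≤ 2
    D≤2 {g = g} {v} flow w cover le = ≤-trans (≤-reflexive (flow-D {g} flow v)) (+-mono-≤ le′ le′)
      where
      le′ : inc (endsOf ω S.+) g v ≤ 1
      le′ = ≤-trans (≤-reflexive (trans (inc-cong (endsOf ω S.+) {g} λ e _ _ _ → cover e) (closed-inc w S.+ v))) le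

  -- `g₁` and `g₂` are to be the edge multiplicities of the two halves of a covering walk that
  -- visits `v` twice. They are not flows: at `v` the ends used by one half are all positive and
  -- those used by the other all negative.
  record Separated (g : Fin m → ℕ) (v : Fin n) : Set where
    field
      g₁ g₂ : Fin m → ℕ
      total : ∀ e → g e ≡ g₁ e + g₂ e
      disjoint : ∀ e → g₁ e ≡ 0 ⊎ g₂ e ≡ 0
      at₁ : D g₁ v ≡ 2
      at₂ : D g₂ v ≡ 2
      away : ∀ x → x ≢ v → D g₁ x ≡ 0 ⊎ D g₂ x ≡ 0

  -- A vertex is visited at most once in each state.  If it is visited in both, it cuts the closed
  -- walk into P and Q, and reversing Q gives another closed walk with the same edges; as no state
  -- repeats in either, P and Q have no other common vertex.
  local-structure : ∀ {g} → Flow g → (∃ λ e → g e ≢ 0) → Indecomposable g → ∀ v → D g v ≤ 2 ⊎ Separated g v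
  local-structure {g} flow nz indec v with covering-walk flow nz indec
  ... | p₀ , w₀ , cover₀ with dep w₀ (v , S.+) ℕ.≟ 0 | dep w₀ (v , S.-) ℕ.≟ 0
  ...   | yes z | _ = inj₁ (D≤2 flow w₀ cover₀ (+-mono-≤ (≤-reflexive z) (no-repeat indec w₀ cover₀ (v , S.-))))
  ...   | no _ | yes z = inj₁ (D≤2 flow w₀ cover₀ (+-mono-≤ (no-repeat indec w₀ cover₀ (v , S.+)) (≤-reflexive z)))
  ...   | no f | no f′ with rotate w₀ (v , S.+) f
  ...     | w , u , d with split w (v , S.-) (λ k → f′ (trans (d _) k))
  ...       | P , Q , uPQ , _ , _ = inj₂ record
    { g₁ = use P ; g₂ = use Q ; total = total ; disjoint = disjoint
    ; at₁ = trans (D-signs ω (use P) v) (cong₂ _+_ incP+ incP-) ; at₂ = trans (D-signs ω (use Q) v) (cong₂ _+_ incQ+ incQ-) ; away = away }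
    where
    total : ∀ e → g e ≡ use P e + use Q e
    total e = trans (cover₀ e) (trans (u e) (uPQ e))

    once : ∀ x → dep P x + dep Q x ≤ 1
    once x = ≤-trans (≤-reflexive (sym (dep-++ P Q x))) (no-repeat indec (P ++ Q) (λ e → trans (total e) (sym (use-++ P Q e))) x)

    once-rev : ∀ x → dep P x + arr Q (ι x) ≤ 1
    once-rev x = ≤-trans (≤-reflexive (trans (cong (dep P x +_) (sym (dep-rev Q x))) (sym (dep-++ P (rev Q) x))))
      (no-repeat indec (P ++ rev Q) (λ e → trans (total e) (trans (cong (use P e +_) (sym (use-rev Q e))) (sym (use-++ P (rev Q) e)))) x)

    at+ : dep P (v , S.+) ≡ 1 + arr P (v , S.+)
    at+ = trans (sym (+-identityʳ _)) (trans (dep-arr P (v , S.+)) (trans (cong (arr P (v , S.+) +_) (δ-self (v , S.+))) (+-comm (arr P (v , S.+)) 1)))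
    at- : dep Q (v , S.-) ≡ 1 + arr Q (v , S.-)
    at- = trans (sym (+-identityʳ _)) (trans (dep-arr Q (v , S.-)) (trans (cong (arr Q (v , S.-) +_) (δ-self (v , S.-))) (+-comm (arr Q (v , S.-)) 1)))
    at-′ : arr P (v , S.-) ≡ 1 + dep P (v , S.-)
    at-′ = trans (sym (+-identityʳ _)) (trans (sym (dep-arr P (v , S.-))) (trans (cong (dep P (v , S.-) +_) (δ-self (v , S.-))) (+-comm (dep P (v , S.-)) 1)))
    at+′ : arr Q (v , S.+) ≡ 1 + dep Q (v , S.+)
    at+′ = trans (sym (+-identityʳ _)) (trans (sym (dep-arr Q (v , S.+))) (trans (cong (dep Q (v , S.+) +_) (δ-self (v , S.+))) (+-comm (dep Q (v , S.+)) 1)))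

    force : ∀ {a b c} → a ≡ 1 + c → a + b ≤ 1 → b ≡ 0 × c ≡ 0
    force {b = b} {c} refl (s≤s le) = m+n≡0⇒n≡0 c (ℕₚ.n≤0⇒n≡0 le) , m+n≡0⇒m≡0 c (ℕₚ.n≤0⇒n≡0 le)

    f₁ : dep Q (v , S.+) ≡ 0 × arr P (v , S.+) ≡ 0
    f₁ = force at+ (once (v , S.+))
    f₂ : dep P (v , S.-) ≡ 0 × arr Q (v , S.-) ≡ 0
    f₂ = force at- (≤-trans (≤-reflexive (+-comm (dep Q (v , S.-)) _)) (once (v , S.-)))

    -- `P` leaves `v` through a positive end, and it also comes back through one, because the state
    -- `(v , S.-)` is entered through a positive end. For `Q` the signs are exchanged.
    incP+ : inc (endsOf ω S.+) (use P) v ≡ 2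
    incP+ = trans (inc-use P S.+ v) (cong₂ _+_ (trans at+ (cong suc (proj₂ f₁))) (trans at-′ (cong suc (proj₁ f₂))))
    incP- : inc (endsOf ω S.-) (use P) v ≡ 0
    incP- = trans (inc-use P S.- v) (cong₂ _+_ (proj₁ f₂) (proj₂ f₁))
    incQ+ : inc (endsOf ω S.+) (use Q) v ≡ 0
    incQ+ = trans (inc-use Q S.+ v) (cong₂ _+_ (proj₁ f₁) (proj₂ f₂))
    incQ- : inc (endsOf ω S.-) (use Q) v ≡ 2
    incQ- = trans (inc-use Q S.- v) (cong₂ _+_ (trans at- (cong suc (proj₂ f₂))) (trans at+′ (cong suc (proj₁ f₁))))

    module Away (x : Fin n) (x≢v : x ≢ v) where
      dep≡arr : ∀ {s t s′} (W : Walk (v , s) (v , t)) → dep W (x , s′) ≡ arr W (x , s′)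
      dep≡arr {s} {t} {s′} W = trans (sym (+-identityʳ _)) (trans (cong (dep W (x , s′) +_) (sym (δ-≢ {v , t} (x≢v ∘ sym ∘ cong proj₁))))
        (trans (dep-arr W (x , s′)) (trans (cong (arr W (x , s′) +_) (δ-≢ {v , s} (x≢v ∘ sym ∘ cong proj₁))) (+-identityʳ _))))

      D≡ : ∀ {s t} (W : Walk (v , s) (v , t)) → dep W (x , S.+) ≡ 0 → dep W (x , S.-) ≡ 0 → D (use W) x ≡ 0
      D≡ W p q = trans (D-signs ω (use W) x) (cong₂ _+_
        (trans (inc-use W S.+ x) (cong₂ _+_ p (trans (sym (dep≡arr W)) q)))
        (trans (inc-use W S.- x) (cong₂ _+_ q (trans (sym (dep≡arr W)) p))))

      zero-of : ∀ {a b} → a + b ≤ 1 → a ≢ 0 → b ≡ 0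
      zero-of {zero} le k = ⊥-elim (k refl)
      zero-of {suc a} {b} (s≤s le) k = m+n≡0⇒n≡0 a (ℕₚ.n≤0⇒n≡0 le)

      -- The sheet of `s` is excluded by the walk `P ++ Q`, the other sheet by `P ++ rev Q`.
      kill : ∀ s → dep P (x , s) ≢ 0 → ∀ t → dep Q (x , t) ≡ 0
      kill s k t with t ≟ₛ s
      ... | yes refl = zero-of (once (x , s)) k
      ... | no t≢s = trans (dep≡arr Q) (trans (cong (λ s → arr Q (x , s)) (≢⇒opposite t s t≢s)) (zero-of (once-rev (x , s)) k))

      result : D (use P) x ≡ 0 ⊎ D (use Q) x ≡ 0
      result with dep P (x , S.+) ℕ.≟ 0 | dep P (x , S.-) ℕ.≟ 0
      ... | no k | _ = inj₂ (D≡ Q (kill S.+ k S.+) (kill S.+ k S.-))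
      ... | yes _ | no k = inj₂ (D≡ Q (kill S.- k S.+) (kill S.- k S.-))
      ... | yes k | yes k′ = inj₁ (D≡ P k k′)

    away : ∀ x → x ≢ v → D (use P) x ≡ 0 ⊎ D (use Q) x ≡ 0
    away = Away.result

    -- An edge whose first end is away from `v` is settled by `away`; at `v` the sign of that end
    -- tells which half may use it.
    disjoint : ∀ e → use P e ≡ 0 ⊎ use Q e ≡ 0
    disjoint e with endpt e false ≟ v | ω e false in eq
    ... | no k | _ = [ (λ z → inj₁ (inc-zero⁻¹ allEnds z {b = false} refl refl)) , (λ z → inj₂ (inc-zero⁻¹ allEnds z {b = false} refl refl)) ] (away _ k)
    ... | yes k | S.+ = inj₂ (inc-zero⁻¹ (endsOf ω S.+) incQ+ {b = false} (cong (λ s → does (s ≟ₛ S.+)) eq) k)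
    ... | yes k | S.- = inj₁ (inc-zero⁻¹ (endsOf ω S.-) incP- {b = false} (cong (λ s → does (s ≟ₛ S.-)) eq) k)

-- Shapes of blocks: circles and bridges.

even≤2 : ∀ {k} → 2 ∣ k → k ≤ 2 → k ≡ 0 ⊎ k ≡ 2
even≤2 {0} _ _ = inj₁ refl
even≤2 {1} d _ with ∣⇒≤ d
... | s≤s ()
even≤2 {2} _ _ = inj₂ refl
even≤2 {suc (suc (suc _))} _ (s≤s (s≤s ()))

module BlockShapes {n m : ℕ} (G : SignedGraph n m) (T : Sub n m) (wfT : WellFormed G T) where
  open SignedGraph G
  open Incidence G
  open Paths G
  open Blocks G T wfT

  Bridge : Sub n m → Fin m → Set
  Bridge B e = (∀ e′ → E B e′ ≡ true ⇔ e′ ≡ e) × ¬ IsLoop G e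

  private
    variable
      B : Sub n m
      e : Fin m
      x : Fin n

  ↾-single : ∀ h → (∀ e′ → E B e′ ≡ true → e′ ≡ e) → ∀ e′ → e′ ≢ e → (h ↾ E B) e′ ≡ 0
  ↾-single {B} h only e′ p = ↾-false h (E B) (≢true λ q → p (only e′ q))

  ind-↾ : ∀ {h : Fin m → ℕ} (F : Fin m → Bool) → (∀ e → F e ≡ true → h e ≡ 1) → ∀ e → (h ↾ F) e ≡ ind (F e)
  ind-↾ F one e with F e in eq
  ... | true = one e eq
  ... | false = refl

  -- A loop whose block is a single edge counts as a circle.
  shape : Block B → IsCircle G B ⊎ SingleEdge G B → IsCircle G B ⊎ ∃ (Bridge B)
  shape isB (inj₁ c) = inj₁ c
  shape {B} isB (inj₂ (e , single)) with endpt e false ≟ endpt e true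
  ... | no ¬l = inj₂ (e , single , ¬l)
  ... | yes l = inj₁ (proj₁ isB , proj₁ (proj₂ (proj₂ isB)) , degree)
    where
    e∈B = Equivalence.from (single e) refl
    degree : ∀ v → V B v ≡ true → deg G (E B) v ≡ 2
    degree v p = trans (deg≡D (E B) v) (trans
      (D-only-loop {ind ∘ E B} {e} {v} (λ e′ q → cong ind (≢true λ r → q (Equivalence.to (single e′) r))) l
        (sym (good-loop-V (block⇒good isB) e∈B l v p)))
      (cong (λ b → ind b + ind b) e∈B))

  bridge-end : Block B → Bridge B e → V B x ≡ true → ∃ λ b → endpt e b ≡ x
  bridge-end {B} {e} {x} isB (single , _) p with endpt e false ≟ x
  ... | yes q = false , q
  ... | no q with reach-first (proj₂ (proj₁ (proj₂ (proj₂ isB))) x (endpt e false) p (proj₁ isB e false (Equivalence.from (single e) refl))) (q ∘ sym)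
  ...   | e′ , b , r , s , _ with Equivalence.to (single e′) r
  ...     | refl = b , s

  D-bridge : ∀ h → Block B → Bridge B e → V B x ≡ true → D (h ↾ E B) x ≡ h e
  D-bridge {B} {e} h isB br@(single , ¬l) p with bridge-end isB br p
  ... | b , q = trans (D-only-link (↾-single {B} h λ e′ → Equivalence.to (single e′)) ¬l b q) (↾-true h (E B) (Equivalence.from (single e) refl))

  D-circle : ∀ h → IsCircle G B → (∀ e → E B e ≡ true → h e ≡ 1) → V B x ≡ true → D (h ↾ E B) x ≡ 2
  D-circle {B} {x} h (_ , _ , degree) one p =
    trans (inc-cong allEnds λ e _ _ _ → ind-↾ (E B) one e) (trans (sym (deg≡D (E B) x)) (degree x p))

  -- An end of a bridge has degree one within it.
  circle-not-bridge : IsCircle G B → ¬ Bridge B e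
  circle-not-bridge {B} {e} circ@(wf , _ , degree) (single , ¬l) = case trans (sym (degree _ v₀∈B)) (trans (deg≡D (E B) _)
      (trans (D-only-link {ind ∘ E B} {e} (λ e′ q → cong ind (≢true λ r → q (Equivalence.to (single e′) r))) ¬l false refl)
        (cong ind e∈B))) of λ ()
    where
    e∈B = Equivalence.from (single e) refl
    v₀∈B : V B (endpt e false) ≡ true
    v₀∈B = wf e false e∈B

  circle-resp : ∀ {H K} → SameSub G H K → IsCircle G H → IsCircle G K
  circle-resp {H} {K} (sv , se) (wf , ((v₀ , p₀) , conn) , degree) =
    (λ e b p → trans (sym (sv _)) (wf e b (trans (se e) p))) ,
    ((v₀ , trans (sym (sv v₀)) p₀) , λ x y p q → reach-mono (λ e r → trans (sym (se e)) r) (conn x y (trans (sv x) p) (trans (sv y) q))) ,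
    λ v p → trans (deg≡D (E K) v) (trans (inc-cong allEnds λ e _ _ _ → cong ind (sym (se e))) (trans (sym (deg≡D (E H) v)) (degree v (trans (sv v) p))))

-- A directed circle-tree carries an indecomposable flow.

module Backward {n m : ℕ} (G : SignedGraph n m) (T : Sub n m) (wfT : WellFormed G T) (ω : EndSigns m) (g : Fin m → ℕ)
  (tree : CircleTree G T) (dir : Direction G T ω)
  (g≢0 : ∀ e → E T e ≡ true → g e ≢ 0) (g-supp : ∀ e → g e ≢ 0 → E T e ≡ true)
  (one : ∀ e → InCircleBlock G T e → g e ≡ 1) (two : ∀ e → OnBlockPath G T e → g e ≡ 2)
  (other : ∀ e → ¬ InCircleBlock G T e → ¬ OnBlockPath G T e → g e ≡ 0) where
  open SignedGraph G
  open Incidence G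
  open Paths G
  open Decide G
  open Blocks G T wfT
  open BlockShapes G T wfT
  open Walks G ω using (Flow; flow-even; flow-sign; Indecomposable)

  private
    variable
      B B′ : Sub n m
      e e′ : Fin m
      x : Fin n

    shapeT : Block B → IsCircle G B ⊎ ∃ (Bridge B)
    shapeT {B} isB = shape isB (proj₁ (proj₂ (proj₂ tree)) B isB)

    g-circle : Block B → IsCircle G B → ∀ e → E B e ≡ true → g e ≡ 1
    g-circle {B} isB circ e e∈B = one e (B , isB , circ , e∈B)

    -- No block path through the bridge has to be constructed: off the circle blocks the indicator
    -- is 2 or 0, and 0 is excluded on the support.
    g-bridge : Block B → Bridge B e → g e ≡ 2
    g-bridge {B} {e} isB br@(single , _) = decidable-stable (g e ℕ.≟ 2) λ g≢2 →
      g≢0 e (proj₂ (proj₁ (proj₂ isB)) e e∈B) (other e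
        (λ { (C , isC , circ , e∈C) → circle-not-bridge (circle-resp (edge⇒same isC isB e∈C e∈B) circ) br })
        (g≢2 ∘ two e))
      where e∈B = Equivalence.from (single e) refl

    D-block : Block B → V B x ≡ true → D (g ↾ E B) x ≡ 2
    D-block isB p with shapeT isB
    ... | inj₁ circ = D-circle g circ (g-circle isB circ) p
    ... | inj₂ (e , br) = trans (D-bridge g isB br p) (g-bridge isB br)

    -- On a circle this is the sink-or-source condition of a direction; a bridge has only one end at
    -- `x`.
    one-sign : Block B → CutVertex G T x → V B x ≡ true → ∃ λ s → ∀ e b → E B e ≡ true → endpt e b ≡ x → ω e b ≡ s
    one-sign {B} {x} isB cut p with shapeT isB
    ... | inj₁ circ = [ (S.+ ,_) , (S.- ,_) ] (proj₂ (proj₂ dir) B isB circ x cut p)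
    ... | inj₂ (e , br@(single , ¬l)) with bridge-end isB br p
    ...   | b , q = ω e b , λ e′ b′ r s → same-end (Equivalence.to (single e′) r) b b′ q s
      where
      same-end : ∀ {e′} → e′ ≡ e → ∀ b b′ → endpt e b ≡ x → endpt e′ b′ ≡ x → ω e′ b′ ≡ ω e b
      same-end refl false false q s = refl
      same-end refl false true q s = ⊥-elim (¬l (trans q (sym s)))
      same-end refl true false q s = ⊥-elim (¬l (trans s (sym q)))
      same-end refl true true q s = refl

  module _ (h : Fin m → ℕ) (h≤g : ∀ e → h e ≤ g e) (flow : Flow h) where
    private
      h-supp : ∀ e → h e ≢ 0 → E T e ≡ true
      h-supp e p = g-supp e λ q → p (ℕₚ.n≤0⇒n≡0 (≤-trans (h≤g e) (≤-reflexive q)))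

      ↾≤ : ∀ e → (h ↾ E B) e ≤ (g ↾ E B) e
      ↾≤ {B} e with E B e
      ... | true = h≤g e
      ... | false = z≤n

      zero-or-two : Block B → V B x ≡ true → D (h ↾ E B) x ≡ 0 ⊎ D (h ↾ E B) x ≡ 2
      zero-or-two {B} isB p = even≤2 (even-in-block h h-supp (flow-even flow) isB p)
        (≤-trans (inc-mono allEnds λ e _ _ _ → ↾≤ {B} e) (≤-reflexive (D-block isB p)))

      block-off : ∀ {b} → D (h ↾ E B) x ≡ 0 → E B e ≡ true → endpt e b ≡ x → h e ≡ 0
      block-off {B} {b = b} p q r = trans (sym (↾-true h (E B) q)) (inc-zero⁻¹ allEnds p {b = b} refl r)

      block-on : ∀ {b} → Block B → D (h ↾ E B) x ≡ 2 → E B e ≡ true → endpt e b ≡ x → h e ≡ g e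
      block-on {B} {x} {e} {b} isB p q r = trans (sym (↾-true h (E B) q)) (trans
        (inc-≤-≡ allEnds (↾≤ {B}) (trans p (sym (D-block isB (subst (λ v → V B v ≡ true) r (proj₁ isB e b q))))) {b = b} refl r) (↾-true g (E B) q))

      -- Edges of different blocks meet only at cut-vertices, where two blocks contain all ends.
      -- Each block shows a single sign at `x`, and the two signs differ because `x` is neither a
      -- sink nor a source; conservation of `h` at `x` then equates the two shares.
      cross : ∀ {b b′} → Block B → Block B′ → E B e ≡ true → endpt e b ≡ x → E B′ e′ ≡ true → endpt e′ b′ ≡ x → E B e′ ≡ false →
              D (h ↾ E B) x ≡ D (h ↾ E B′) x
      cross {B} {B′} {e} {x} {e′} {b} {b′} isB isB′ p q p′ q′ e′∉B =
        trans (sym (only-sign isB s₁ sgn₁ λ e b e∈T r t → [ id , (λ u → ⊥-elim (s₁≢s₂ (trans (sym t) (sgn₂ e b u r)))) ] (covered e b e∈T r)))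
          (trans (trans (flow-sign flow s₁ x) (cong (λ s → inc (endsOf ω s) h x) (sym (≢⇒opposite s₂ s₁ (s₁≢s₂ ∘ sym)))))
            (only-sign isB′ s₂ sgn₂ λ e b e∈T r t → [ (λ u → ⊥-elim (s₁≢s₂ (trans (sym (sgn₁ e b u r)) t))) , id ] (covered e b e∈T r)))
        where
        x∈B : V B x ≡ true
        x∈B = subst (λ v → V B v ≡ true) q (proj₁ isB e b p)
        x∈B′ : V B′ x ≡ true
        x∈B′ = subst (λ v → V B′ v ≡ true) q′ (proj₁ isB′ e′ b′ p′)
        isCut : CutVertex G T x
        isCut = decidable-stable (cutVertex? T x) λ nc →
          true≢false (noncut⇒same-block isB p q (proj₂ (proj₁ (proj₂ isB′)) e′ p′) q′ nc) e′∉B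
        -- The two blocks granted by the circle-tree axiom are `B` and `B′` in some order, since
        -- `e′` tells these apart.
        pigeonhole : ∀ {C B₁ B₂} → SameSub G B B₁ ⊎ SameSub G B B₂ → SameSub G B′ B₁ ⊎ SameSub G B′ B₂ →
                     SameSub G C B₁ ⊎ SameSub G C B₂ → SameSub G C B ⊎ SameSub G C B′
        pigeonhole (inj₁ r) (inj₁ s) _ = ⊥-elim (true≢false (trans (proj₂ r e′) (trans (sym (proj₂ s e′)) p′)) e′∉B)
        pigeonhole (inj₂ r) (inj₂ s) _ = ⊥-elim (true≢false (trans (proj₂ r e′) (trans (sym (proj₂ s e′)) p′)) e′∉B)
        pigeonhole (inj₁ r) (inj₂ s) (inj₁ t) = inj₁ (same-trans t (same-sym r))
        pigeonhole (inj₁ r) (inj₂ s) (inj₂ t) = inj₂ (same-trans t (same-sym s))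
        pigeonhole (inj₂ r) (inj₁ s) (inj₁ t) = inj₂ (same-trans t (same-sym s))
        pigeonhole (inj₂ r) (inj₁ s) (inj₂ t) = inj₁ (same-trans t (same-sym r))
        covered : ∀ e b → E T e ≡ true → endpt e b ≡ x → E B e ≡ true ⊎ E B′ e ≡ true
        covered e b e∈T r with block-of e∈T | proj₂ (proj₂ (proj₂ (proj₂ tree))) x isCut
        ... | C , isC , e∈C | B₁ , B₂ , _ , _ , _ , _ , _ , all with
              pigeonhole (all B isB x∈B) (all B′ isB′ x∈B′) (all C isC (subst (λ v → V C v ≡ true) r (proj₁ isC e b e∈C)))
        ...   | inj₁ same = inj₁ (trans (sym (proj₂ same e)) e∈C)
        ...   | inj₂ same = inj₂ (trans (sym (proj₂ same e)) e∈C)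
        s₁ = proj₁ (one-sign isB isCut x∈B)
        sgn₁ = proj₂ (one-sign isB isCut x∈B)
        s₂ = proj₁ (one-sign isB′ isCut x∈B′)
        sgn₂ = proj₂ (one-sign isB′ isCut x∈B′)
        s₁≢s₂ : s₁ ≢ s₂
        s₁≢s₂ eq = excluded s₁ λ e b e∈T r → [ (λ u → sgn₁ e b u r) , (λ u → trans (sgn₂ e b u r) (sym eq)) ] (covered e b e∈T r)
          where
          excluded : ∀ s → (∀ e b → E T e ≡ true → endpt e b ≡ x → ω e b ≡ s) → ⊥
          excluded S.+ = proj₁ (proj₁ (proj₂ dir) x (proj₁ isCut))
          excluded S.- = proj₂ (proj₁ (proj₂ dir) x (proj₁ isCut))
        only-sign : ∀ {C} → Block C → ∀ s → (∀ e b → E C e ≡ true → endpt e b ≡ x → ω e b ≡ s) →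
                    (∀ e b → E T e ≡ true → endpt e b ≡ x → ω e b ≡ s → E C e ≡ true) → inc (endsOf ω s) h x ≡ D (h ↾ E C) x
        only-sign {C} isC s sgn conv = sym (trans (D-sign ω s (h ↾ E C) x) (trans (cong₂ _+_
            (inc-cong (endsOf ω s) λ e b r t → restore e b (fromDoes (_ ≟ₛ _) r) t)
            (inc-zero (endsOf ω (opposite s)) λ e b r t → ↾-false h (E C) (≢true λ u → s≢opposite[s] s (trans (sym (sgn e b u t)) (fromDoes (_ ≟ₛ _) r)))))
          (+-identityʳ _)))
          where
          restore : ∀ e b → ω e b ≡ s → endpt e b ≡ x → (h ↾ E C) e ≡ h e
          restore e b r t with h e ℕ.≟ 0
          ... | no he≢0 = ↾-true h (E C) (conv e b (h-supp e he≢0) t r)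
          ... | yes he≡0 = trans (ℕₚ.n≤0⇒n≡0 (≤-trans (↾-≤ h (E C) e) (≤-reflexive he≡0))) (sym he≡0)

    abstract
      agree : ∀ {b b′} → E T e ≡ true → endpt e b ≡ x → E T e′ ≡ true → endpt e′ b′ ≡ x → (h e ≡ 0 × h e′ ≡ 0) ⊎ (h e ≡ g e × h e′ ≡ g e′)
      agree {e} {x} {e′} {b} {b′} p q p′ q′ with block-of p
      ... | B , isB , e∈B with zero-or-two isB (subst (λ v → V B v ≡ true) q (proj₁ isB e b e∈B)) | E B e′ in eq
      ...   | inj₁ z | true = inj₁ (block-off {B} z e∈B q , block-off {B} z eq q′)
      ...   | inj₂ t | true = inj₂ (block-on isB t e∈B q , block-on isB t eq q′)
      ...   | zt | false with block-of p′
      ...     | B′ , isB′ , e′∈B′ with zt | cross isB isB′ e∈B q e′∈B′ q′ eq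
      ...       | inj₁ z | c = inj₁ (block-off {B} z e∈B q , block-off {B′} (trans (sym c) z) e′∈B′ q′)
      ...       | inj₂ t | c = inj₂ (block-on isB t e∈B q , block-on isB′ (trans (sym c) t) e′∈B′ q′)

    nonzero⇒everything : ∀ e₀ → h e₀ ≢ 0 → ∀ e → E T e ≡ true → h e ≡ g e
    nonzero⇒everything e₀ nz e e∈T =
      reach-invariant Full (λ e b p full → spread e (not b) p (λ q → g≢0 e p (trans (sym (full e b p refl)) q)))
        (proj₂ (proj₁ (proj₂ tree)) (endpt e₀ false) (endpt e false) (wfT e₀ false e₀∈T) (wfT e false e∈T))
        (spread e₀ false e₀∈T nz) e false e∈T refl
      where
      e₀∈T = h-supp e₀ nz
      Full : Fin n → Set
      Full y = ∀ e b → E T e ≡ true → endpt e b ≡ y → h e ≡ g e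
      spread : ∀ e b → E T e ≡ true → h e ≢ 0 → Full (endpt e b)
      spread e b p q e′ b′ p′ q′ with agree p refl p′ q′
      ... | inj₁ (z , _) = ⊥-elim (q z)
      ... | inj₂ (_ , r) = r

  indecomposable : Indecomposable g
  indecomposable g₁ g₂ flow₁ _ split≡ (e₁ , nz₁) (e₂ , nz₂) = nz₂ (+-cancelˡ-≡ (g₁ e₂) _ _
    (trans (trans (sym (split≡ e₂)) (sym (nonzero⇒everything g₁ (λ e → ≤-trans (m≤m+n _ _) (≤-reflexive (sym (split≡ e)))) flow₁ e₁ nz₁ e₂
      (g-supp e₂ λ q → nz₂ (m+n≡0⇒n≡0 (g₁ e₂) (trans (sym (split≡ e₂)) q)))))) (sym (+-identityʳ _))))

-- Signs, parity and counting.

signPow-even : ∀ {k} → 2 ∣ k → signPow k ≡ S.+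
signPow-even {k} (divides q refl) = go q
  where
  go : ∀ q → signPow (q ℕ.* 2) ≡ S.+
  go zero = refl
  go (suc q) = trans (opposite-involutive _) (go q)

signPow-+ : ∀ a b → signPow (a + b) ≡ signPow a S.* signPow b
signPow-+ zero b = refl
signPow-+ (suc a) b = trans (cong opposite (signPow-+ a b)) (lem (signPow a) (signPow b))
  where
  lem : ∀ s t → opposite (s S.* t) ≡ opposite s S.* t
  lem S.+ t = refl
  lem S.- t = opposite-involutive t

signPow-cong : ∀ a b → 2 ∣ a + b → signPow a ≡ signPow b
signPow-cong a b d with signPow a | signPow b | trans (sym (signPow-+ a b)) (signPow-even d)
... | S.+ | S.+ | _ = refl
... | S.- | S.- | _ = refl

sum-double : ∀ {k} (h : Fin k → ℕ) → sum (λ i → h i + h i) ≡ sum h + sum h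
sum-double h = ∑-distrib-+ h h

double-injective : ∀ {a b} → a + a ≡ b + b → a ≡ b
double-injective {a} {b} p with ℕₚ.<-cmp a b
... | tri< q _ _ = ⊥-elim (ℕₚ.<⇒≢ (ℕₚ.+-mono-< q q) p)
... | tri≈ _ q _ = q
... | tri> _ _ q = ⊥-elim (ℕₚ.<⇒≢ (ℕₚ.+-mono-< q q) (sym p))

length-filter : ∀ {k} {P : Fin k → Set} (P? : ∀ i → Dec (P i)) → length (filter P? (allFin k)) ≡ sum (λ i → ind (does (P? i)))
length-filter {k} P? = go k id
  where
  go : ∀ j (f : Fin j → Fin k) → length (filter P? (tabulate f)) ≡ sum (λ i → ind (does (P? (f i))))
  go zero f = refl
  go (suc j) f with does (P? (f zero))
  ... | true = cong suc (go j (f ∘ suc))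
  ... | false = go j (f ∘ suc)

-- The support of an indecomposable flow is a directed sesqui-Eulerian circle-tree.

module Forward {n m : ℕ} (G : SignedGraph n m) (T : Sub n m) (wfT : WellFormed G T) (ω : EndSigns m) (g : Fin m → ℕ)
  (g≢0 : ∀ e → E T e ≡ true → g e ≢ 0) (g-supp : ∀ e → g e ≢ 0 → E T e ≡ true)
  (T-end : ∀ v → V T v ≡ true → ∃₂ λ e b → E T e ≡ true × SignedGraph.endpt G e b ≡ v)
  (orientation : IsOrientation G ω) (flow : Walks.Flow G ω g) (nz : ∃ λ e → g e ≢ 0) (indec : Walks.Indecomposable G ω g) where
  open SignedGraph G
  open Incidence G hiding (cut)
  open Paths G
  open Decide G
  open Blocks G T wfT
  open BlockShapes G T wfT
  open Walks G ω using (Flow; flow-even; subflow-everything; Separated; local-structure)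

  private
    variable
      B B′ : Sub n m

  -- The component of `x` carries a nonzero subflow, which would have to be all of `g`; yet `g` does
  -- not vanish at `y`.
  connected : Connected G T
  connected = (endpt (proj₁ nz) false , wfT _ false (g-supp _ (proj₂ nz))) , λ x y p q →
    decidable-stable (reach? (E T) x y) λ ¬r → Disconnected.absurd x y p q ¬r
    where
    module Disconnected (x y : Fin n) (x∈T : V T x ≡ true) (y∈T : V T y ≡ true) (¬r : ¬ Reach G (E T) x y) where
      S : Fin n → Bool
      S z = does (reach? (E T) x z)
      closed : ∀ e → g e ≢ 0 → S (endpt e false) ≡ S (endpt e true)
      closed e p = bool-ext
        (λ s → dec-true (reach? _ _ _) (reach-trans (fromDoes (reach? (E T) x _) s) (reach-edge e false (g-supp e p))))
        (λ s → dec-true (reach? _ _ _) (reach-trans (fromDoes (reach? (E T) x _) s) (reach-edge e true (g-supp e p))))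
      part : Fin m → ℕ
      part = Incidence.cut G g S closed
      part-flow : Flow part
      part-flow z with S z in eq
      ... | true = trans (inc-cut-in g S closed _ eq) (trans (flow z) (sym (inc-cut-in g S closed _ eq)))
      ... | false = trans (inc-cut-out g S closed _ eq) (sym (inc-cut-out g S closed _ eq))
      D-nonzero : ∀ {z} → V T z ≡ true → D g z ≢ 0
      D-nonzero {z} p q with T-end z p
      ... | e , b , r , s = g≢0 e r (inc-zero⁻¹ allEnds q {b = b} refl s)
      part-nonzero : ∃ λ e → part e ≢ 0
      part-nonzero with inc-nonzero allEnds (subst (_≢ 0) (sym (inc-cut-in g S closed allEnds (dec-true (reach? (E T) x x) here))) (D-nonzero x∈T))
      ... | e , _ , _ , _ , r = e , r
      absurd : ⊥
      absurd = D-nonzero y∈T (trans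
        (inc-cong allEnds λ e _ _ _ → sym (subflow-everything flow indec part part-flow (↾-≤ g (λ e → S (endpt e false))) part-nonzero e))
        (inc-cut-out g S closed allEnds (dec-false (reach? (E T) x y) ¬r)))

  private
    -- The halves of the walk meet only at `v`, so edges of `B` from both halves cannot be joined
    -- past `v`. If one of the two edges is a loop, the loop clause of `CutVertex` applies instead.
    separated⇒cut : ∀ {v} (sep : Separated g v) → let open Separated sep in ∀ {e b e′ b′} →
                    V B v ≡ true → (∀ x y → V B x ≡ true → V B y ≡ true → Reach G (E B) x y) → WellFormed G B → SubOf G B T →
                    E B e ≡ true → endpt e b ≡ v → g₁ e ≢ 0 → E B e′ ≡ true → endpt e′ b′ ≡ v → g₂ e′ ≢ 0 → CutVertex G B v
    separated⇒cut {B} {v} sep {e} {b} {e′} {b′} v∈B conn wf (_ , sE) p q r p′ q′ r′ with endpt e false ≟ endpt e true | endpt e′ false ≟ endpt e′ true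
    ... | yes l | _ = v∈B , inj₂ (e , e′ , p , l , trans (loop-end l false b) q , p′ , e′≢e , end⇒incident b′ q′)
      where
      open Separated sep
      e′≢e : e′ ≢ e
      e′≢e refl = [ r , r′ ] (disjoint e)
    ... | no _ | yes l = v∈B , inj₂ (e′ , e , p′ , l , trans (loop-end l false b′) q′ , p , e≢e′ , end⇒incident b q)
      where
      open Separated sep
      e≢e′ : e ≢ e′
      e≢e′ refl = [ r , r′ ] (disjoint e)
    ... | no ¬l | no ¬l′ = v∈B , inj₁ (endpt e (not b) , endpt e′ (not b′) ,
            ∧-intro (wf e (not b) p) (cong not (dec-false (_ ≟ _) (far≢ ¬l b q))) ,
            ∧-intro (wf e′ (not b′) p′) (cong not (dec-false (_ ≟ _) (far≢ ¬l′ b′ q′))) ,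
            conn _ _ (wf e (not b) p) (wf e′ (not b′) p′) , separate)
      where
      open Separated sep
      far≢ : ∀ {e} → ¬ IsLoop G e → ∀ b → endpt e b ≡ v → endpt e (not b) ≢ v
      far≢ ¬l false q r = ¬l (trans q (sym r))
      far≢ ¬l true q r = ¬l (trans r (sym q))
      -- Away from `v` each vertex is met by at most one half, so belonging to the first half
      -- persists along paths that avoid `v`.
      kept : ∀ e″ b″ → (E B ⊖ v) e″ ≡ true → D g₁ (endpt e″ b″) ≢ 0 → D g₁ (endpt e″ (not b″)) ≢ 0
      kept e″ b″ p nz₁ z with away (endpt e″ b″) (⊖-avoid (E B) p b″)
      ... | inj₁ k = nz₁ k
      ... | inj₂ k = g≢0 e″ (sE e″ (⊖-edge (E B) p)) (trans (total e″)
              (cong₂ _+_ (inc-zero⁻¹ allEnds z {b = not b″} refl refl) (inc-zero⁻¹ allEnds k {b = b″} refl refl)))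
      separate : ¬ Reach G (E B ⊖ v) (endpt e (not b)) (endpt e′ (not b′))
      separate path with away (endpt e′ (not b′)) (far≢ ¬l′ b′ q′)
      ... | inj₁ k = reach-invariant (λ y → D g₁ y ≢ 0) kept path (λ z → r (inc-zero⁻¹ allEnds z {b = not b} refl refl)) k
      ... | inj₂ k = r′ (inc-zero⁻¹ allEnds k {b = not b′} refl refl)

    -- A block has no cut-vertex, so at `v` it can draw on only one half of the walk, and each half
    -- amounts to 2 there.
    D-block≤2 : ∀ {v} → Block B → V B v ≡ true → D (g ↾ E B) v ≤ 2
    D-block≤2 {B} {v} isB v∈B with local-structure flow nz indec v
    ... | inj₁ le = ≤-trans (inc-mono allEnds λ e _ _ _ → ↾-≤ g (E B) e) le
    ... | inj₂ sep = bound (D (g₁ ↾ E B) v ℕ.≟ 0) (D (g₂ ↾ E B) v ℕ.≟ 0)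
      where
      open Separated sep
      sum≡ : D (g ↾ E B) v ≡ D (g₁ ↾ E B) v + D (g₂ ↾ E B) v
      sum≡ = trans (inc-cong allEnds λ e _ _ _ → restrict e) (inc-+ allEnds (g₁ ↾ E B) (g₂ ↾ E B) v)
        where
        restrict : ∀ e → (g ↾ E B) e ≡ (g₁ ↾ E B) e + (g₂ ↾ E B) e
        restrict e with E B e
        ... | true = total e
        ... | false = refl
      bound : Dec (D (g₁ ↾ E B) v ≡ 0) → Dec (D (g₂ ↾ E B) v ≡ 0) → D (g ↾ E B) v ≤ 2
      bound (yes z) _ = ≤-trans (≤-reflexive (trans sum≡ (cong (_+ D (g₂ ↾ E B) v) z))) (≤-trans (inc-mono allEnds λ e _ _ _ → ↾-≤ g₂ (E B) e) (≤-reflexive at₂))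
      bound (no _) (yes z) = ≤-trans (≤-reflexive (trans sum≡ (trans (cong (D (g₁ ↾ E B) v +_) z) (+-identityʳ _)))) (≤-trans (inc-mono allEnds λ e _ _ _ → ↾-≤ g₁ (E B) e) (≤-reflexive at₁))
      bound (no k) (no k′) with inc-nonzero allEnds k | inc-nonzero allEnds k′
      ... | e , b , _ , q , r | e′ , b′ , _ , q′ , r′ = ⊥-elim (proj₁ (proj₂ (proj₂ (proj₂ isB))) v
            (separated⇒cut {B} sep {e} {b} {e′} {b′} v∈B (proj₂ (proj₁ (proj₂ (proj₂ isB)))) (proj₁ isB) (proj₁ (proj₂ isB))
              (proj₁ (↾-nonzero g₁ (E B) r)) q (proj₂ (↾-nonzero g₁ (E B) r)) (proj₁ (↾-nonzero g₂ (E B) r′)) q′ (proj₂ (↾-nonzero g₂ (E B) r′))))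

  block-end : ∀ {v} → Block B → V B v ≡ true → ∃₂ λ e b → E B e ≡ true × endpt e b ≡ v
  block-end {B} {v} isB v∈B with T-end v (proj₁ (proj₁ (proj₂ isB)) v v∈B)
  ... | e , b , p , q = block-has-end isB v∈B p q

  block⊆T : Block B → ∀ {e} → E B e ≡ true → E T e ≡ true
  block⊆T isB p = proj₂ (proj₁ (proj₂ isB)) _ p

  abstract
    D-block : ∀ {v} → Block B → V B v ≡ true → D (g ↾ E B) v ≡ 2
    D-block {B} {v} isB v∈B with even≤2 (even-in-block g g-supp (flow-even flow) isB v∈B) (D-block≤2 isB v∈B)
    ... | inj₂ p = p
    ... | inj₁ z with block-end isB v∈B
    ...   | e , b , p , q = ⊥-elim (g≢0 e (block⊆T isB p) (trans (sym (↾-true g (E B) p)) (inc-zero⁻¹ allEnds z {b = b} refl q)))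

  D≤4 : ∀ v → D g v ≤ 4
  D≤4 v with local-structure flow nz indec v
  ... | inj₁ le = ≤-trans le (s≤s (s≤s z≤n))
  ... | inj₂ sep = ≤-reflexive (trans (inc-cong allEnds λ e _ _ _ → total e) (trans (inc-+ allEnds g₁ g₂ v) (cong₂ _+_ at₁ at₂)))
    where open Separated sep

  block-edge≤2 : Block B → ∀ {e} → E B e ≡ true → g e ≤ 2
  block-edge≤2 {B} isB {e} p = ≤-trans (≤-reflexive (sym (↾-true g (E B) p)))
    (≤-trans (≤inc allEnds (g ↾ E B) {b = false} refl refl) (≤-reflexive (D-block isB (proj₁ isB e false p))))

  Unit : Sub n m → Set
  Unit B = ∀ e → E B e ≡ true → g e ≡ 1

  abstract
    -- If all values are 1, `D-block` is exactly 2-regularity. Any other value is 2 and already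
    -- exhausts the share of the block at both ends of its edge, so no further edge of `B` touches
    -- it and connectedness leaves it alone.
    kind : Block B → (IsCircle G B × Unit B) ⊎ ∃ λ e → Bridge B e × g e ≡ 2
    kind {B} isB@(wf , (_ , sE) , (conn₀ , conn) , _) with any? (λ e → (E B e ≟ᵇ true) ×-dec ¬? (g e ℕ.≟ 1))
    ... | no ¬p = inj₁ ((wf , (conn₀ , conn) , degree) , unit)
      where
      unit : Unit B
      unit e p = decidable-stable (g e ℕ.≟ 1) λ q → ¬p (e , p , q)
      degree : ∀ v → V B v ≡ true → deg G (E B) v ≡ 2
      degree v p = trans (deg≡D (E B) v) (trans (inc-cong allEnds λ e _ _ _ → sym (ind-↾ (E B) unit e)) (D-block isB p))
    ... | yes (e , e∈B , g≢1) = inj₂ (e , (single , ¬l) , g≡2)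
      where
      is2 : ∀ k → k ≢ 0 → k ≢ 1 → k ≤ 2 → k ≡ 2
      is2 0 p _ _ = ⊥-elim (p refl)
      is2 1 _ p _ = ⊥-elim (p refl)
      is2 2 _ _ _ = refl
      is2 (suc (suc (suc _))) _ _ (s≤s (s≤s ()))
      g≡2 : g e ≡ 2
      g≡2 = is2 (g e) (g≢0 e (sE e e∈B)) g≢1 (block-edge≤2 isB e∈B)
      gB≡2 : (g ↾ E B) e ≡ 2
      gB≡2 = trans (↾-true g (E B) e∈B) g≡2
      ¬l : ¬ IsLoop G e
      ¬l l with ≤-trans (≤-reflexive (cong₂ _+_ (sym gB≡2) (sym gB≡2))) (≤-trans (loop≤D (g ↾ E B) l refl) (≤-reflexive (D-block isB (wf e false e∈B))))
      ... | s≤s (s≤s ())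
      alone : ∀ e′ b b′ → E B e′ ≡ true → endpt e b ≡ endpt e′ b′ → e′ ≡ e
      alone e′ b b′ p q = decidable-stable (e′ ≟ e) λ e′≢e → g≢0 e′ (sE e′ p) (trans (sym (↾-true g (E B) p)) (trans
          (sym (inc-≤-≡ allEnds {only} {g ↾ E B} (λ e″ → ↾-≤ (g ↾ E B) isE e″)
            (≤-antisym (inc-mono allEnds λ e″ _ _ _ → ↾-≤ (g ↾ E B) isE e″)
              (≤-trans (≤-reflexive (trans (D-block isB (subst (λ v → V B v ≡ true) q (wf e b e∈B))) (sym (trans (↾-true (g ↾ E B) isE (dec-true (e ≟ e) refl)) gB≡2))))
                (≤inc allEnds only {b = b} refl q))) {b = b′} refl refl))
          (↾-false (g ↾ E B) isE {e′} (dec-false (e′ ≟ e) e′≢e))))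
        where
        isE : Fin m → Bool
        isE e″ = does (e″ ≟ e)
        only : Fin m → ℕ
        only = (g ↾ E B) ↾ isE
      OnEdge : Fin n → Set
      OnEdge z = ∃ λ b → endpt e b ≡ z
      single : ∀ e′ → E B e′ ≡ true ⇔ e′ ≡ e
      single e′ = mk⇔ (λ p → forth p (reach-invariant OnEdge
          (λ { e″ b″ r (c , s) → case alone e″ c b″ r s of λ { refl → not b″ , refl } })
          (conn (endpt e false) (endpt e′ false) (wf e false e∈B) (wf e′ false p)) (false , refl))) (λ { refl → e∈B })
        where
        forth : E B e′ ≡ true → OnEdge (endpt e′ false) → e′ ≡ e
        forth p (c , s) = alone e′ c false p s

  circle-unit : Block B → IsCircle G B → Unit B
  circle-unit isB circ with kind isB
  ... | inj₁ (_ , unit) = unit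
  ... | inj₂ (_ , br , _) = ⊥-elim (circle-not-bridge circ br)

  private
    balanced⇒D≡0 : ∀ {v} s → inc (endsOf ω (opposite s)) g v ≡ 0 → D g v ≡ 0
    balanced⇒D≡0 {v} s z = trans (D-sign ω s g v) (cong₂ _+_ (trans (Walks.flow-sign G ω flow s v) z) z)

    not-monochrome : ∀ {v} s → V T v ≡ true → ¬ (∀ e b → E T e ≡ true → endpt e b ≡ v → ω e b ≡ s)
    not-monochrome {v} s v∈T mono with T-end v v∈T
    ... | e , b , p , q = g≢0 e p (inc-zero⁻¹ allEnds (balanced⇒D≡0 s (inc-zero (endsOf ω (opposite s)) λ e b r t →
            decidable-stable (g e ℕ.≟ 0) λ ge≢0 → s≢opposite[s] s (trans (sym (mono e b (g-supp e ge≢0) t)) (fromDoes (_ ≟ₛ _) r)))) {b = b} refl q)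

  no-sink-source : ∀ v → V T v ≡ true → ¬ Sink G (E T) ω v × ¬ Source G (E T) ω v
  no-sink-source v p = not-monochrome S.+ p , not-monochrome S.- p

  private
    Leaving : Fin n → Fin n → Set
    Leaving v x = ∃₂ λ e b → E T e ≡ true × endpt e b ≡ v × endpt e (not b) ≢ v × Reach G (E T ⊖ v) x (endpt e (not b))

    -- Applied to a path in both directions, this supplies for each side of a cut-vertex an edge
    -- leading into that side.
    first-hit : ∀ {v x y} → Reach G (E T) x y → x ≢ v → Reach G (E T ⊖ v) x y ⊎ Leaving v x
    first-hit here p = inj₁ here
    first-hit {v} (step e b q refl r) p with endpt e (not b) ≟ v
    ... | yes s = inj₂ (e , not b , q , s , (λ t → p (trans (sym (endpt-not-not refl)) t)) ,
                        subst (λ c → Reach G (E T ⊖ v) (endpt e b) (endpt e c)) (sym (not-involutive b)) here)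
    ... | no s with first-hit r s
    ...   | inj₁ t = inj₁ (step e b (⊖-intro′ (E T) b q p s) refl t)
    ...   | inj₂ (e′ , b′ , u , u′ , u″ , t) = inj₂ (e′ , b′ , u , u′ , u″ , step e b (⊖-intro′ (E T) b q p s) refl t)

  -- A block containing an edge into either side would connect the far ends while avoiding `v`. In
  -- the loop case, the block of the loop contains nothing else.
  cut-edges : ∀ {v} → CutVertex G T v → ∃₂ λ e b → ∃₂ λ e′ b′ → E T e ≡ true × endpt e b ≡ v × E T e′ ≡ true × endpt e′ b′ ≡ v ×
              (∀ {B} → Block B → E B e ≡ true → E B e′ ≡ true → ⊥)
  cut-edges (_ , inj₂ (e , e′ , p , l , q , p′ , e′≢e , i)) with incident⇒end i
  ... | b′ , q′ = e , false , e′ , b′ , p , q , p′ , q′ , λ isB r r′ → e′≢e (good-loop-E (block⇒good isB) r l e′ r′)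
  cut-edges {v} (_ , inj₁ (x , y , x∈ , y∈ , r , ¬r)) with
      first-hit r (fromDoes-false (x ≟ v) (not-true (∧-elimʳ {V T x} x∈))) |
      first-hit (reach-sym r) (fromDoes-false (y ≟ v) (not-true (∧-elimʳ {V T y} y∈)))
  ... | inj₁ t | _ = ⊥-elim (¬r t)
  ... | inj₂ _ | inj₁ t = ⊥-elim (¬r (reach-sym t))
  ... | inj₂ (e , b , p , q , f , t) | inj₂ (e′ , b′ , p′ , q′ , f′ , t′) = e , b , e′ , b′ , p , q , p′ , q′ , λ {B} isB u u′ →
          ¬r (reach-trans t (reach-trans (reach-mono (⊖-mono (proj₂ (proj₁ (proj₂ isB))))
            (good-avoiding (block⇒good isB) v (proj₁ isB e (not b) u) (proj₁ isB e′ (not b′) u′) f f′)) (reach-sym t′)))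

  private
    vertex∈ : Block B → ∀ {e b v} → E B e ≡ true → endpt e b ≡ v → V B v ≡ true
    vertex∈ {B} isB {e} {b} p q = subst (λ z → V B z ≡ true) q (proj₁ isB e b p)

  cut-blocks : ∀ v → CutVertex G T v → ∃₂ λ B₁ B₂ → IsBlock G T B₁ × IsBlock G T B₂ × V B₁ v ≡ true × V B₂ v ≡ true ×
               ¬ SameSub G B₁ B₂ × (∀ B → IsBlock G T B → V B v ≡ true → SameSub G B B₁ ⊎ SameSub G B B₂)
  cut-blocks v isCut with cut-edges isCut
  ... | e , b , e′ , b′ , p , q , p′ , q′ , apart with block-of p | block-of p′
  ...   | B₁ , is₁ , e∈₁ | B₂ , is₂ , e′∈₂ = B₁ , B₂ , is₁ , is₂ , v∈₁ , v∈₂ ,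
          (λ same → apart is₁ e∈₁ (trans (proj₂ same e′) e′∈₂)) , third
    where
    v∈₁ = vertex∈ is₁ e∈₁ q
    v∈₂ = vertex∈ is₂ e′∈₂ q′
    third : ∀ B → IsBlock G T B → V B v ≡ true → SameSub G B B₁ ⊎ SameSub G B B₂
    third B isB v∈B with block-end isB v∈B
    ... | e″ , b″ , p″ , q″ with E B₁ e″ in eq₁ | E B₂ e″ in eq₂
    ...   | true | _ = inj₁ (edge⇒same isB is₁ p″ eq₁)
    ...   | false | true = inj₂ (edge⇒same isB is₂ p″ eq₂)
    -- Three different blocks share no edge and take 2 each at `v`, which exceeds the bound 4.
    ...   | false | false = ⊥-elim (6≰4 (≤-trans (≤-reflexive (sym total)) (≤-trans (inc-mono allEnds λ e _ _ _ → below e) (D≤4 v))))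
      where
      6≰4 : ¬ (6 ≤ 4)
      6≰4 (s≤s (s≤s (s≤s (s≤s ()))))
      total : D (λ e → (g ↾ E B₁) e + ((g ↾ E B₂) e + (g ↾ E B) e)) v ≡ 6
      total = trans (inc-+ allEnds (g ↾ E B₁) _ v) (cong₂ _+_ (D-block is₁ v∈₁)
        (trans (inc-+ allEnds (g ↾ E B₂) (g ↾ E B) v) (cong₂ _+_ (D-block is₂ v∈₂) (D-block isB v∈B))))
      below : ∀ e → (g ↾ E B₁) e + ((g ↾ E B₂) e + (g ↾ E B) e) ≤ g e
      below z with E B₁ z in z₁ | E B₂ z in z₂ | E B z in z₃
      ... | true | true | _ = ⊥-elim (apart is₁ e∈₁ (trans (proj₂ (edge⇒same is₁ is₂ z₁ z₂) e′) e′∈₂))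
      ... | true | false | true = ⊥-elim (true≢false (trans (sym (proj₂ (edge⇒same isB is₁ z₃ z₁) e″)) p″) eq₁)
      ... | true | false | false = ≤-reflexive (+-identityʳ (g z))
      ... | false | true | true = ⊥-elim (true≢false (trans (sym (proj₂ (edge⇒same isB is₂ z₃ z₂) e″)) p″) eq₂)
      ... | false | true | false = ≤-reflexive (+-identityʳ (g z))
      ... | false | false | true = ≤-refl
      ... | false | false | false = z≤n

  private
    cut-other-edge : ∀ {v} → Block B → CutVertex G T v → ∃₂ λ e b → E T e ≡ true × endpt e b ≡ v × E B e ≡ false
    cut-other-edge {B} isB isCut with cut-edges isCut
    ... | e , b , e′ , b′ , p , q , p′ , q′ , apart with E B e in eq | E B e′ in eq′
    ...   | false | _ = e , b , p , q , eq
    ...   | true | false = e′ , b′ , p′ , q′ , eq′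
    ...   | true | true = ⊥-elim (apart isB eq eq′)

  -- Otherwise the part of g hanging off B at v would be a flow by itself.
  block-unbalanced : ∀ {v} → Block B → V B v ≡ true → CutVertex G T v →
                     inc (endsOf ω S.+) (g ↾ E B) v ≢ inc (endsOf ω S.-) (g ↾ E B) v
  block-unbalanced {B} {v} isB v∈B isCut bal with cut-other-edge isB isCut | block-end isB v∈B
  ... | e′ , b′ , p′ , q′ , e′∉B | e , b , p , q = g≢0 e (block⊆T isB p) (trans (sym (subflow-everything flow indec side side-flow
          (λ z → ≤-trans (side≤ z) (↾-≤ g (not ∘ E B) z)) side-nonzero e))
          (ℕₚ.n≤0⇒n≡0 (≤-trans (side≤ e) (≤-reflexive (↾-false g (not ∘ E B) (cong not p))))))
    where
    open Side g g-supp isB v∈B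
    rest-balanced : inc (endsOf ω S.+) rest v ≡ inc (endsOf ω S.-) rest v
    rest-balanced = +-cancelˡ-≡ (inc (endsOf ω S.+) (g ↾ E B) v) _ _ (trans (sym (inc-↾-complement (endsOf ω S.+) g (E B) v))
      (trans (flow v) (trans (inc-↾-complement (endsOf ω S.-) g (E B) v) (cong (_+ inc (endsOf ω S.-) rest v) (sym bal)))))
    side-flow : Flow side
    side-flow z with z ≟ v
    ... | yes refl = trans (side-at (endsOf ω S.+)) (trans rest-balanced (sym (side-at (endsOf ω S.-))))
    ... | no z≢v with side-off z≢v
    ...   | inj₁ f = trans (f (endsOf ω S.+)) (trans (flow z) (sym (f (endsOf ω S.-))))
    ...   | inj₂ f = trans (f (endsOf ω S.+)) (sym (f (endsOf ω S.-)))
    D-rest≢0 : D rest v ≢ 0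
    D-rest≢0 k = g≢0 e′ p′ (trans (sym (↾-true g (not ∘ E B) (cong not e′∉B))) (inc-zero⁻¹ allEnds k {b = b′} refl q′))
    side-nonzero : ∃ λ e → side e ≢ 0
    side-nonzero with inc-nonzero allEnds (λ k → D-rest≢0 (trans (sym (side-at allEnds)) k))
    ... | z , _ , _ , _ , r = z , r

  private
    sum≡2 : ∀ a b → a + b ≡ 2 → a ≢ b → (a ≡ 2 × b ≡ 0) ⊎ (a ≡ 0 × b ≡ 2)
    sum≡2 0 b p _ = inj₂ (refl , p)
    sum≡2 1 1 p q = ⊥-elim (q refl)
    sum≡2 2 0 p _ = inj₁ (refl , refl)

  cut-ends : ∀ {v} → Block B → V B v ≡ true → CutVertex G T v →
             (inc (endsOf ω S.+) (g ↾ E B) v ≡ 2 × inc (endsOf ω S.-) (g ↾ E B) v ≡ 0) ⊎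
             (inc (endsOf ω S.+) (g ↾ E B) v ≡ 0 × inc (endsOf ω S.-) (g ↾ E B) v ≡ 2)
  cut-ends {B} {v} isB v∈B isCut = sum≡2 _ _ (trans (sym (D-signs ω (g ↾ E B) v)) (D-block isB v∈B)) (block-unbalanced isB v∈B isCut)

  private
    no-end : ∀ {v} → Block B → ∀ s → inc (endsOf ω s) (g ↾ E B) v ≡ 0 → ∀ e b → E B e ≡ true → endpt e b ≡ v → ω e b ≢ s
    no-end {B} isB s z e b p q r = g≢0 e (block⊆T isB p) (trans (sym (↾-true g (E B) p)) (inc-zero⁻¹ (endsOf ω s) z {b = b} (dec-true (ω e b ≟ₛ s) r) q))

  sink-or-source : ∀ B → Block B → IsCircle G B → ∀ v → CutVertex G T v → V B v ≡ true → Sink G (E B) ω v ⊎ Source G (E B) ω v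
  sink-or-source B isB _ v isCut v∈B with cut-ends isB v∈B isCut
  ... | inj₁ (_ , z) = inj₁ λ e b p q → decidable-stable (ω e b ≟ₛ S.+) λ r → no-end isB S.- z e b p q (≢⇒opposite (ω e b) S.+ r)
  ... | inj₂ (z , _) = inj₂ λ e b p q → decidable-stable (ω e b ≟ₛ S.-) λ r → no-end isB S.+ z e b p q (≢⇒opposite (ω e b) S.- r)

  direction : Direction G T ω
  direction = (λ e _ → orientation e refl) , no-sink-source , sink-or-source

  -- Otherwise the bridge would be the only edge at this end, with a single end there, and the
  -- vertex would be a sink or a source.
  bridge-neighbour : ∀ {e} → Block B → Bridge B e → ∀ b → ∃₂ λ e′ b′ → E T e′ ≡ true × endpt e′ b′ ≡ endpt e b × E B e′ ≡ false
  bridge-neighbour {B} {e} isB (single , ¬l) b with any? (λ e′ → (E T e′ ≟ᵇ true) ×-dec ((E B e′ ≟ᵇ false) ×-dec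
                                                          (endpt e′ false ≟ endpt e b ⊎-dec endpt e′ true ≟ endpt e b)))
  ... | yes (e′ , p , q , i) with incident⇒end i
  ...   | b′ , r = e′ , b′ , p , r , q
  bridge-neighbour {B} {e} isB (single , ¬l) b | no ¬p =
    ⊥-elim (not-monochrome (ω e b) (wfT e b (block⊆T isB e∈B)) λ e′ b′ p q → same-end (only e′ b′ p q) b b′ q)
    where
    e∈B = Equivalence.from (single e) refl
    only : ∀ e′ b′ → E T e′ ≡ true → endpt e′ b′ ≡ endpt e b → e′ ≡ e
    only e′ b′ p q with E B e′ in eq
    ... | true = Equivalence.to (single e′) eq
    ... | false = ⊥-elim (¬p (e′ , p , eq , end⇒incident b′ q))
    same-end : ∀ {e′} → e′ ≡ e → ∀ b b′ → endpt e′ b′ ≡ endpt e b → ω e′ b′ ≡ ω e b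
    same-end refl false false q = refl
    same-end refl true true q = refl
    same-end refl false true q = ⊥-elim (¬l (sym q))
    same-end refl true false q = ⊥-elim (¬l q)

  -- Other blocks touch a bridge at both ends. If there were only one of them, it would share two
  -- vertices with the bridge and coincide with it.
  end-block-circle : ∀ B → Block B → EndBlock G T B → IsCircle G B
  end-block-circle B isB (B′ , isB′ , ¬same , _ , unique) with kind isB
  ... | inj₁ (circ , _) = circ
  ... | inj₂ (e , br@(single , ¬l) , _) = ⊥-elim (¬same (same-sym (two-vertices⇒same isB isB′ ¬l
          (proj₁ isB e false e∈B) (proj₁ isB e true e∈B) (touches false) (touches true))))
    where
    e∈B = Equivalence.from (single e) refl
    touches : ∀ b → V B′ (endpt e b) ≡ true
    touches b with bridge-neighbour isB br b
    ... | e′ , b′ , p , q , e′∉B with block-of p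
    ...   | C , isC , e′∈C = trans (sym (proj₁ (unique C isC (λ same → true≢false (trans (sym (proj₂ same e′)) e′∈C) e′∉B)
              (endpt e b , proj₁ isB e b e∈B , vertex∈ isC e′∈C q)) (endpt e b))) (vertex∈ isC e′∈C q)

  circle-tree : CircleTree G T
  circle-tree = (proj₁ nz , g-supp _ (proj₂ nz)) , connected ,
    (λ B isB → [ (λ c → inj₁ (proj₁ c)) , (λ { (e , (single , _) , _) → inj₂ (e , single) }) ] (kind isB)) ,
    end-block-circle , cut-blocks

  -- Where nothing is cut, all of `g` at `v` lies in `B`, so conservation halves the amount 2.
  noncut-ends : ∀ {v} → Block B → V B v ≡ true → ¬ CutVertex G T v → inc (endsOf ω S.+) (g ↾ E B) v ≡ 1
  noncut-ends {B} {v} isB v∈B noncut with block-end isB v∈B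
  ... | e , b , p , q = double-injective (trans (cong (inc (endsOf ω S.+) (g ↾ E B) v +_)
          (trans (all S.+) (trans (flow v) (sym (all S.-))))) (trans (sym (D-signs ω (g ↾ E B) v)) (D-block isB v∈B)))
    where
    restore : ∀ e′ b′ → endpt e′ b′ ≡ v → (g ↾ E B) e′ ≡ g e′
    restore e′ b′ q′ with g e′ ℕ.≟ 0
    ... | no k = ↾-true g (E B) (noncut⇒same-block isB p q (g-supp e′ k) q′ noncut)
    ... | yes k = trans (ℕₚ.n≤0⇒n≡0 (≤-trans (↾-≤ g (E B) e′) (≤-reflexive k))) (sym k)
    all : ∀ s → inc (endsOf ω s) (g ↾ E B) v ≡ inc (endsOf ω s) g v
    all s = inc-cong (endsOf ω s) λ e′ b′ _ q′ → restore e′ b′ q′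

  -- σ(e) = (-1)^(a+1) with a the number of positive ends of e.  Summing over the circle C by vertices,
  -- each vertex contributes 1 for itself (there are as many edges as vertices) plus its positive ends in C:
  -- one if it is not a cut-vertex, none or two if it is.
  circle-sign : ∀ C → Block C → IsCircle G C → ∃ λ p → Count (λ v → CutVertex G T v × V C v ≡ true) p × circleSign G C ≡ signPow p
  circle-sign C isC circ@(wf , _ , degree) = length cuts ,
      (cuts , filter⁺ isCut? (allFin⁺ n) , (λ v → mk⇔ (proj₂ ∘ ∈-filter⁻ isCut? {v} {allFin n}) (∈-filter⁺ isCut? (∈-allFin v))) , refl) ,
      trans sign≡ (signPow-cong (sum k) (length cuts) parity)
    where
    isCut? : ∀ v → Dec (CutVertex G T v × V C v ≡ true)
    isCut? v = cutVertex? T v ×-dec (V C v ≟ᵇ true)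
    cuts : List (Fin n)
    cuts = filter isCut? (allFin n)
    h : Fin m → ℕ
    h = ind ∘ E C
    k : Fin m → ℕ
    k e = ((if endsOf ω S.+ e false then h e else 0) + (if endsOf ω S.+ e true then h e else 0)) + h e
    edge-sign : ∀ e → (if E C e then σ e else S.+) ≡ signPow (k e)
    edge-sign e with E C e
    ... | false with ω e false | ω e true
    ...   | S.+ | S.+ = refl
    ...   | S.+ | S.- = refl
    ...   | S.- | S.+ = refl
    ...   | S.- | S.- = refl
    edge-sign e | true with ω e false | ω e true | orientation e refl
    ...   | S.+ | S.+ | q = q
    ...   | S.+ | S.- | q = q
    ...   | S.- | S.+ | q = q
    ...   | S.- | S.- | q = q
    sign≡ : circleSign G C ≡ signPow (sum k)
    sign≡ = go m id
      where
      go : ∀ j (f : Fin j → Fin m) → foldr (λ e s → if E C e then σ e S.* s else s) S.+ (tabulate f) ≡ signPow (sum (k ∘ f))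
      go zero f = refl
      go (suc j) f = trans (cong (λ t → if E C (f zero) then σ (f zero) S.* t else t) (go j (f ∘ suc)))
        (trans (factor (E C (f zero))) (trans (cong (S._* signPow (sum (k ∘ f ∘ suc))) (edge-sign (f zero))) (sym (signPow-+ (k (f zero)) _))))
        where
        factor : ∀ c → (if c then σ (f zero) S.* signPow (sum (k ∘ f ∘ suc)) else signPow (sum (k ∘ f ∘ suc)))
                     ≡ (if c then σ (f zero) else S.+) S.* signPow (sum (k ∘ f ∘ suc))
        factor true = refl
        factor false = refl
    gC≡h : ∀ e → (g ↾ E C) e ≡ h e
    gC≡h = ind-↾ (E C) (circle-unit isC circ)
    D-h : ∀ v → D h v ≡ ind (V C v) + ind (V C v)
    D-h v with V C v in eq
    ... | true = trans (sym (deg≡D (E C) v)) (degree v eq)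
    ... | false = inc-zero allEnds λ e b _ q → cong ind (≢true λ p → true≢false (subst (λ z → V C z ≡ true) q (wf e b p)) eq)
    -- The handshake lemma for a 2-regular subgraph, halved.
    edges≡vertices : sum h ≡ sum (ind ∘ V C)
    edges≡vertices = double-injective (trans (sym (sum-double h)) (trans (sym (sum-inc allEnds h)) (trans (sum-cong-≗ D-h) (sum-double (ind ∘ V C)))))
    N : Fin n → ℕ
    N = inc (endsOf ω S.+) h
    sum-k : sum k ≡ sum (λ v → N v + ind (V C v))
    sum-k = trans (∑-distrib-+ _ h) (trans (cong₂ _+_ (sym (sum-inc (endsOf ω S.+) h)) edges≡vertices) (sym (∑-distrib-+ N (ind ∘ V C))))
    N≡ : ∀ v → N v ≡ inc (endsOf ω S.+) (g ↾ E C) v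
    N≡ v = inc-cong (endsOf ω S.+) λ e _ _ _ → sym (gC≡h e)
    N-outside : ∀ v → V C v ≡ false → N v ≡ 0
    N-outside v eq = inc-zero (endsOf ω S.+) λ e b _ q → cong ind (≢true λ p → true≢false (subst (λ z → V C z ≡ true) q (wf e b p)) eq)
    vertex-parity : ∀ v → 2 ∣ (N v + ind (V C v)) + ind (does (isCut? v))
    vertex-parity v with V C v in eq | cutVertex? T v
    ... | false | yes _ = subst (λ z → 2 ∣ (z + 0) + 0) (sym (N-outside v eq)) (2 ∣0)
    ... | false | no _ = subst (λ z → 2 ∣ (z + 0) + 0) (sym (N-outside v eq)) (2 ∣0)
    ... | true | no noncut = subst (λ z → 2 ∣ (z + 1) + 0) (sym (trans (N≡ v) (noncut-ends isC eq noncut))) (even-double 1)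
    ... | true | yes isCut = [ (λ p → subst (λ z → 2 ∣ (z + 1) + 1) (sym (trans (N≡ v) (proj₁ p))) (even-double 2)) ,
                               (λ p → subst (λ z → 2 ∣ (z + 1) + 1) (sym (trans (N≡ v) (proj₁ p))) (even-double 1)) ] (cut-ends isC eq isCut)
    parity : 2 ∣ sum k + length cuts
    parity = subst (2 ∣_) (trans (∑-distrib-+ (λ v → N v + ind (V C v)) _) (cong₂ _+_ (sym sum-k) (sym (length-filter isCut?)))) (even-sum _ vertex-parity)

  sesqui : SesquiEulerianCircleTree G T
  sesqui = circle-tree , circle-sign

  circle-one : ∀ e → InCircleBlock G T e → g e ≡ 1
  circle-one e (C , isC , circ , e∈C) = circle-unit isC circ e e∈C

  path-two : ∀ e → OnBlockPath G T e → g e ≡ 2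
  path-two e (_ , _ , es , _ , edges , _ , i , refl) with proj₂ (proj₂ (edges i))
  ... | B , isB , ¬circ , e∈B with kind isB
  ...   | inj₁ (circ , _) = ⊥-elim (¬circ circ)
  ...   | inj₂ (e′ , (single , _) , two) = trans (cong g (Equivalence.to (single (es i)) e∈B)) two

  private
    -- By `kind` these are the bridges, since `g` is 1 on circle blocks. Selecting them by value
    -- makes membership a Boolean that `Reach` can use.
    F : Fin m → Bool
    F e = does (g e ℕ.≟ 2)

    F⊆T : ∀ e → F e ≡ true → E T e ≡ true
    F⊆T e p = g-supp e λ z → case trans (sym z) (fromDoes (g e ℕ.≟ 2) p) of λ ()

    F-bridge : ∀ {e} → F e ≡ true → Block B → E B e ≡ true → Bridge B e
    F-bridge {B} {e} p isB e∈B with kind isB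
    ... | inj₁ (_ , unit) = case trans (sym (unit e e∈B)) (fromDoes (g e ℕ.≟ 2) p) of λ ()
    ... | inj₂ (e′ , br@(single , _) , _) = subst (Bridge B) (sym (Equivalence.to (single e) e∈B)) br

    Grown : Fin m → Fin n → Set
    Grown e w = ∃ λ u → Σ (Reach G F u w) λ r → Simple r × OnE r e × ∃ λ C → Block C × IsCircle G C × V C u ≡ true

    -- The path is prolonged at its start through neighbouring bridges until a circle block is met.
    -- The fuel suffices because a simple path has fewer than `n` edges.
    grow : ∀ j {u w e} (r : Reach G F u w) → Simple r → OnE r e → n ≤ len r + j → Grown e w
    grow zero r simple _ le = ⊥-elim (ℕₚ.<⇒≱ (simple-short r simple) (≤-trans le (≤-reflexive (+-identityʳ _))))
    grow (suc j) {u} {w} {e} r@(step a b p refl r′) simple@(u∉r′ , simple′) on le with block-of (F⊆T a p)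
    ... | B , isB , a∈B with bridge-neighbour isB (F-bridge p isB a∈B) b
    ...   | e₁ , b₁ , p₁ , q₁ , e₁∉B with block-of p₁
    ...     | B₁ , isB₁ , e₁∈B₁ with kind isB₁
    ...       | inj₁ (circ , _) = u , r , simple , on , B₁ , isB₁ , circ , vertex∈ isB₁ e₁∈B₁ q₁
    ...       | inj₂ (e′ , (single , ¬l) , two) =
      grow j (step e₁ (not b₁) F₁ refl (subst (λ z → Reach G F z w) (sym (endpt-not-not q₁)) r)) (new∉ , transport r simple) (inj₂ (on′ r on)) (≤-trans le (≤-reflexive (trans (+-suc (len r) j) (cong (λ i → suc (i + j)) (len′ r)))))
      where
      e₁≡e′ : e₁ ≡ e′
      e₁≡e′ = Equivalence.to (single e₁) e₁∈B₁
      F₁ : F e₁ ≡ true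
      F₁ = dec-true (g e₁ ℕ.≟ 2) (trans (cong g e₁≡e′) two)
      -- The far end of the prepended step is `endpt e₁ (not (not b₁))`, which does not reduce to
      -- `u`, so the old path is transported; the following facts say that this preserves all its
      -- features.
      coerce : ∀ {z z′} → z ≡ z′ → Reach G F z w → Reach G F z′ w
      coerce eq = subst (λ z → Reach G F z w) eq
      simple-coerce : ∀ {z z′} (eq : z ≡ z′) (r : Reach G F z w) → Simple r → Simple (coerce eq r)
      simple-coerce refl r s = s
      transport : (r : Reach G F u w) → Simple r → Simple (coerce (sym (endpt-not-not q₁)) r)
      transport = simple-coerce _
      on-coerce : ∀ {z z′ e} (eq : z ≡ z′) (r : Reach G F z w) → OnE r e → OnE (coerce eq r) e
      on-coerce refl r s = s
      on′ : (r : Reach G F u w) → OnE r e → OnE (coerce (sym (endpt-not-not q₁)) r) e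
      on′ = on-coerce _
      len-coerce : ∀ {z z′} (eq : z ≡ z′) (r : Reach G F z w) → len r ≡ len (coerce eq r)
      len-coerce refl r = refl
      len′ : (r : Reach G F u w) → len r ≡ len (coerce (sym (endpt-not-not q₁)) r)
      len′ = len-coerce _
      onV-coerce : ∀ {z z′ v} (eq : z ≡ z′) (r : Reach G F z w) → OnV (coerce eq r) v → OnV r v
      onV-coerce refl r s = s
      new = endpt e₁ (not b₁)
      u∈B₁ : V B₁ u ≡ true
      u∈B₁ = vertex∈ isB₁ e₁∈B₁ q₁
      new∈B₁ : V B₁ new ≡ true
      new∈B₁ = proj₁ isB₁ e₁ (not b₁) e₁∈B₁
      u≢new : u ≢ new
      u≢new eq = subst (λ e → ¬ IsLoop G e) (sym e₁≡e′) ¬l (loop b₁ (trans q₁ eq))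
        where
        loop : ∀ c → endpt e₁ c ≡ endpt e₁ (not c) → IsLoop G e₁
        loop false p = p
        loop true p = sym p
      new∉ : ¬ OnV (coerce (sym (endpt-not-not q₁)) r) new
      new∉ s with onV-coerce (sym (endpt-not-not q₁)) r s
      ... | inj₁ eq = u≢new (sym eq)
      ... | inj₂ s′ with simple-prefix r′ simple′ s′
      -- If the new vertex were already on the path, the stretch from `u` to it would be an ear of
      -- `B₁`. Then `a` would lie in `B₁` and equal `e₁`, contrary to `e₁` lying outside `B`.
      ...   | r″ , simple″ , sub″ = true≢false a∈B (trans (cong (E B) (trans
                (Equivalence.to (single a) (block-absorbs-path isB₁ u∈B₁ new∈B₁ u≢new F⊆T (step a b p refl r″) (u∉r′ ∘ sub″ , simple″) a (inj₁ refl)))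
                (sym e₁≡e′))) e₁∉B)

    nonempty : ∀ {u w e} (r : Reach G F u w) → Simple r → OnE r e → u ≢ w
    nonempty (step _ _ _ _ r) (u∉r , _) _ refl = u∉r (end-onV r)

  -- The path is obtained by extending the bridge at both ends until circles are reached.
  bridge-on-path : ∀ e → E T e ≡ true → ¬ InCircleBlock G T e → OnBlockPath G T e
  bridge-on-path e p ¬circle with block-of p
  ... | B , isB , e∈B with kind isB
  ...   | inj₁ (circ , _) = ⊥-elim (¬circle (B , isB , circ , e∈B))
  ...   | inj₂ (e′ , (single , ¬l) , two) with Equivalence.to (single e) e∈B
  ...     | refl with grow n (step e false (dec-true (g e ℕ.≟ 2) two) refl here) (¬l , tt) (inj₁ refl) (m≤n+m n 1)
  ...       | u₁ , r₁ , s₁ , on₁ , C₁ , isC₁ , circ₁ , u₁∈C₁ with grow n (reverse r₁) (simple-reverse r₁ s₁) (onE-reverse r₁ on₁) (m≤n+m n (len (reverse r₁)))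
  ...         | u₂ , r₂ , s₂ , on₂ , C₂ , isC₂ , circ₂ , u₂∈C₂ =
    len r₂ , vertexAt r₂ , edgeAt r₂ , vertexAt-injective r₂ s₂ ,
    (λ i → F⊆T _ (proj₁ (edgeAt-ends r₂ i)) , proj₂ (edgeAt-ends r₂ i) , noncircle (proj₁ (edgeAt-ends r₂ i))) ,
    (C₂ , C₁ , isC₂ , circ₂ , isC₁ , circ₁ ,
      -- If both ends lay on one circle block, the path would be an ear of it and `e` would belong
      -- to a circle.
      (λ same → ¬circle (C₂ , isC₂ , circ₂ , block-absorbs-path isC₂ u₂∈C₂ (trans (proj₁ same u₁) u₁∈C₁) (nonempty r₂ s₂ on₂) F⊆T r₂ s₂ e on₂)) ,
      u₂∈C₂ , subst (λ z → V C₁ z ≡ true) (sym (vertexAt-last r₂)) u₁∈C₁) ,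
    onE⇒edgeAt r₂ on₂
    where
    noncircle : ∀ {e} → F e ≡ true → ∃ λ B → IsBlock G T B × ¬ IsCircle G B × E B e ≡ true
    noncircle {e} q with block-of (F⊆T e q)
    ... | B , isB , e∈B = B , isB , (λ circ → circle-not-bridge circ (F-bridge q isB e∈B)) , e∈B

-- Passage between integral flows and non-negative ones.

any⁺ : ∀ {A : Set} (p : A → Bool) {xs x} → x ∈ xs → p x ≡ true → any p xs ≡ true
any⁺ p (here refl) q = ∨-introˡ q
any⁺ p (there i) q = ∨-introʳ (any⁺ p i q)

any⁻ : ∀ {A : Set} (p : A → Bool) xs → any p xs ≡ true → ∃ λ x → p x ≡ true
any⁻ p (x ∷ xs) q with ∨-elim q
... | inj₁ r = x , r
... | inj₂ r = any⁻ p xs r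

-- Summands of non-negative product do not have opposite signs, so both take the sign of the sum and
-- absolute values add. A zero summand fits as well, because `s ◃ 0` is zero for either sign.
conformal : ∀ i j → 0ℤ ℤ.≤ i * j →
            i ≡ ℤ.sign (i ℤ.+ j) ◃ ℤ.∣ i ∣ × j ≡ ℤ.sign (i ℤ.+ j) ◃ ℤ.∣ j ∣ × ℤ.∣ i ℤ.+ j ∣ ≡ ℤ.∣ i ∣ + ℤ.∣ j ∣
conformal (ℤ.+ a) (ℤ.+ b) p = sym (ℤₚ.+◃n≡+n a) , sym (ℤₚ.+◃n≡+n b) , refl
conformal (ℤ.+ zero) ℤ.-[1+ b ] p = refl , refl , refl
conformal ℤ.-[1+ a ] (ℤ.+ zero) p = refl , refl , sym (+-identityʳ _)
conformal ℤ.-[1+ a ] ℤ.-[1+ b ] p = refl , refl , cong suc (sym (+-suc a b))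
conformal (ℤ.+ suc a) ℤ.-[1+ b ] ()
conformal ℤ.-[1+ a ] (ℤ.+ suc b) ()

sumℤ-difference : ∀ {k} (t : Fin k → ℤ) (a b : Fin k → ℕ) → (∀ i → t i ≡ ℤ.+ a i ℤ.- ℤ.+ b i) →
                  sumℤ (Data.List.map t (allFin k)) ≡ ℤ.+ sum a ℤ.- ℤ.+ sum b
sumℤ-difference {k} t a b eq = go k id
  where
  go : ∀ j (f : Fin j → Fin k) → sumℤ (Data.List.map t (tabulate f)) ≡ ℤ.+ sum (a ∘ f) ℤ.- ℤ.+ sum (b ∘ f)
  go zero f = refl
  go (suc j) f = trans (cong₂ ℤ._+_ (eq (f zero)) (go j (f ∘ suc)))
    (solve 4 (λ a b c d → (a :- b) :+ (c :- d) := (a :+ c) :- (b :+ d)) refl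
      (ℤ.+ a (f zero)) (ℤ.+ b (f zero)) (ℤ.+ sum (a ∘ f ∘ suc)) (ℤ.+ sum (b ∘ f ∘ suc)))
    where open ℤ-Solver.+-*-Solver

module Integral {n m : ℕ} (G : SignedGraph n m) (ω : EndSigns m) (orientation : IsOrientation G ω) (f : Fin m → ℤ) where
  open SignedGraph G
  open Incidence G

  T : Sub n m
  T = supp G f

  sgn : Fin m → Sign
  sgn e = ℤ.sign (f e)

  g : Fin m → ℕ
  g e = ℤ.∣ f e ∣

  -- Switching the edges on which f is negative makes f non-negative.
  ω′ : EndSigns m
  ω′ e b = ω e b S.* sgn e

  open Walks G ω′ using (Flow; Indecomposable)

  f≡ : ∀ e → f e ≡ sgn e ◃ g e
  f≡ e = sym (ℤₚ.◃-inverse (f e))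

  -- Both ends of an edge are switched together, which leaves the product of their signs unchanged.
  orientation′ : IsOrientation G ω′
  orientation′ e p = trans (orientation e p) (cong opposite (lem (ω e false) (ω e true) (sgn e)))
    where
    lem : ∀ a b s → a S.* b ≡ (a S.* s) S.* (b S.* s)
    lem S.+ S.+ S.+ = refl
    lem S.+ S.+ S.- = refl
    lem S.+ S.- S.+ = refl
    lem S.+ S.- S.- = refl
    lem S.- S.+ S.+ = refl
    lem S.- S.+ S.- = refl
    lem S.- S.- S.+ = refl
    lem S.- S.- S.- = refl

  opaque
    unfolding inc

    -- The sign of `f` on an edge is absorbed into the orientation: an end contributes `h` with the
    -- sign it has under `ω′`.
    boundary≡ : ∀ h v → boundary G ω (λ e → sgn e ◃ h e) v ≡ ℤ.+ inc (endsOf ω′ S.+) h v ℤ.- ℤ.+ inc (endsOf ω′ S.-) h v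
    boundary≡ h v = sumℤ-difference _ (λ e → end S.+ e false + end S.+ e true) (λ e → end S.- e false + end S.- e true)
      λ e → trans (cong₂ ℤ._+_ (lem e false) (lem e true))
        (solve 4 (λ a b c d → (a :- b) :+ (c :- d) := (a :+ c) :- (b :+ d)) refl
          (ℤ.+ end S.+ e false) (ℤ.+ end S.- e false) (ℤ.+ end S.+ e true) (ℤ.+ end S.- e true))
      where
      open ℤ-Solver.+-*-Solver
      end : Sign → Fin m → Bool → ℕ
      end s = atEnd (endsOf ω′ s) h v
      value : ∀ s k → s ◃ k ≡ ℤ.+ (if does (s ≟ₛ S.+) then k else 0) ℤ.- ℤ.+ (if does (s ≟ₛ S.-) then k else 0)
      value S.+ k = trans (ℤₚ.+◃n≡+n k) (sym (ℤₚ.+-identityʳ _))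
      value S.- k = trans (ℤₚ.-◃n≡-n k) (sym (ℤₚ.+-identityˡ _))
      lem : ∀ e b → (if does (endpt e b ≟ v) then (ω e b ◃ 1) ℤ.* (sgn e ◃ h e) else 0ℤ) ≡ ℤ.+ end S.+ e b ℤ.- ℤ.+ end S.- e b
      lem e b with does (endpt e b ≟ v)
      ... | false rewrite ∧-zeroʳ (does (ω′ e b ≟ₛ S.+)) | ∧-zeroʳ (does (ω′ e b ≟ₛ S.-)) = refl
      ... | true rewrite ∧-identityʳ (does (ω′ e b ≟ₛ S.+)) | ∧-identityʳ (does (ω′ e b ≟ₛ S.-)) =
        trans (sym (ℤₚ.◃-distrib-* (ω e b) (sgn e) 1 (h e))) (trans (cong (ω′ e b ◃_) (ℕₚ.*-identityˡ (h e))) (value (ω′ e b) (h e)))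

    boundary-cong : ∀ {h k} → (∀ e → h e ≡ k e) → ∀ v → boundary G ω h v ≡ boundary G ω k v
    boundary-cong p v = cong sumℤ (map-cong
      (λ e → cong₂ ℤ._+_ (cong (λ z → if does (endpt e false ≟ v) then (ω e false ◃ 1) ℤ.* z else 0ℤ) (p e))
                         (cong (λ z → if does (endpt e true ≟ v) then (ω e true ◃ 1) ℤ.* z else 0ℤ) (p e))) (allFin m))

  flow⁺ : ∀ {h} → Flow h → IsFlow G ω (λ e → sgn e ◃ h e)
  flow⁺ {h} flow v = trans (boundary≡ h v) (ℤₚ.i≡j⇒i-j≡0 (cong ℤ.+_ (flow v)))

  flow⁻ : ∀ {k h} → (∀ e → k e ≡ sgn e ◃ h e) → IsFlow G ω k → Flow h
  flow⁻ {h = h} p flow v = ℤₚ.+-injective (ℤₚ.i-j≡0⇒i≡j _ _ (trans (sym (boundary≡ h v)) (trans (boundary-cong (sym ∘ p) v) (flow v))))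

  nz⁻ : ∀ {e} → nz G f e ≡ true → g e ≢ 0
  nz⁻ {e} p q = fromDoes-false (f e ℤ.≟ 0ℤ) (not-true p) (ℤₚ.∣i∣≡0⇒i≡0 q)

  nz⁺ : ∀ {e} → g e ≢ 0 → nz G f e ≡ true
  nz⁺ {e} p = cong not (dec-false (f e ℤ.≟ 0ℤ) λ q → p (cong ℤ.∣_∣ q))

  wfT : WellFormed G T
  wfT e b p = any⁺ _ (∈-allFin e) (∧-intro p (Paths.incidentB-end G b refl))

  T-end : ∀ v → V T v ≡ true → ∃₂ λ e b → E T e ≡ true × endpt e b ≡ v
  T-end v p with any⁻ _ (allFin m) p
  ... | e , q with Paths.incidentB⁻ G (∧-elimʳ {nz G f e} q)
  ...   | b , r = e , b , ∧-elimˡ q , r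

  nonzero⁻ : ∀ {h : Fin m → ℤ} → NonZero G h → ∃ λ e → ℤ.∣ h e ∣ ≢ 0
  nonzero⁻ {h} p with any? (λ e → ¬? (ℤ.∣ h e ∣ ℕ.≟ 0))
  ... | yes q = q
  ... | no q = ⊥-elim (p λ e → ℤₚ.∣i∣≡0⇒i≡0 (decidable-stable (ℤ.∣ h e ∣ ℕ.≟ 0) λ r → q (e , r)))

  -- A splitting of `g` becomes one of `f` when both parts are given the signs of `f`; equal signs
  -- make it conformal.
  indecomposable⁺ : ConfIndecomposable G ω f → Indecomposable g
  indecomposable⁺ (nonzero , ¬dec) g₁ g₂ flow₁ flow₂ split≡ nz₁ nz₂ = ¬dec (nonzero , (λ e → sgn e ◃ g₁ e) , (λ e → sgn e ◃ g₂ e) ,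
      flow⁺ {g₁} flow₁ , flow⁺ {g₂} flow₂ , nonzero⁺ {g₁} nz₁ , nonzero⁺ {g₂} nz₂ ,
      (λ e → trans (f≡ e) (trans (cong (sgn e ◃_) (split≡ e)) (ℤₚ.◃-distrib-+ (sgn e) (g₁ e) (g₂ e)))) ,
      λ e → subst (0ℤ ℤ.≤_) (trans (sym (ℤₚ.+◃n≡+n (g₁ e ℕ.* g₂ e))) (trans (cong (_◃ (g₁ e ℕ.* g₂ e)) (sym (s*s≡+ (sgn e))))
              (ℤₚ.◃-distrib-* (sgn e) (sgn e) (g₁ e) (g₂ e)))) (ℤ.+≤+ z≤n))
    where
    nonzero⁺ : ∀ {h} → (∃ λ e → h e ≢ 0) → NonZero G (λ e → sgn e ◃ h e)
    nonzero⁺ {h} (e , p) q = p (trans (sym (ℤₚ.abs-◃ (sgn e) (h e))) (cong ℤ.∣_∣ (q e)))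

  -- Conformality prevents cancellation, so absolute values split `g`; and since both parts carry
  -- the signs of `f`, their absolute values are conserved under `ω′`.
  indecomposable⁻ : Indecomposable g → ¬ ConfDecomposable G ω f
  indecomposable⁻ indec (_ , f₁ , f₂ , flow₁ , flow₂ , nz₁ , nz₂ , split≡ , conf) =
    indec (ℤ.∣_∣ ∘ f₁) (ℤ.∣_∣ ∘ f₂) (flow⁻ {f₁} signed₁ flow₁) (flow⁻ {f₂} signed₂ flow₂)
      (λ e → trans (cong ℤ.∣_∣ (split≡ e)) (proj₂ (proj₂ (conformal (f₁ e) (f₂ e) (conf e))))) (nonzero⁻ {f₁} nz₁) (nonzero⁻ {f₂} nz₂)
    where
    signed₁ : ∀ e → f₁ e ≡ sgn e ◃ ℤ.∣ f₁ e ∣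
    signed₁ e = trans (proj₁ (conformal (f₁ e) (f₂ e) (conf e))) (cong (λ z → ℤ.sign z ◃ ℤ.∣ f₁ e ∣) (sym (split≡ e)))
    signed₂ : ∀ e → f₂ e ≡ sgn e ◃ ℤ.∣ f₂ e ∣
    signed₂ e = trans (proj₁ (proj₂ (conformal (f₁ e) (f₂ e) (conf e)))) (cong (λ z → ℤ.sign z ◃ ℤ.∣ f₂ e ∣) (sym (split≡ e)))

  DirectedIndicator : Set
  DirectedIndicator = ∃ λ ωf → Direction G T ωf × ∃ λ I → IsIndicator G T I × (∀ e → f e ≡ coupling G ω ωf T e * I e)

  *-*-cancel : ∀ s t → s S.* (s S.* t) ≡ t
  *-*-cancel S.+ t = refl
  *-*-cancel S.- S.+ = refl
  *-*-cancel S.- S.- = refl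

  -- The coupling of `ω` with the switched orientation `ω′` is the sign of `f` on the support, so
  -- `ω′` serves as the direction and the absolute value of `f` as the indicator.
  forward : IsFlow G ω f → ConfIndecomposable G ω f → SesquiEulerianCircleTree G T × DirectedIndicator
  forward isFlow indec = sesqui , ω′ , direction , ℤ.+_ ∘ g ,
      (λ e → (λ p → cong ℤ.+_ (circle-one e p)) , (λ p → cong ℤ.+_ (path-two e p)) ,
             λ ¬p ¬q → cong ℤ.+_ (decidable-stable (g e ℕ.≟ 0) λ r → ¬q (bridge-on-path e (nz⁺ r) ¬p))) ,
      coupled
    where
    open Forward G T wfT ω′ g (λ e → nz⁻) (λ e → nz⁺) T-end orientation′ (flow⁻ {f} f≡ isFlow) (nonzero⁻ {f} (proj₁ indec)) (indecomposable⁺ indec)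
    coupled : ∀ e → f e ≡ coupling G ω ω′ T e * ℤ.+ g e
    coupled e with nz G f e in eq
    ... | true = trans (f≡ e) (sym (trans (cong₂ (λ s z → (s ◃ 1) * z) (*-*-cancel (ω e false) (sgn e)) (sym (ℤₚ.+◃n≡+n (g e))))
                   (trans (sym (ℤₚ.◃-distrib-* (sgn e) S.+ 1 (g e))) (cong₂ _◃_ (S-identityʳ (sgn e)) (ℕₚ.*-identityˡ (g e))))))
      where
      S-identityʳ : ∀ s → s S.* S.+ ≡ s
      S-identityʳ S.+ = refl
      S-identityʳ S.- = refl
    ... | false = decidable-stable (f e ℤ.≟ 0ℤ) λ r → true≢false (cong not (dec-false (f e ℤ.≟ 0ℤ) r)) eq

  module _ (tree : CircleTree G T) (ωf : EndSigns m) (dir : Direction G T ωf) (I : Fin m → ℤ) (isI : IsIndicator G T I)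
           (coupled : ∀ e → f e ≡ coupling G ω ωf T e * I e) where
    private
      c : Fin m → ℤ
      c e = (ω e false S.* ωf e false) ◃ 1

      on-support : ∀ {e} → E T e ≡ true → f e ≡ c e * I e
      on-support {e} p = trans (coupled e) (cong (λ t → (if t then c e else 0ℤ) * I e) p)

      -- Membership in circle blocks and block paths is never decided: if `I e` were neither value,
      -- both would fail, so `I e` would be 0 and `e` would not be in the support.
      I-value : ∀ {e} → E T e ≡ true → I e ≡ 1ℤ ⊎ I e ≡ ℤ.+ 2
      I-value {e} p = decidable-stable (I e ℤ.≟ 1ℤ ⊎-dec I e ℤ.≟ ℤ.+ 2) λ ¬v → nz⁻ p (cong ℤ.∣_∣ (trans (on-support p)
        (trans (cong (c e *_) (proj₂ (proj₂ (isI e)) (¬v ∘ inj₁ ∘ proj₁ (isI e)) (¬v ∘ inj₂ ∘ proj₁ (proj₂ (isI e))))) (ℤₚ.*-zeroʳ (c e)))))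

      g≡I : ∀ {e} → E T e ≡ true → g e ≡ ℤ.∣ I e ∣
      g≡I {e} p = trans (cong ℤ.∣_∣ (on-support p)) (trans (ℤₚ.abs-* (c e) (I e))
        (trans (cong (ℕ._* ℤ.∣ I e ∣) (ℤₚ.abs-◃ (ω e false S.* ωf e false) 1)) (ℕₚ.*-identityˡ _)))

      sgn≡ : ∀ {e} → E T e ≡ true → sgn e ≡ ω e false S.* ωf e false
      sgn≡ {e} p = trans (cong ℤ.sign (on-support p)) (go (ω e false S.* ωf e false) (I-value p))
        where
        go : ∀ s → I e ≡ 1ℤ ⊎ I e ≡ ℤ.+ 2 → ℤ.sign ((s ◃ 1) * I e) ≡ s
        go S.+ (inj₁ q) rewrite q = refl
        go S.- (inj₁ q) rewrite q = refl
        go S.+ (inj₂ q) rewrite q = refl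
        go S.- (inj₂ q) rewrite q = refl

      -- A positive indicator makes the coupling equal to the sign of `f`, so switching `ω` by that
      -- sign reproduces `ωf` at the first end. The edge sign then determines the second end.
      ω′≡ωf : ∀ {e} → E T e ≡ true → ∀ b → ω′ e b ≡ ωf e b
      ω′≡ωf {e} p false = trans (cong (ω e false S.*_) (sgn≡ p)) (*-*-cancel (ω e false) (ωf e false))
      ω′≡ωf {e} p true = determined (ω′ e false) (ω′ e true) (ωf e true)
          (opposite-injective (trans (sym (orientation′ e refl)) (trans (proj₁ dir e p) (cong (λ s → opposite (s S.* ωf e true)) (sym (ω′≡ωf p false))))))
        where
        determined : ∀ s a b → s S.* a ≡ s S.* b → a ≡ b
        determined s a b q = trans (sym (*-*-cancel s a)) (trans (cong (s S.*_) q) (*-*-cancel s b))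

    direction′ : Direction G T ω′
    direction′ = (λ e _ → orientation′ e refl) ,
      (λ v p → (λ s → proj₁ (proj₁ (proj₂ dir) v p) λ e b q r → trans (sym (ω′≡ωf q b)) (s e b q r)) ,
               (λ s → proj₂ (proj₁ (proj₂ dir) v p) λ e b q r → trans (sym (ω′≡ωf q b)) (s e b q r))) ,
      λ C isC circ v isCut v∈C → [ (λ s → inj₁ λ e b q r → trans (ω′≡ωf (proj₂ (proj₁ (proj₂ isC)) e q) b) (s e b q r)) ,
                                   (λ s → inj₂ λ e b q r → trans (ω′≡ωf (proj₂ (proj₁ (proj₂ isC)) e q) b) (s e b q r)) ]
                                 (proj₂ (proj₂ dir) C isC circ v isCut v∈C)

    backward : ConfIndecomposable G ω f
    backward = (λ z → nz⁻ (proj₂ (proj₁ tree)) (cong ℤ.∣_∣ (z (proj₁ (proj₁ tree))))) , indecomposable⁻ (Backward.indecomposable G T wfT ω′ g tree direction′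
        (λ e → nz⁻) (λ e → nz⁺)
        (λ { e p@(C , isC , _ , e∈C) → trans (g≡I (proj₂ (proj₁ (proj₂ isC)) e e∈C)) (cong ℤ.∣_∣ (proj₁ (isI e) p)) })
        (λ { e p@(_ , _ , es , _ , edges , _ , i , q) → trans (g≡I (subst (λ z → E T z ≡ true) q (proj₁ (edges i)))) (cong ℤ.∣_∣ (proj₁ (proj₂ (isI e)) p)) })
        (λ e ¬p ¬q → cong ℤ.∣_∣ (trans (coupled e) (trans (cong (coupling G ω ωf T e *_) (proj₂ (proj₂ (isI e)) ¬p ¬q)) (ℤₚ.*-zeroʳ (coupling G ω ωf T e))))))

theorem4p6 : ∀ {n m : ℕ} (G : SignedGraph n m) (ω : EndSigns m) → IsOrientation G ω →
    (f : Fin m → ℤ) → IsFlow G ω f →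
    ConfIndecomposable G ω f ⇔
    (SesquiEulerianCircleTree G (supp G f) ×
    ∃ λ ωf → Direction G (supp G f) ωf ×
    ∃ λ I → IsIndicator G (supp G f) I ×
    (∀ e → f e ≡ coupling G ω ωf (supp G f) e * I e))
theorem4p6 G ω orientation f flow = mk⇔ (forward flow)
  λ { ((tree , _) , ωf , dir , I , isI , coupled) → backward tree ωf dir I isI coupled }
  where open Integral G ω orientation f
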